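{- Let $G$ be a 2-edge-connected planar cubic graph. Then every edge $e$ of $G$ either is contained in a 2-edge-cut of $G$, or there exists a 2-factor $F$ of $G$ and a cycle $C$ of $F$ such that $e$ is a chord of $C$.
   Context: Graphs are finite and may have multiple edges but no self-loops. A 2-edge-cut is a set of two edges whose removal disconnects the graph. A 2-factor is a spanning subgraph in which every vertex has degree 2 (a disjoint union of cycles covering all vertices; a cycle may have length 2, formed by two parallel edges). An edge $e$ is a chord of a cycle $C$ if $e$ is not an edge of $C$ and both endpoints of $e$ lie on $C$. -}

module Defs where

open import Data.Nat using (ℕ; zero; suc; _+_; _*_)
open import Data.Bool using (Bool; true; false; not; T)
open import Data.Fin using (Fin; _≟_)
open import Data.List using (List; map; allFin)
open import Data.Nat.ListAction using (sum)
open import Data.Product using (Σ; ∃; ∃-syntax; _×_; _,_; proj₁; proj₂)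
open import Data.Sum using (_⊎_)
open import Relation.Nullary using (¬_; Dec; yes; no)
open import Relation.Binary.PropositionalEquality using (_≡_; _≢_)
open import Function.Bundles using (_↔_; Inverse)

record Graph : Set where
  field
    n        : ℕ
    m        : ℕ
    ends     : Fin m → Fin n × Fin n
    loopless : ∀ e → proj₁ (ends e) ≢ proj₂ (ends e)

open Graph public

module _ (G : Graph) where

  Vertex : Set
  Vertex = Fin (n G)

  Edge : Set
  Edge = Fin (m G)

  Joins : Edge → Vertex → Vertex → Set
  Joins e u w = (ends G e ≡ (u , w)) ⊎ (ends G e ≡ (w , u))

  incid : Edge → Vertex → ℕ
  incid e v = ind (proj₁ (ends G e) ≟ v) + ind (proj₂ (ends G e) ≟ v)
    where
    ind : ∀ {A : Set} → Dec A → ℕ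
    ind (yes _) = 1
    ind (no _)  = 0

  degreeIn : (Edge → Bool) → Vertex → ℕ
  degreeIn S v = sum (map (λ e → sel (S e) (incid e v)) (allFin (m G)))
    where
    sel : Bool → ℕ → ℕ
    sel true  k = k
    sel false _ = 0

  degree : Vertex → ℕ
  degree = degreeIn (λ _ → true)

  Cubic : Set
  Cubic = ∀ v → degree v ≡ 3

  data Reach (P : Edge → Set) : Vertex → Vertex → Set where
    here : ∀ {v} → Reach P v v
    step : ∀ {u w v} (e : Edge) → P e → Joins e u w → Reach P w v → Reach P u v

  ConnectedWithout : (Edge → Set) → Set
  ConnectedWithout X = ∀ u v → Reach (λ e → ¬ X e) u v

  Connected : Set
  Connected = ConnectedWithout (λ _ → Data.Empty.⊥)
    where import Data.Empty

  TwoEdgeConnected : Set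
  TwoEdgeConnected = Connected × (∀ f → ConnectedWithout (λ e → e ≡ f))

  IsTwoEdgeCut : Edge → Edge → Set
  IsTwoEdgeCut e f = e ≢ f × ¬ ConnectedWithout (λ d → (d ≡ e) ⊎ (d ≡ f))

  InTwoEdgeCut : Edge → Set
  InTwoEdgeCut e = ∃[ f ] IsTwoEdgeCut e f

  IsTwoFactor : (Edge → Bool) → Set
  IsTwoFactor F = ∀ v → degreeIn F v ≡ 2

  -- For a 2-factor F, its cycles are its connected components.
  -- The cycle of F through vertex w: vertices = those F-reachable from w,
  -- edges = the F-edges having an end in that vertex set.
  OnCycle : (Edge → Bool) → Vertex → Vertex → Set
  OnCycle F w v = Reach (λ d → T (F d)) w v

  EdgeOfCycle : (Edge → Bool) → Vertex → Edge → Set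
  EdgeOfCycle F w e = T (F e) × OnCycle F w (proj₁ (ends G e))

  IsChord : (Edge → Bool) → Vertex → Edge → Set
  IsChord F w e = ¬ EdgeOfCycle F w e
                × OnCycle F w (proj₁ (ends G e))
                × OnCycle F w (proj₂ (ends G e))

  -- Planarity via combinatorial maps (rotation systems) of genus 0.
  -- Darts: an edge together with a side; head of a dart is the end at
  -- that side.

  Dart : Set
  Dart = Edge × Bool

  head : Dart → Vertex
  head (e , true)  = proj₁ (ends G e)
  head (e , false) = proj₂ (ends G e)

  flip : Dart → Dart
  flip (e , b) = (e , not b)

  iter : ∀ {A : Set} → (A → A) → ℕ → A → A
  iter f zero    x = x
  iter f (suc k) x = f (iter f k x)

  SameOrbit : (Dart → Dart) → Dart → Dart → Set
  SameOrbit φ d d' = ∃[ k ] iter φ k d ≡ d'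

  IsRotation : (Dart ↔ Dart) → Set
  IsRotation σ = (∀ d → head (to d) ≡ head d)
               × (∀ d d' → head d ≡ head d' → SameOrbit to d d')
    where open Inverse σ

  HasOrbitCount : (Dart → Dart) → ℕ → Set
  HasOrbitCount φ k =
    Σ (Dart → Fin k) λ c →
        (∀ i → ∃[ d ] c d ≡ i)
      × (∀ d d' → c d ≡ c d' → SameOrbit φ d d')
      × (∀ d d' → SameOrbit φ d d' → c d ≡ c d')

  -- G is planar: it has a rotation system whose faces (orbits of σ ∘ flip)
  -- satisfy Euler's formula V − E + F = 2 (genus 0).  (Intended for
  -- connected graphs, which is the only case used.)
  Planar : Set
  Planar = ∃[ σ ] ∃[ f ] IsRotation σ
                       × HasOrbitCount (λ d → Inverse.to σ (flip d)) f
                       × (n G + f ≡ m G + 2)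

{-# OPTIONS --safe #-}
-- A 2-factor of a plane cubic graph is the boundary between two colours of its faces, where no vertex
-- sees three faces of one colour.  Delete e and suppress its ends, so that the two sides of e become
-- one face z.  It then suffices to find such a colouring in which z is false, the two faces at the
-- ends of e are true, and these are linked by a chain of adjacent true faces: a closed curve through
-- this chain and along e crosses the 2-factor only twice, next to the two ends of e, so both ends
-- are on the same cycle.
--
-- Such a linked colouring exists for any two edges of any face z, by induction on the graph.  To
-- make cuts of two or three edges tractable, the claim is also proved for a corner of z in place of
-- an edge; there exactly one of the two other faces at the corner has to be true, and it gets
-- linked.  Of the three non-constant ways to colour the faces around a 3-edge-cut with z false, each
-- side then realises at least two, so both sides realise a common one.  Without such cuts, an edge
-- terminal makes it possible to remove the next edge and merge the faces at its ends, and a face x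
-- next to a corner terminal, of even length after at most one contraction, can be removed by
-- colouring it true and merging every second face around it into z.
module Submission where

open import Data.Bool using (Bool; true; false; not; _∧_; _xor_; if_then_else_; T; T?)
open import Data.Nat using (ℕ; zero; suc; _+_; _<_; s≤s; z≤n; s≤s⁻¹; _≤_; _*_)
open import Data.Nat.Properties using (+-suc; +-identityʳ; ≤-refl; m≤n⇒m≤1+n; <-≤-trans; <-trans; +-assoc; +-comm; suc-injective; m+n≡0⇒m≡0; m+n≡0⇒n≡0; ≤-reflexive; <-cmp; n<1+n; m<n⇒m<1+n; <-irrefl; *-identityʳ)
open import Data.Fin using (Fin; zero; suc; punchIn; punchOut; toℕ; _↑ˡ_; _↑ʳ_; splitAt; fromℕ<)
open import Data.Fin.Properties using (_≟_; any?; punchIn-punchOut; punchInᵢ≢i; pigeonhole; splitAt-↑ˡ; splitAt-↑ʳ; toℕ<n; toℕ-fromℕ<; toℕ-injective; join-splitAt)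
open import Data.Product using (Σ; ∃-syntax; _×_; _,_; proj₁; proj₂)
open import Data.Sum using (_⊎_; inj₁; inj₂; [_,_]′)
open import Data.Empty using (⊥; ⊥-elim)
open import Relation.Nullary using (¬_; Dec; yes; no; does; ¬?)
open import Relation.Binary.PropositionalEquality using (_≡_; _≢_; refl; sym; trans; cong; cong₂; subst; module ≡-Reasoning)
open import Data.List using (List; []; _∷_; map; allFin; tabulate)
open import Data.List.Relation.Unary.All using (All; []; _∷_)
open import Relation.Nullary.Decidable using (_×-dec_; _⊎-dec_)
open import Data.List.Relation.Unary.Any using (Any; here; there)
open import Data.List.Properties using (map-cong; map-tabulate)
open import Function.Base using (id)
open import Function.Bundles using (_↔_; Inverse)
open import Relation.Binary.Definitions using (tri<; tri≈; tri>)
import Data.Bool.Properties as 𝔹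
import Data.Nat.Properties as ℕ
import Data.Nat.ListAction as List

-- Linear algebra over the field with two elements

-- Genus zero has to survive every reduction. Euler's formula is therefore used only once, to show
-- that every even subgraph is the boundary of a set of faces; this linear statement is what the
-- reductions carry along. It replaces the Jordan curve theorem: by the Fredholm alternative over
-- the field with two elements, a closed curve in the dual is an edge cut (`separation`). The darts
-- and the vertex rotation `r` never change; a reduction marks darts as absent, redirects `mate` and
-- changes face labels, so terminals need no renaming.
--
-- Edge terminals alone do not get past a 3-edge-cut. For the two faces other than `z` the patterns
-- are true/true, true/false and false/true. Edge terminals might realise only true/true on one side
-- while the other side realises only the remaining two. A corner terminal excludes exactly
-- true/true, and this yields two patterns out of three. Both kinds of terminal have to go through
-- one induction, since the contraction that repairs the parity of `x` turns a corner terminal into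
-- an edge terminal.

¬true⇒false : ∀ {b} → ¬ (b ≡ true) → b ≡ false
¬true⇒false {true}  h = ⊥-elim (h refl)
¬true⇒false {false} _ = refl

true≢false : ∀ {b} → b ≡ true → b ≡ false → ⊥
true≢false refl ()

xor-interchange : ∀ a b c d → (a xor b) xor (c xor d) ≡ (a xor c) xor (b xor d)
xor-interchange true  true  c d = lem c d
  where
  lem : ∀ c d → c xor d ≡ not c xor not d
  lem true  d = sym (𝔹.xor-identityˡ (not d))
  lem false d = sym (𝔹.not-involutive d)
xor-interchange true  false c d = 𝔹.not-distribˡ-xor c d
xor-interchange false true  c d = 𝔹.not-distribʳ-xor c d
xor-interchange false false c d = refl

[_]≟_ : ∀ {n} → Fin n → Fin n → Bool
[ i ]≟ j = does (i ≟ j)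

opaque
  sum : ∀ {n} → (Fin n → Bool) → Bool
  sum {zero}  f = false
  sum {suc n} f = f zero xor sum (λ i → f (suc i))

  sum-zero : (f : Fin 0 → Bool) → sum f ≡ false
  sum-zero f = refl

  sum-suc : ∀ {n} (f : Fin (suc n) → Bool) → sum f ≡ f zero xor sum (λ i → f (suc i))
  sum-suc f = refl

  sum-cong-≗ : ∀ {n} {f g : Fin n → Bool} → (∀ i → f i ≡ g i) → sum f ≡ sum g
  sum-cong-≗ {zero}  h = refl
  sum-cong-≗ {suc n} h = cong₂ _xor_ (h zero) (sum-cong-≗ (λ i → h (suc i)))

  sum-false : ∀ {n} {f : Fin n → Bool} → (∀ i → f i ≡ false) → sum f ≡ false
  sum-false {zero}  h = refl
  sum-false {suc n} h = cong₂ _xor_ (h zero) (sum-false (λ i → h (suc i)))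

  ∑-distrib-+ : ∀ {n} (f g : Fin n → Bool) → sum (λ i → f i xor g i) ≡ sum f xor sum g
  ∑-distrib-+ {zero}  f g = refl
  ∑-distrib-+ {suc n} f g = trans (cong ((f zero xor g zero) xor_) (∑-distrib-+ (λ i → f (suc i)) (λ i → g (suc i)))) (xor-interchange (f zero) (g zero) _ _)

  *-distribˡ-sum : ∀ {n} s (f : Fin n → Bool) → s ∧ sum f ≡ sum (λ i → s ∧ f i)
  *-distribˡ-sum true  f = refl
  *-distribˡ-sum false f = sym (sum-false {f = λ i → false ∧ f i} (λ _ → refl))

  ∑-comm : ∀ {m n} (f : Fin m → Fin n → Bool) → sum (λ i → sum (f i)) ≡ sum (λ j → sum (λ i → f i j))
  ∑-comm {zero}  f = sym (sum-false {f = λ j → sum (λ i → f i j)} (λ _ → refl))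
  ∑-comm {suc m} f = trans (cong (sum (f zero) xor_) (∑-comm (λ i → f (suc i)))) (sym (∑-distrib-+ (f zero) (λ j → sum (λ i → f (suc i) j))))

  sum-remove : ∀ {n} {p : Fin (suc n)} (f : Fin (suc n) → Bool) → sum f ≡ f p xor sum (λ i → f (punchIn p i))
  sum-remove {n}     {zero}  f = refl
  sum-remove {suc n} {suc p} f = trans (cong (f zero xor_) (sum-remove {p = p} (λ i → f (suc i)))) (xor-interchange false (f zero) (f (suc p)) _)

sum-xor-∧ : ∀ {n} (f g : Fin n → Bool) s → sum (λ i → f i xor (s ∧ g i)) ≡ sum f xor (s ∧ sum g)
sum-xor-∧ f g s = trans (∑-distrib-+ f (λ i → s ∧ g i)) (cong (sum f xor_) (sym (*-distribˡ-sum s g)))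

sum-single : ∀ {n} (p : Fin n) (f : Fin n → Bool) → sum (λ i → [ p ]≟ i ∧ f i) ≡ f p
sum-single {suc n} p f = trans (sum-remove {p = p} (λ i → [ p ]≟ i ∧ f i)) (trans (cong₂ _xor_ at-p rest) (𝔹.xor-identityʳ _))
  where
  at-p : [ p ]≟ p ∧ f p ≡ f p
  at-p with p ≟ p
  ... | yes _ = refl
  ... | no h  = ⊥-elim (h refl)
  rest : sum (λ i → [ p ]≟ punchIn p i ∧ f (punchIn p i)) ≡ false
  rest = sum-false λ i → h i
    where
    h : ∀ i → [ p ]≟ punchIn p i ∧ f (punchIn p i) ≡ false
    h i with p ≟ punchIn p i
    ... | yes e = ⊥-elim (punchInᵢ≢i p i (sym e))
    ... | no _  = refl

sum-∧-comm : ∀ {n} (f g : Fin n → Bool) → sum (λ i → f i ∧ g i) ≡ sum (λ i → g i ∧ f i)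
sum-∧-comm f g = sum-cong-≗ λ i → 𝔹.∧-comm (f i) (g i)

sum-bilinear : ∀ {m n} (x : Fin m → Bool) (a : Fin m → Fin n → Bool) (y : Fin n → Bool) →
               sum (λ i → x i ∧ sum (λ j → a i j ∧ y j)) ≡ sum (λ j → sum (λ i → x i ∧ a i j) ∧ y j)
sum-bilinear x a y = begin
  sum (λ i → x i ∧ sum (λ j → a i j ∧ y j))    ≡⟨ sum-cong-≗ (λ i → *-distribˡ-sum (x i) _) ⟩
  sum (λ i → sum (λ j → x i ∧ (a i j ∧ y j)))  ≡⟨ ∑-comm _ ⟩
  sum (λ j → sum (λ i → x i ∧ (a i j ∧ y j)))  ≡⟨ sum-cong-≗ (λ j → trans (sum-cong-≗ (λ i → rot (x i) (a i j) (y j))) (trans (sym (*-distribˡ-sum (y j) _)) (𝔹.∧-comm (y j) _))) ⟩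
  sum (λ j → sum (λ i → x i ∧ a i j) ∧ y j)    ∎
  where
  open ≡-Reasoning
  rot : ∀ a b c → a ∧ (b ∧ c) ≡ c ∧ (a ∧ b)
  rot a b c = trans (sym (𝔹.∧-assoc a b c)) (𝔹.∧-comm (a ∧ b) c)

xor-cancel : ∀ {a b} → a xor b ≡ false → a ≡ b
xor-cancel {true}  {true}  _ = refl
xor-cancel {false} {false} _ = refl

xor-triangle : ∀ a b c → (a xor b) xor ((b xor c) xor (c xor a)) ≡ false
xor-triangle true  true  true  = refl
xor-triangle true  true  false = refl
xor-triangle true  false true  = refl
xor-triangle true  false false = refl
xor-triangle false true  true  = refl
xor-triangle false true  false = refl
xor-triangle false false true  = refl
xor-triangle false false false = refl

-- Gaussian elimination of the first unknown, with pivot row p.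
eliminate : ∀ {k n} → (Fin k → Fin (suc n) → Bool) → Fin k → Fin k → Fin n → Bool
eliminate a p i j = a i (suc j) xor (a i zero ∧ a p (suc j))

eliminate-row : ∀ {k n} (a : Fin k → Fin (suc n) → Bool) p (x : Fin n → Bool) i β →
  a i zero ∧ (β xor sum (λ j → a p (suc j) ∧ x j)) xor sum (λ j → a i (suc j) ∧ x j)
    ≡ sum (λ j → eliminate a p i j ∧ x j) xor (a i zero ∧ β)
eliminate-row a p x i β = sym (begin
  sum (λ j → eliminate a p i j ∧ x j) xor (a i zero ∧ β)
    ≡⟨ cong (_xor (a i zero ∧ β)) (trans (sum-cong-≗ (λ j → d (a i (suc j)) (a i zero) (a p (suc j)) (x j))) (sum-xor-∧ _ _ (a i zero))) ⟩
  (sum (λ j → a i (suc j) ∧ x j) xor (a i zero ∧ sum (λ j → a p (suc j) ∧ x j))) xor (a i zero ∧ β)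
    ≡⟨ e (a i zero) β _ _ ⟩
  _ ∎)
  where
  open ≡-Reasoning
  d : ∀ u s v w → (u xor (s ∧ v)) ∧ w ≡ (u ∧ w) xor (s ∧ (v ∧ w))
  d u s v w = trans (𝔹.∧-distribʳ-xor w u (s ∧ v)) (cong ((u ∧ w) xor_) (𝔹.∧-assoc s v w))
  e : ∀ s β q t → (t xor (s ∧ q)) xor (s ∧ β) ≡ (s ∧ (β xor q)) xor t
  e true true true t = trans (𝔹.xor-assoc t true true) (𝔹.xor-identityʳ t)
  e true true false t = trans (𝔹.xor-assoc t false true) (𝔹.xor-comm t true)
  e true false true t = trans (𝔹.xor-assoc t true false) (𝔹.xor-comm t true)
  e true false false t = trans (𝔹.xor-assoc t false false) (𝔹.xor-identityʳ t)
  e false β q t = trans (𝔹.xor-assoc t false false) (𝔹.xor-identityʳ t)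

Solution : ∀ {k n} → (Fin k → Fin n → Bool) → (Fin k → Bool) → Set
Solution {k} {n} a b = Σ (Fin n → Bool) λ x → ∀ i → sum (λ j → a i j ∧ x j) ≡ b i

Obstruction : ∀ {k n} → (Fin k → Fin n → Bool) → (Fin k → Bool) → Set
Obstruction {k} {n} a b = Σ (Fin k → Bool) λ y → (∀ j → sum (λ i → y i ∧ a i j) ≡ false) × sum (λ i → y i ∧ b i) ≡ true

-- Elimination of the first unknown. The pivot row stays in the reduced system, where it is zero
-- with right-hand side zero, so the number of equations is constant. An obstruction of the reduced
-- system is corrected at the pivot row until it also annihilates the first column.
fredholm : ∀ n {k} (a : Fin k → Fin n → Bool) (b : Fin k → Bool) → Solution a b ⊎ Obstruction a b
fredholm zero a b with any? (λ i → b i 𝔹.≟ true)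
... | yes (i , h) = inj₂ ([ i ]≟_ , (λ ()) , trans (sum-single i b) h)
... | no h = inj₁ ((λ ()) , λ i → trans (sum-zero _) (sym (¬true⇒false (λ e → h (i , e)))))
fredholm (suc n) {k} a b with any? (λ i → a i zero 𝔹.≟ true)
... | no h = tail (fredholm n (λ i j → a i (suc j)) b)
  where
  a0 : ∀ i → a i zero ≡ false
  a0 i = ¬true⇒false (λ e → h (i , e))
  tail : Solution (λ i j → a i (suc j)) b ⊎ Obstruction (λ i j → a i (suc j)) b → Solution a b ⊎ Obstruction a b
  tail (inj₁ (x , hx)) = inj₁ (x′ , λ i → trans (sum-suc (λ j → a i j ∧ x′ j)) (trans (cong (_xor sum (λ j → a i (suc j) ∧ x j)) (𝔹.∧-zeroʳ (a i zero))) (hx i)))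
    where
    x′ : Fin (suc n) → Bool
    x′ zero    = false
    x′ (suc j) = x j
  tail (inj₂ (y , hy , hb)) = inj₂ (y , (λ { zero → sum-false (λ i → trans (cong (y i ∧_) (a0 i)) (𝔹.∧-zeroʳ (y i))) ; (suc j) → hy j }) , hb)
... | yes (p , ap) = lift (fredholm n (eliminate a p) b′)
  where
  b′ : Fin k → Bool
  b′ i = b i xor (a i zero ∧ b p)
  lift : Solution (eliminate a p) b′ ⊎ Obstruction (eliminate a p) b′ → Solution a b ⊎ Obstruction a b
  lift (inj₁ (x , hx)) = inj₁ (x′ , λ i → trans (sum-suc (λ j → a i j ∧ x′ j))
      (trans (eliminate-row a p x i (b p)) (trans (cong (_xor (a i zero ∧ b p)) (hx i)) (e (b i) (a i zero ∧ b p)))))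
    where
    x′ : Fin (suc n) → Bool
    x′ zero    = b p xor sum (λ j → a p (suc j) ∧ x j)
    x′ (suc j) = x j
    e : ∀ u v → (u xor v) xor v ≡ u
    e u v = trans (𝔹.xor-assoc u v v) (trans (cong (u xor_) (𝔹.xor-same v)) (𝔹.xor-identityʳ u))
  lift (inj₂ (y , hy , hb)) = inj₂ (y′ , (λ { zero → first ; (suc j) → trans (pair (λ i → a i (suc j))) (hy j) }) , trans (pair b) hb)
    where
    s : Bool
    s = sum (λ i → y i ∧ a i zero)
    y′ : Fin k → Bool
    y′ i = y i xor (s ∧ [ p ]≟ i)
    dist : ∀ v → sum (λ i → y′ i ∧ v i) ≡ sum (λ i → y i ∧ v i) xor (s ∧ v p)
    dist v = trans (sum-cong-≗ (λ i → trans (𝔹.∧-distribʳ-xor (v i) (y i) _) (cong ((y i ∧ v i) xor_) (𝔹.∧-assoc s _ (v i)))))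
             (trans (sum-xor-∧ _ _ s) (cong (λ q → sum (λ i → y i ∧ v i) xor (s ∧ q)) (sum-single p v)))
    first : sum (λ i → y′ i ∧ a i zero) ≡ false
    first = trans (dist (λ i → a i zero)) (trans (cong (λ q → s xor (s ∧ q)) ap) (trans (cong (s xor_) (𝔹.∧-identityʳ s)) (𝔹.xor-same s)))
    pair : ∀ v → sum (λ i → y′ i ∧ v i) ≡ sum (λ i → y i ∧ (v i xor (a i zero ∧ v p)))
    pair v = trans (dist v) (sym (trans (sum-cong-≗ (λ i → e (y i) (v i) (a i zero) (v p))) (trans (sum-xor-∧ (λ i → y i ∧ v i) (λ i → y i ∧ a i zero) (v p)) (cong (sum (λ i → y i ∧ v i) xor_) (𝔹.∧-comm (v p) s)))))
      where
      e : ∀ y v a w → y ∧ (v xor (a ∧ w)) ≡ (y ∧ v) xor (w ∧ (y ∧ a))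
      e y v a w = trans (𝔹.∧-distribˡ-xor y v (a ∧ w)) (cong ((y ∧ v) xor_) (trans (sym (𝔹.∧-assoc y a w)) (𝔹.∧-comm (y ∧ a) w)))

kernel-lift : ∀ {k n} (a : Fin (suc k) → Fin (suc n) → Bool) p → a p zero ≡ true → (x : Fin n → Bool) →
  (∀ i → sum (λ j → eliminate a p (punchIn p i) j ∧ x j) ≡ false) →
  ∃[ x₀ ] (∀ i → (a i zero ∧ x₀) xor sum (λ j → a i (suc j) ∧ x j) ≡ false)
kernel-lift a p ap x hx = x₀ , rows
  where
  x₀ : Bool
  x₀ = sum (λ j → a p (suc j) ∧ x j)
  row : ∀ i → (a (punchIn p i) zero ∧ x₀) xor sum (λ j → a (punchIn p i) (suc j) ∧ x j) ≡ false
  row i = trans (eliminate-row a p x (punchIn p i) false) (trans (cong (_xor (a (punchIn p i) zero ∧ false)) (hx i)) (𝔹.∧-zeroʳ (a (punchIn p i) zero)))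
  rows : ∀ i → (a i zero ∧ x₀) xor sum (λ j → a i (suc j) ∧ x j) ≡ false
  rows i with p ≟ i
  ... | yes refl = trans (cong (λ s → (s ∧ x₀) xor x₀) ap) (𝔹.xor-same x₀)
  ... | no p≢i = subst (λ i → (a i zero ∧ x₀) xor sum (λ j → a i (suc j) ∧ x j) ≡ false) (punchIn-punchOut p≢i) (row (punchOut p≢i))

kernel : ∀ n {k} → k < n → (a : Fin k → Fin n → Bool) →
  Σ (Fin n → Bool) λ x → (∃[ j ] x j ≡ true) × (∀ i → sum (λ j → a i j ∧ x j) ≡ false)
kernel (suc n) {zero}  k<n a = (λ _ → true) , (zero , refl) , λ ()
kernel (suc n) {suc k} k<n a with any? (λ i → a i zero 𝔹.≟ true)
... | no h = [ zero ]≟_ , (zero , refl) , λ i → trans (sum-∧-comm (a i) ([ zero ]≟_)) (trans (sum-single zero (a i)) (¬true⇒false (λ e → h (i , e))))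
... | yes (p , ap) =
  let x , (j , xj) , hx = kernel n (s≤s⁻¹ k<n) (λ i → eliminate a p (punchIn p i))
      x₀ , rows = kernel-lift a p ap x hx
  in cons x₀ x , (suc j , xj) , λ i → trans (sum-suc _) (rows i)
  where
  cons : Bool → (Fin n → Bool) → Fin (suc n) → Bool
  cons x₀ x zero    = x₀
  cons x₀ x (suc j) = x j

-- Every left-null vector makes one row redundant.
kernel′ : ∀ k {m n} → m < n + k → (a : Fin m → Fin n → Bool) (y : Fin k → Fin m → Bool) →
  (∀ i j → sum (λ e → y i e ∧ a e j) ≡ false) →
  (∀ (s : Fin k → Bool) → (∀ e → sum (λ i → s i ∧ y i e) ≡ false) → ∀ i → s i ≡ false) →
  Σ (Fin n → Bool) λ x → (∃[ j ] x j ≡ true) × (∀ e → sum (λ j → a e j ∧ x j) ≡ false)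
kernel′ zero {m} {n} m<n a y null indep = kernel n (subst (m <_) (+-identityʳ n) m<n) a
kernel′ (suc k) {m} {n} m<n a y null indep with any? (λ e → y zero e 𝔹.≟ true)
... | no h = ⊥-elim (true≢false refl (indep ([ zero ]≟_) (λ e → trans (sum-single zero (λ i → y i e)) (¬true⇒false (λ q → h (e , q)))) zero))
kernel′ (suc k) {suc m} {n} m<n a y null indep | yes (p , yp)
  with kernel′ k (s≤s⁻¹ (subst (suc m <_) (+-suc n k) m<n)) (λ e → a (punchIn p e)) (λ i e → y′ i (punchIn p e)) null′ indep′
  where
  y′ : Fin k → Fin (suc m) → Bool
  y′ i e = y (suc i) e xor (y (suc i) p ∧ y zero e)
  y′p : ∀ i → y′ i p ≡ false
  y′p i = trans (cong (λ q → y (suc i) p xor (y (suc i) p ∧ q)) yp) (trans (cong (y (suc i) p xor_) (𝔹.∧-identityʳ (y (suc i) p))) (𝔹.xor-same (y (suc i) p)))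
  null′ : ∀ i j → sum (λ e → y′ i (punchIn p e) ∧ a (punchIn p e) j) ≡ false
  null′ i j = trans (sym (trans (sum-remove {p = p} (λ e → y′ i e ∧ a e j)) (cong (λ q → (q ∧ a p j) xor sum (λ e → y′ i (punchIn p e) ∧ a (punchIn p e) j)) (y′p i))))
    (trans (sum-cong-≗ (λ e → trans (𝔹.∧-distribʳ-xor (a e j) (y (suc i) e) _) (cong ((y (suc i) e ∧ a e j) xor_) (𝔹.∧-assoc (y (suc i) p) _ _))))
    (trans (sum-xor-∧ _ _ (y (suc i) p)) (trans (cong₂ (λ u v → u xor (y (suc i) p ∧ v)) (null (suc i) j) (null zero j)) (𝔹.∧-zeroʳ _))))
  indep′ : ∀ (s : Fin k → Bool) → (∀ e → sum (λ i → s i ∧ y′ i (punchIn p e)) ≡ false) → ∀ i → s i ≡ false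
  indep′ s hs i = indep s′ all (suc i)
    where
    t : Bool
    t = sum (λ i → s i ∧ y (suc i) p)
    s′ : Fin (suc k) → Bool
    s′ zero    = t
    s′ (suc i) = s i
    expand : ∀ e → sum (λ i → s i ∧ y′ i e) ≡ sum (λ i → s′ i ∧ y i e)
    expand e = trans (sum-cong-≗ (λ i → h (s i) (y (suc i) e) (y (suc i) p) (y zero e)))
      (trans (sum-xor-∧ _ _ (y zero e)) (trans (𝔹.xor-comm (sum (λ i → s i ∧ y (suc i) e)) _) (trans (cong (_xor sum (λ i → s i ∧ y (suc i) e)) (𝔹.∧-comm (y zero e) t)) (sym (sum-suc (λ i → s′ i ∧ y i e))))))
      where
      h : ∀ s u v w → s ∧ (u xor (v ∧ w)) ≡ (s ∧ u) xor (w ∧ (s ∧ v))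
      h s u v w = trans (𝔹.∧-distribˡ-xor s u (v ∧ w)) (cong ((s ∧ u) xor_) (trans (sym (𝔹.∧-assoc s v w)) (𝔹.∧-comm (s ∧ v) w)))
    all : ∀ e → sum (λ i → s′ i ∧ y i e) ≡ false
    all e with p ≟ e
    ... | yes refl = trans (sym (expand e)) (sum-false (λ i → trans (cong (s i ∧_) (y′p i)) (𝔹.∧-zeroʳ (s i))))
    ... | no p≢e = subst (λ e → sum (λ i → s′ i ∧ y i e) ≡ false) (punchIn-punchOut p≢e) (trans (sym (expand _)) (hs (punchOut p≢e)))
... | x , nz , hx = x , nz , rows
  where
  others : ∀ e → p ≢ e → sum (λ j → a e j ∧ x j) ≡ false
  others e p≢e = subst (λ e → sum (λ j → a e j ∧ x j) ≡ false) (punchIn-punchOut p≢e) (hx (punchOut p≢e))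
  rows : ∀ e → sum (λ j → a e j ∧ x j) ≡ false
  rows e with p ≟ e
  ... | no p≢e = others e p≢e
  -- All other rows vanish on `x`, so the removed row equals the combination of all rows with
  -- coefficients `y zero`, which is zero by `null`.
  ... | yes refl = trans (sym (sum-single p (λ e → sum (λ j → a e j ∧ x j))))
    (trans (sum-cong-≗ same) (trans (sum-bilinear (y zero) a x) (sum-false (λ j → cong (_∧ x j) (null zero j)))))
    where
    same : ∀ e → [ p ]≟ e ∧ sum (λ j → a e j ∧ x j) ≡ y zero e ∧ sum (λ j → a e j ∧ x j)
    same e with p ≟ e
    ... | yes refl = cong (_∧ _) (sym yp)
    ... | no p≢e = sym (trans (cong (y zero e ∧_) (others e p≢e)) (𝔹.∧-zeroʳ _))

module Maps {N K : ℕ} (r : Fin N → Fin N) (r³ : ∀ d → r (r (r d)) ≡ d) where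

  -- Cubic plane maps

  -- The three darts d, r d, r (r d) form a vertex and mate joins the two darts of an edge; only the
  -- darts in al are present.  The edge of d separates the faces lab d and lab (r d).  The field cyc
  -- expresses genus zero: every even subgraph is the boundary of a set of faces.
  record Map : Set where
    field
      al   : Fin N → Bool
      mate : Fin N → Fin N
      lab  : Fin N → Fin K
      al-r      : ∀ d → al (r d) ≡ al d
      al-mate   : ∀ {d} → al d ≡ true → al (mate d) ≡ true
      mate-mate : ∀ {d} → al d ≡ true → mate (mate d) ≡ d
      lab-mate  : ∀ {d} → al d ≡ true → lab (r (mate d)) ≡ lab d
      loopless  : ∀ {d} → al d ≡ true → lab d ≢ lab (r d)
      conn : (X : Fin N → Bool) → (∀ {d} → al d ≡ true → X (r d) ≡ X d) →
             (∀ {d} → al d ≡ true → X (mate d) ≡ X d) →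
             ∀ {d d′} → al d ≡ true → al d′ ≡ true → X d ≡ X d′
      cyc  : (F : Fin N → Bool) → (∀ {d} → al d ≡ true → F (mate d) ≡ F d) →
             (∀ {d} → al d ≡ true → F d xor (F (r d) xor F (r (r d))) ≡ false) →
             Σ (Fin K → Bool) λ c → ∀ {d} → al d ≡ true → F d ≡ c (lab d) xor c (lab (r d))

  r-injective : ∀ {d d′} → r d ≡ r d′ → d ≡ d′
  r-injective {d} {d′} e = trans (sym (r³ d)) (trans (cong (λ x → r (r x)) e) (r³ d′))

  -- Iteration, indicator functions and cardinalities

  iterate : ∀ {A : Set} → (A → A) → ℕ → A → A
  iterate f zero    x = x
  iterate f (suc k) x = f (iterate f k x)

  iterate-suc : ∀ {A : Set} (f : A → A) k x → iterate f k (f x) ≡ f (iterate f k x)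
  iterate-suc f zero    x = refl
  iterate-suc f (suc k) x = cong f (iterate-suc f k x)

  does-refl : ∀ {n} (i : Fin n) → [ i ]≟ i ≡ true
  does-refl i with i ≟ i
  ... | yes _ = refl
  ... | no h  = ⊥-elim (h refl)

  does-false : ∀ {n} {i j : Fin n} → i ≢ j → [ i ]≟ j ≡ false
  does-false {i = i} {j} h with i ≟ j
  ... | yes e = ⊥-elim (h e)
  ... | no _  = refl

  does-cong : ∀ {m n} {i j : Fin n} {k l : Fin m} → (i ≡ j → k ≡ l) → (k ≡ l → i ≡ j) → [ i ]≟ j ≡ [ k ]≟ l
  does-cong {i = i} {j} {k} {l} f g with i ≟ j | k ≟ l
  ... | yes _ | yes _ = refl
  ... | no _  | no _  = refl
  ... | yes e | no h  = ⊥-elim (h (f e))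
  ... | no h  | yes e = ⊥-elim (h (g e))

  count : ∀ {n} → (Fin n → Bool) → ℕ
  count {zero}  f = 0
  count {suc n} f with f zero
  ... | true  = suc (count (λ i → f (suc i)))
  ... | false = count (λ i → f (suc i))

  count-≤ : ∀ {n} {f g : Fin n → Bool} → (∀ i → f i ≡ true → g i ≡ true) → count f ≤ count g
  count-≤ {zero} h = z≤n
  count-≤ {suc n} {f} {g} h with f zero in ef | g zero in eg
  ... | true  | true  = s≤s (count-≤ (λ i → h (suc i)))
  ... | true  | false = ⊥-elim (true≢false (h zero ef) eg)
  ... | false | true  = m≤n⇒m≤1+n (count-≤ (λ i → h (suc i)))
  ... | false | false = count-≤ (λ i → h (suc i))

  count-< : ∀ {n} {f g : Fin n → Bool} → (∀ i → f i ≡ true → g i ≡ true) → ∀ p → g p ≡ true → f p ≡ false → count f < count g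
  count-< {suc n} {f} {g} h zero gp fp with f zero | g zero
  ... | false | true = s≤s (count-≤ (λ i → h (suc i)))
  count-< {suc n} {f} {g} h (suc p) gp fp with f zero in ef | g zero in eg
  ... | true  | true  = s≤s (count-< (λ i → h (suc i)) p gp fp)
  ... | true  | false = ⊥-elim (true≢false (h zero ef) eg)
  ... | false | true  = m≤n⇒m≤1+n (count-< (λ i → h (suc i)) p gp fp)
  ... | false | false = count-< (λ i → h (suc i)) p gp fp

  opaque
    unfolding sum
    sum-++ : ∀ m {n} (f : Fin (m + n) → Bool) → sum f ≡ sum (λ i → f (i ↑ˡ n)) xor sum (λ j → f (m ↑ʳ j))
    sum-++ zero f = refl
    sum-++ (suc m) {n} f = trans (cong (f zero xor_) (sum-++ m (λ i → f (suc i)))) (sym (𝔹.xor-assoc (f zero) (sum (λ i → f (suc (i ↑ˡ n)))) _))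

  size : Map → ℕ
  size M = count (Map.al M)

  -- Faces and edge cuts of a map

  module Laws (M : Map) where
    open Map M public

    al-rr : ∀ {d} → al d ≡ true → al (r d) ≡ true
    al-rr {d} h = trans (al-r d) h

    al-rr⁻ : ∀ {d} → al (r d) ≡ true → al d ≡ true
    al-rr⁻ {d} h = trans (sym (al-r d)) h

    lab-mate′ : ∀ {d} → al d ≡ true → lab (mate d) ≡ lab (r d)
    lab-mate′ h = trans (sym (lab-mate (al-mate h))) (cong (λ x → lab (r x)) (mate-mate h))

    loopless₂ : ∀ {d} → al d ≡ true → lab d ≢ lab (r (r d))
    loopless₂ {d} h e = loopless (al-rr (al-rr h)) (trans (sym e) (cong lab (sym (r³ d))))

    mate-injective : ∀ {d d′} → al d ≡ true → al d′ ≡ true → mate d ≡ mate d′ → d ≡ d′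
    mate-injective h h′ e = trans (sym (mate-mate h)) (trans (cong mate e) (mate-mate h′))

    mate-swap : ∀ {d d′} → al d ≡ true → mate d ≡ d′ → d ≡ mate d′
    mate-swap h e = trans (sym (mate-mate h)) (cong mate e)

    φ ν : Fin N → Fin N
    φ d = r (mate d)
    ν d = mate (r (r d))

    al-φ : ∀ {d} → al d ≡ true → al (φ d) ≡ true
    al-φ h = al-rr (al-mate h)

    al-ν : ∀ {d} → al d ≡ true → al (ν d) ≡ true
    al-ν h = al-mate (al-rr (al-rr h))

    lab-ν : ∀ {d} → al d ≡ true → lab (ν d) ≡ lab d
    lab-ν {d} h = trans (lab-mate′ (al-rr (al-rr h))) (cong lab (r³ d))

    lab-r-ν : ∀ {d} → al d ≡ true → lab (r (ν d)) ≡ lab (r (r d))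
    lab-r-ν {d} h = lab-mate (al-rr (al-rr h))

    φν : ∀ {d} → al d ≡ true → φ (ν d) ≡ d
    φν {d} h = trans (cong r (mate-mate (al-rr (al-rr h)))) (r³ d)

    νφ : ∀ {d} → al d ≡ true → ν (φ d) ≡ d
    νφ {d} h = trans (cong mate (r³ (mate d))) (mate-mate h)

    φ-injective : ∀ {d d′} → al d ≡ true → al d′ ≡ true → φ d ≡ φ d′ → d ≡ d′
    φ-injective h h′ e = mate-injective h h′ (r-injective e)

    ν-injective : ∀ {d d′} → al d ≡ true → al d′ ≡ true → ν d ≡ ν d′ → d ≡ d′
    ν-injective h h′ e = r-injective (r-injective (mate-injective (al-rr (al-rr h)) (al-rr (al-rr h′)) e))

    al-φ^ : ∀ k {d} → al d ≡ true → al (iterate φ k d) ≡ true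
    al-φ^ zero    h = h
    al-φ^ (suc k) h = al-φ (al-φ^ k h)

    lab-φ^ : ∀ k {d} → al d ≡ true → lab (iterate φ k d) ≡ lab d
    lab-φ^ zero    h = refl
    lab-φ^ (suc k) h = trans (lab-mate (al-φ^ k h)) (lab-φ^ k h)

    period : ∀ {d} → al d ≡ true → ∃[ p ] iterate φ (suc p) d ≡ d
    period {d} h with pigeonhole ≤-refl (λ (i : Fin (suc N)) → iterate φ (toℕ i) d)
    ... | i , j , i<j , e = cancel (toℕ i) (toℕ j) i<j e
      where
      cancel : ∀ i j → i < j → iterate φ i d ≡ iterate φ j d → ∃[ p ] iterate φ (suc p) d ≡ d
      cancel zero    (suc j) _   e = j , sym e
      cancel (suc i) (suc j) i<j e = cancel i j (s≤s⁻¹ i<j) (φ-injective (al-φ^ i h) (al-φ^ j h) e)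

    -- The boundary of a face is a closed walk: if `s` turns false along it, it has to turn true
    -- again before the orbit of `φ` returns to `d`.
    crosses-back : (s : Fin N → Bool) → (∀ {d} → al d ≡ true → s (r d) ≡ s d) →
      ∀ {d} → al d ≡ true → s d ≡ true → s (mate d) ≡ false →
      ∃[ d′ ] (al d′ ≡ true × lab d′ ≡ lab d × s d′ ≡ false × s (mate d′) ≡ true)
    crosses-back s s-r {d} h sd sm
      with any? (λ d′ → (al d′ 𝔹.≟ true) ×-dec (lab d′ ≟ lab d) ×-dec (s d′ 𝔹.≟ false) ×-dec (s (mate d′) 𝔹.≟ true))
    ... | yes found = found
    ... | no none = ⊥-elim (true≢false sd (subst (λ x → s x ≡ false) (trans (iterate-suc φ (proj₁ (period h)) d) (proj₂ (period h))) (stays (proj₁ (period h)))))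
      where
      stays : ∀ k → s (iterate φ k (φ d)) ≡ false
      stays zero    = trans (s-r (al-mate h)) sm
      stays (suc k) = trans (s-r (al-mate al-k)) (¬true⇒false λ e →
          none (iterate φ k (φ d) , al-k , trans (lab-φ^ k (al-φ h)) (lab-mate h) , stays k , e))
        where
        al-k : al (iterate φ k (φ d)) ≡ true
        al-k = al-φ^ k (al-φ h)

    -- The darts of a face form a single orbit of φ: otherwise the boundary of one orbit would be an
    -- even subgraph that is no boundary of a set of faces.
    face-orbit : ∀ z (k : Fin N → Bool) → (∀ {d} → al d ≡ true → lab d ≡ z → k (φ d) ≡ k d) →
      ∀ {d d′} → al d ≡ true → al d′ ≡ true → lab d ≡ z → lab d′ ≡ z → k d ≡ k d′
    face-orbit z k k-φ {d} {d′} h h′ e e′ = cancel {c z} (trans (sym (kz-at e)) (trans c-const (kz-at e′)))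
      where
      kz : Fin N → Bool
      kz d = k d ∧ [ lab d ]≟ z
      kz-φ : ∀ {d} → al d ≡ true → kz (φ d) ≡ kz d
      kz-φ {d} h with lab d ≟ z | lab (φ d) ≟ z
      ... | yes e | yes _ = cong (_∧ true) (k-φ h e)
      ... | yes e | no ¬e = ⊥-elim (¬e (trans (lab-mate h) e))
      ... | no ¬e | yes e = ⊥-elim (¬e (trans (sym (lab-mate h)) e))
      ... | no _  | no _  = trans (𝔹.∧-zeroʳ (k (φ d))) (sym (𝔹.∧-zeroʳ (k d)))
      F : Fin N → Bool
      F d = kz d xor kz (r d)
      F-mate : ∀ {d} → al d ≡ true → F (mate d) ≡ F d
      F-mate {d} h = trans (𝔹.xor-comm (kz (mate d)) (kz (φ d))) (cong₂ _xor_ (kz-φ h)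
        (trans (sym (kz-φ (al-mate h))) (cong (λ x → kz (r x)) (mate-mate h))))
      F-even : ∀ {d} → al d ≡ true → F d xor (F (r d) xor F (r (r d))) ≡ false
      F-even {d} h = trans (cong (λ x → F d xor (F (r d) xor (kz (r (r d)) xor kz x))) (r³ d)) (xor-triangle (kz d) (kz (r d)) (kz (r (r d))))
      c : Fin K → Bool
      c = proj₁ (cyc F F-mate F-even)
      F≡δc : ∀ {d} → al d ≡ true → F d ≡ c (lab d) xor c (lab (r d))
      F≡δc = proj₂ (cyc F F-mate F-even)
      -- `F` arises from `c` as well as from `kz`, so the sum of the two is unchanged around
      -- vertices and across edges, hence constant.
      X : Fin N → Bool
      X d = c (lab d) xor kz d
      X-r : ∀ {d} → al d ≡ true → X (r d) ≡ X d
      X-r {d} h = swap (kz d) (kz (r d)) (c (lab d)) (c (lab (r d))) (F≡δc h)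
        where
        swap : ∀ a b u v → a xor b ≡ u xor v → v xor b ≡ u xor a
        swap a b u v e = xor-cancel (trans (xor-interchange v b u a) (trans (cong₂ _xor_ (𝔹.xor-comm v u) (𝔹.xor-comm b a))
          (trans (cong ((u xor v) xor_) e) (𝔹.xor-same (u xor v)))))
      X-mate : ∀ {d} → al d ≡ true → X (mate d) ≡ X d
      X-mate {d} h = trans (sym (X-r (al-mate h))) (cong₂ _xor_ (cong c (lab-mate h)) (kz-φ h))
      c-const : X d ≡ X d′
      c-const = conn X X-r X-mate h h′
      kz-at : ∀ {d} → lab d ≡ z → X d ≡ c z xor k d
      kz-at {d} refl = cong (c (lab d) xor_) (trans (cong (k d ∧_) (does-refl (lab d))) (𝔹.∧-identityʳ (k d)))
      cancel : ∀ {u a b} → u xor a ≡ u xor b → a ≡ b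
      cancel {true}  {true}  {true}  _ = refl
      cancel {true}  {false} {false} _ = refl
      cancel {false} e = e

    -- ∂ es is the indicator function of a list of edges, counted modulo 2.
    ∂ : List (Fin N) → Fin N → Bool
    ∂ []       d = false
    ∂ (e ∷ es) d = ([ e ]≟ d xor [ mate e ]≟ d) xor ∂ es d

    total : (Fin N → Bool) → List (Fin N) → Bool
    total F []       = false
    total F (e ∷ es) = F e xor total F es

    sum-∂ : (h : Fin N → Bool) → ∀ es → sum (λ d → h d ∧ ∂ es d) ≡ total (λ d → h d xor h (mate d)) es
    sum-∂ h []       = sum-false (λ d → 𝔹.∧-zeroʳ (h d))
    sum-∂ h (e ∷ es) = begin
      sum (λ d → h d ∧ (([ e ]≟ d xor [ mate e ]≟ d) xor ∂ es d))
        ≡⟨ sum-cong-≗ (λ d → trans (𝔹.∧-distribˡ-xor (h d) ([ e ]≟ d xor [ mate e ]≟ d) (∂ es d)) (cong (_xor (h d ∧ ∂ es d)) (trans (𝔹.∧-distribˡ-xor (h d) ([ e ]≟ d) ([ mate e ]≟ d)) (cong₂ _xor_ (𝔹.∧-comm (h d) _) (𝔹.∧-comm (h d) _))))) ⟩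
      sum (λ d → (([ e ]≟ d ∧ h d) xor ([ mate e ]≟ d ∧ h d)) xor (h d ∧ ∂ es d))
        ≡⟨ trans (∑-distrib-+ _ _) (cong₂ _xor_ (∑-distrib-+ _ _) (sum-∂ h es)) ⟩
      (sum (λ d → [ e ]≟ d ∧ h d) xor sum (λ d → [ mate e ]≟ d ∧ h d)) xor total (λ d → h d xor h (mate d)) es
        ≡⟨ cong (_xor total (λ d → h d xor h (mate d)) es) (cong₂ _xor_ (sum-single e h) (sum-single (mate e) h)) ⟩
      total (λ d → h d xor h (mate d)) (e ∷ es) ∎
      where open ≡-Reasoning

    Cut : List (Fin N) → Set
    Cut es = Σ (Fin N → Bool) λ X → (∀ {d} → al d ≡ true → X (r d) ≡ X d) × (∀ {d} → al d ≡ true → X d xor X (mate d) ≡ ∂ es d)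

    -- Duality in the sphere: edges that every boundary of a set of faces meets evenly form a cut.
    -- The side `X` is sought as solution of a linear system with one equation per dart for `r` and
    -- one for `mate`. An obstruction assigns weights `g` and `h` to these equations. The sum `F` of
    -- `h` over the two darts of each edge is then an even subgraph meeting `es` oddly, yet by `cyc`
    -- it is a boundary.
    separation : ∀ es → (∀ (c : Fin K → Bool) → total (λ d → c (lab d) xor c (lab (r d))) es ≡ false) →
      All (λ e → al e ≡ true) es → Cut es
    separation es closed al-es = by (fredholm N {N + N} a b)
      where
      step : (Fin N → Fin N) → Fin N → Fin N → Bool
      step f d j = al d ∧ ([ d ]≟ j xor [ f d ]≟ j)
      a : Fin (N + N) → Fin N → Bool
      a i j = [ (λ d → step r d j) , (λ d → step mate d j) ]′ (splitAt N i)
      b : Fin (N + N) → Bool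
      b i = [ (λ _ → false) , (λ d → al d ∧ ∂ es d) ]′ (splitAt N i)
      row : ∀ f d (x : Fin N → Bool) → sum (λ j → step f d j ∧ x j) ≡ al d ∧ (x d xor x (f d))
      row f d x = trans (sum-cong-≗ (λ j → trans (𝔹.∧-assoc (al d) _ (x j)) (cong (al d ∧_) (𝔹.∧-distribʳ-xor (x j) ([ d ]≟ j) ([ f d ]≟ j)))))
        (trans (sym (*-distribˡ-sum (al d) _)) (cong (al d ∧_) (trans (∑-distrib-+ _ _) (cong₂ _xor_ (sum-single d x) (sum-single (f d) x)))))
      by : Solution a b ⊎ Obstruction a b → Cut es
      by (inj₁ (x , hx)) = x , x-r , x-mate
        where
        x-r : ∀ {d} → al d ≡ true → x (r d) ≡ x d
        x-r {d} h = sym (xor-cancel (trans (cong (_∧ (x d xor x (r d))) (sym h)) (trans (sym (row r d x)) (subst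
          (λ s → sum (λ j → [ (λ d → step r d j) , (λ d → step mate d j) ]′ s ∧ x j) ≡ [ (λ _ → false) , (λ d → al d ∧ ∂ es d) ]′ s)
          (splitAt-↑ˡ N d N) (hx (d ↑ˡ N))))))
        x-mate : ∀ {d} → al d ≡ true → x d xor x (mate d) ≡ ∂ es d
        x-mate {d} h = trans (cong (_∧ (x d xor x (mate d))) (sym h)) (trans (sym (row mate d x)) (trans (subst
          (λ s → sum (λ j → [ (λ d → step r d j) , (λ d → step mate d j) ]′ s ∧ x j) ≡ [ (λ _ → false) , (λ d → al d ∧ ∂ es d) ]′ s)
          (splitAt-↑ʳ N N d) (hx (N ↑ʳ d))) (cong (_∧ ∂ es d) h)))
      by (inj₂ (y , hy , hb)) = ⊥-elim (true≢false odd even)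
        where
        g h F : Fin N → Bool
        g d = y (d ↑ˡ N) ∧ al d
        h d = y (N ↑ʳ d) ∧ al d
        F d = h d xor h (mate d)
        [≟]-sym : ∀ i j → [ i ]≟ j ≡ [ j ]≟ i
        [≟]-sym i j = does-cong {i = i} {k = j} sym sym
        split : ∀ (u : Fin N ⊎ Fin N → Bool) → sum (λ i → y i ∧ u (splitAt N i)) ≡
                sum (λ d → y (d ↑ˡ N) ∧ u (inj₁ d)) xor sum (λ d → y (N ↑ʳ d) ∧ u (inj₂ d))
        split u = trans (sum-++ N _) (cong₂ _xor_
          (sum-cong-≗ (λ d → cong (λ s → y (d ↑ˡ N) ∧ u s) (splitAt-↑ˡ N d N)))
          (sum-cong-≗ (λ d → cong (λ s → y (N ↑ʳ d) ∧ u s) (splitAt-↑ʳ N N d))))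
        column : ∀ (z : Fin N → Bool) f f⁻ j → (∀ d → al d ≡ true → [ f d ]≟ j ≡ [ f⁻ ]≟ d) →
          sum (λ d → z d ∧ step f d j) ≡ (z j ∧ al j) xor (z f⁻ ∧ al f⁻)
        column z f f⁻ j inv = trans (sum-cong-≗ (λ d → trans (cong (λ q → z d ∧ q) (pt d)) (sep (z d) (al d) ([ j ]≟ d) ([ f⁻ ]≟ d))))
          (trans (∑-distrib-+ _ _) (cong₂ _xor_ (sum-single j (λ d → z d ∧ al d)) (sum-single f⁻ (λ d → z d ∧ al d))))
          where
          pt : ∀ d → step f d j ≡ al d ∧ ([ j ]≟ d xor [ f⁻ ]≟ d)
          pt d with al d in e
          ... | true  = cong₂ _xor_ ([≟]-sym d j) (inv d e)
          ... | false = refl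
          sep : ∀ z a u v → z ∧ (a ∧ (u xor v)) ≡ (u ∧ (z ∧ a)) xor (v ∧ (z ∧ a))
          sep z a u v = trans (sym (𝔹.∧-assoc z a _)) (trans (𝔹.∧-comm (z ∧ a) _) (𝔹.∧-distribʳ-xor (z ∧ a) u v))
        -- The unknown at `j` occurs in the `r`-equations of `j` and of `r (r j)`, its preimage
        -- under `r`, and in the `mate`-equations of `j` and of `mate j`.
        balance : ∀ {j} → al j ≡ true → F j ≡ g j xor g (r (r j))
        balance {j} hj = sym (xor-cancel (trans (cong₂ _xor_
            (sym (column (λ d → y (d ↑ˡ N)) r (r (r j)) j (λ d _ → does-cong {i = r d} {k = r (r j)} (λ { refl → r³ d }) (λ { refl → r³ j }))))
            (sym (column (λ d → y (N ↑ʳ d)) mate (mate j) j (λ d hd → does-cong {i = mate d} {k = mate j} (λ { refl → mate-mate hd }) (λ { refl → mate-mate hj })))))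
          (trans (sym (split [ (λ d → step r d j) , (λ d → step mate d j) ]′)) (hy j))))
        F-mate : ∀ {d} → al d ≡ true → F (mate d) ≡ F d
        F-mate {d} hd = trans (cong (λ x → h (mate d) xor h x) (mate-mate hd)) (𝔹.xor-comm (h (mate d)) (h d))
        F-even : ∀ {d} → al d ≡ true → F d xor (F (r d) xor F (r (r d))) ≡ false
        F-even {d} hd = trans (cong₂ _xor_ (balance hd) (cong₂ _xor_ (balance (al-rr hd)) (balance (al-rr (al-rr hd)))))
          (trans (cong₂ (λ u v → (g d xor g (r (r d))) xor ((g (r d) xor g u) xor (g (r (r d)) xor g v))) (r³ d) (r³ (r d)))
            (tri (g d) (g (r d)) (g (r (r d)))))
          where
          tri : ∀ a b c → (a xor c) xor ((b xor a) xor (c xor b)) ≡ false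
          tri true  true  true  = refl
          tri true  true  false = refl
          tri true  false true  = refl
          tri true  false false = refl
          tri false true  true  = refl
          tri false true  false = refl
          tri false false true  = refl
          tri false false false = refl
        c : Σ (Fin K → Bool) λ c → ∀ {d} → al d ≡ true → F d ≡ c (lab d) xor c (lab (r d))
        c = cyc F F-mate F-even
        total-cong : ∀ {F G : Fin N → Bool} {es} → (∀ {d} → al d ≡ true → F d ≡ G d) → All (λ e → al e ≡ true) es → total F es ≡ total G es
        total-cong eq []       = refl
        total-cong eq (h ∷ hs) = cong₂ _xor_ (eq h) (total-cong eq hs)
        even : total F es ≡ false
        even = trans (total-cong (proj₂ c) al-es) (closed (proj₁ c))
        odd : total F es ≡ true
        odd = trans (sym (sum-∂ h es)) (trans (sum-cong-≗ (λ d → 𝔹.∧-assoc (y (N ↑ʳ d)) (al d) (∂ es d)))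
          (trans (sym (trans (split [ (λ _ → false) , (λ d → al d ∧ ∂ es d) ]′) (cong (_xor sum (λ d → y (N ↑ʳ d) ∧ (al d ∧ ∂ es d))) (sum-false (λ d → 𝔹.∧-zeroʳ (y (d ↑ˡ N))))))) hb))

  -- Colourings linking two terminals of a face

  Mixed : Bool → Bool → Bool → Set
  Mixed a b c = ¬ (a ≡ b × b ≡ c)

  mixed₁₂ : ∀ {a b c} → a ≡ false → b ≡ true → Mixed a b c
  mixed₁₂ refl refl (() , _)

  mixed₂₁ : ∀ {a b c} → a ≡ true → b ≡ false → Mixed a b c
  mixed₂₁ refl refl (() , _)

  mixed₂₃ : ∀ {a b c} → b ≡ false → c ≡ true → Mixed a b c
  mixed₂₃ refl refl (_ , ())

  mixed₃₂ : ∀ {a b c} → b ≡ true → c ≡ false → Mixed a b c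
  mixed₃₂ refl refl (_ , ())

  mixed₁₃ : ∀ {a b c} → a ≡ false → c ≡ true → Mixed a b c
  mixed₁₃ refl refl (refl , ())

  mixed₃₁ : ∀ {a b c} → a ≡ true → c ≡ false → Mixed a b c
  mixed₃₁ refl refl (refl , ())

  mixed-rotate : ∀ {a b c} → Mixed a b c → Mixed b c a
  mixed-rotate h (refl , refl) = h (refl , refl)

  mixed-not : ∀ {a b c} → Mixed a b c → Mixed (not a) (not b) (not c)
  mixed-not {a} {b} {c} h (e , e′) = h (𝔹.not-injective e , 𝔹.not-injective e′)

  -- Both kinds are seen from the face `lab d`: the edge of `d`, and the corner at the vertex of
  -- `d`. `Rep` below selects the true face through which a terminal is linked.
  data Terminal : Set where
    edge corner : Fin N → Terminal

  dart : Terminal → Fin N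
  dart (edge d)   = d
  dart (corner d) = d

  module _ (M : Map) where
    open Map M

    MixedAt : (Fin K → Bool) → Fin N → Set
    MixedAt c d = Mixed (c (lab d)) (c (lab (r d))) (c (lab (r (r d))))

    -- The edges between faces of different colours then form a 2-factor.
    Proper : (Fin K → Bool) → Set
    Proper c = ∀ {d} → al d ≡ true → MixedAt c d

    TrueEdges : (Fin K → Bool) → (Fin K → Bool) → Set
    TrueEdges c k = ∀ {d} → al d ≡ true → c (lab d) ≡ true → c (lab (r d)) ≡ true → k (lab d) ≡ k (lab (r d))

    -- An impredicative way to say that f and g are connected through faces of colour true.
    Linked : (Fin K → Bool) → Fin K → Fin K → Set
    Linked c f g = ∀ k → TrueEdges c k → k f ≡ k g

    Rep : (Fin K → Bool) → Terminal → Fin K → Set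
    Rep c (edge d)   f = f ≡ lab (r d) × c f ≡ true
    Rep c (corner d) f = c f ≡ true × (f ≡ lab (r d) × c (lab (r (r d))) ≡ false ⊎ f ≡ lab (r (r d)) × c (lab (r d)) ≡ false)

    On : Fin K → Terminal → Set
    On z τ = al (dart τ) ≡ true × lab (dart τ) ≡ z

    record Sol (z : Fin K) (τ₁ τ₂ : Terminal) : Set where
      constructor sol
      field
        c      : Fin K → Bool
        proper : Proper c
        cz     : c z ≡ false
        f g    : Fin K
        rep₁   : Rep c τ₁ f
        rep₂   : Rep c τ₂ g
        linked : Linked c f g

    Solvable : Set
    Solvable = ∀ {z τ₁ τ₂} → On z τ₁ → On z τ₂ → Sol z τ₁ τ₂

    EdgeSolvable : Set
    EdgeSolvable = ∀ {z a b} → On z (edge a) → On z (edge b) → Sol z (edge a) (edge b)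

    swap-sol : ∀ {z τ₁ τ₂} → Sol z τ₁ τ₂ → Sol z τ₂ τ₁
    swap-sol (sol c p cz f g r₁ r₂ l) = sol c p cz g f r₂ r₁ (λ k h → sym (l k h))

    mixedAt-r : ∀ {c d} → MixedAt c d → MixedAt c (r d)
    mixedAt-r {c} {d} h = subst (λ x → Mixed (c (lab (r d))) (c (lab (r (r d)))) (c (lab x))) (sym (r³ d)) (mixed-rotate h)

  proper-not : ∀ {M c} → Proper M c → Proper M (λ l → not (c l))
  proper-not p h = mixed-not (p h)

  -- Solve for the face lab d with its two edges at the vertex of d as terminals; exchange the colours
  -- if b is true.
  odd-one-out : ∀ {M} → EdgeSolvable M → ∀ {d} → Map.al M d ≡ true → ∀ b →
    let open Map M in Σ (Fin K → Bool) λ c → Proper M c × c (lab d) ≡ b × c (lab (r d)) ≡ not b × c (lab (r (r d))) ≡ not b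
  odd-one-out {M} solve {d} h b = by b (solve {lab d} {d} {ν d} (h , refl) (al-ν h , lab-ν h))
    where
    open Laws M using (lab; ν; al-ν; lab-ν; lab-r-ν)
    by : ∀ b → Sol M (lab d) (edge d) (edge (ν d)) → Σ (Fin K → Bool) λ c → Proper M c × c (lab d) ≡ b × c (lab (r d)) ≡ not b × c (lab (r (r d))) ≡ not b
    by false (sol c p cz f g (refl , cf) (refl , cg) _) = c , p , cz , cf , trans (cong c (sym (lab-r-ν h))) cg
    by true  (sol c p cz f g (refl , cf) (refl , cg) _) = (λ l → not (c l)) , proper-not {M} {c} p , cong not cz , cong not cf , cong not (trans (cong c (sym (lab-r-ν h))) cg)

  -- Removing the two ends of an edge

  At : Fin N → Fin N → Set
  At t d = d ≡ t ⊎ d ≡ r t ⊎ d ≡ r (r t)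

  at? : ∀ t d → Dec (At t d)
  at? t d = (d ≟ t) ⊎-dec ((d ≟ r t) ⊎-dec (d ≟ r (r t)))

  at-r : ∀ {t d} → At t d → At t (r d)
  at-r (inj₁ refl)        = inj₂ (inj₁ refl)
  at-r (inj₂ (inj₁ refl)) = inj₂ (inj₂ refl)
  at-r (inj₂ (inj₂ refl)) = inj₁ (r³ _)

  at-r⁻ : ∀ {t d} → At t (r d) → At t d
  at-r⁻ {t} {d} h = subst (At t) (r³ d) (at-r (at-r h))

  at-transport : ∀ (P : Fin N → Set) → (∀ {d} → P d → P (r d)) → ∀ {t d} → P t → At t d → P d
  at-transport P step p (inj₁ refl)        = p
  at-transport P step p (inj₂ (inj₁ refl)) = step p
  at-transport P step p (inj₂ (inj₂ refl)) = step (step p)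

  merge : Fin K → Fin K → Fin K → Fin K
  merge u z l = if does (l ≟ u) then z else l

  merge-hit : ∀ {u z l} → l ≡ u → merge u z l ≡ z
  merge-hit {u} {z} {l} e with l ≟ u
  ... | yes _ = refl
  ... | no h  = ⊥-elim (h e)

  merge-miss : ∀ {u z l} → l ≢ u → merge u z l ≡ l
  merge-miss {u} {z} {l} h with l ≟ u
  ... | yes e = ⊥-elim (h e)
  ... | no _  = refl

  merge-cases : ∀ u z l → merge u z l ≡ l × l ≢ u ⊎ merge u z l ≡ z × l ≡ u
  merge-cases u z l with l ≟ u
  ... | yes e = inj₂ (refl , e)
  ... | no h  = inj₁ (refl , h)

  merge-target : ∀ {u z} → merge u z z ≡ z
  merge-target {u} {z} with merge-cases u z z
  ... | inj₁ (e , _) = e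
  ... | inj₂ (e , _) = e

  merge-≡ : ∀ {u z l l′} → merge u z l ≡ merge u z l′ → l ≡ l′ ⊎ (l ≡ u × l′ ≡ z ⊎ l ≡ z × l′ ≡ u)
  merge-≡ {u} {z} {l} {l′} e with merge-cases u z l | merge-cases u z l′
  ... | inj₁ (p , _) | inj₁ (q , _) = inj₁ (trans (sym p) (trans e q))
  ... | inj₁ (p , _) | inj₂ (q , s) = inj₂ (inj₂ (trans (sym p) (trans e q) , s))
  ... | inj₂ (p , s) | inj₁ (q , _) = inj₂ (inj₁ (s , trans (sym q) (trans (sym e) p)))
  ... | inj₂ (p , s) | inj₂ (q , s′) = inj₁ (trans s (sym s′))

  merge-sound : ∀ {u z} (c : Fin K → Bool) → c u ≡ c z → ∀ l → c (merge u z l) ≡ c l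
  merge-sound {u} {z} c e l with merge-cases u z l
  ... | inj₁ (p , _) = cong c p
  ... | inj₂ (p , refl) = trans (cong c p) (sym e)

  -- Common frame for deleting and for splicing an edge: the vertices of `t` and `s` disappear, `π`
  -- pairs the four stubs whose outer ends are joined, and `μ` merges two faces. `Build` collects
  -- what a choice of `π` and `μ` has to satisfy.
  module Rewire (M : Map) {t : Fin N} (ht : Map.al M t ≡ true) (π : Fin N → Fin N) (μ : Fin K → Fin K) where
    open Laws M using (al; mate; lab; al-r; al-mate; mate-mate; lab-mate; loopless; conn; cyc; al-rr; lab-mate′; loopless₂; mate-injective; mate-swap; crosses-back)

    s : Fin N
    s = mate t

    hs : al s ≡ true
    hs = al-mate ht

    lab-s : lab s ≡ lab (r t)
    lab-s = lab-mate′ ht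

    lab-rs : lab (r s) ≡ lab t
    lab-rs = lab-mate ht

    Dead : Fin N → Set
    Dead d = At t d ⊎ At s d

    opaque
      dead? : ∀ d → Dec (Dead d)
      dead? d = at? t d ⊎-dec at? s d

      middle? : ∀ d → Dec (d ≡ t ⊎ d ≡ s)
      middle? d = (d ≟ t) ⊎-dec (d ≟ s)

    dead-r : ∀ {d} → Dead d → Dead (r d)
    dead-r (inj₁ h) = inj₁ (at-r h)
    dead-r (inj₂ h) = inj₂ (at-r h)

    dead-r⁻ : ∀ {d} → Dead (r d) → Dead d
    dead-r⁻ (inj₁ h) = inj₁ (at-r⁻ h)
    dead-r⁻ (inj₂ h) = inj₂ (at-r⁻ h)

    dead-al : ∀ {d} → Dead d → al d ≡ true
    dead-al (inj₁ h) = at-transport (λ d → al d ≡ true) al-rr ht h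
    dead-al (inj₂ h) = at-transport (λ d → al d ≡ true) al-rr hs h

    Stub : Fin N → Set
    Stub e = Dead e × e ≢ t × e ≢ s

    t≢rt : ∀ {d} → al d ≡ true → r d ≢ d
    t≢rt h e = loopless h (cong lab (sym e))

    t≢rrt : ∀ {d} → al d ≡ true → r (r d) ≢ d
    t≢rrt h e = loopless₂ h (cong lab (sym e))

    ¬at-ts : ¬ At t s
    ¬at-ts (inj₁ e)        = loopless ht (trans (cong lab (sym e)) lab-s)
    ¬at-ts (inj₂ (inj₁ e)) = loopless₂ ht (trans (sym lab-rs) (cong (λ x → lab (r x)) e))
    ¬at-ts (inj₂ (inj₂ e)) = loopless (al-rr ht) (trans (sym lab-s) (cong lab e))

    ¬at-st : ¬ At s t
    ¬at-st (inj₁ e)        = ¬at-ts (inj₁ (sym e))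
    ¬at-st (inj₂ (inj₁ e)) = ¬at-ts (inj₂ (inj₂ (trans (sym (r³ s)) (cong (λ x → r (r x)) (sym e)))))
    ¬at-st (inj₂ (inj₂ e)) = ¬at-ts (inj₂ (inj₁ (trans (sym (r³ s)) (cong r (sym e)))))

    stub-rt : Stub (r t)
    stub-rt = inj₁ (inj₂ (inj₁ refl)) , t≢rt ht , λ e → ¬at-ts (inj₂ (inj₁ (sym e)))

    stub-rrt : Stub (r (r t))
    stub-rrt = inj₁ (inj₂ (inj₂ refl)) , t≢rrt ht , λ e → ¬at-ts (inj₂ (inj₂ (sym e)))

    stub-rs : Stub (r s)
    stub-rs = inj₂ (inj₂ (inj₁ refl)) , (λ e → ¬at-st (inj₂ (inj₁ (sym e)))) , t≢rt hs

    stub-rrs : Stub (r (r s))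
    stub-rrs = inj₂ (inj₂ (inj₂ refl)) , (λ e → ¬at-st (inj₂ (inj₂ (sym e)))) , t≢rrt hs

    stub-cases : ∀ {e} → Stub e → (e ≡ r t ⊎ e ≡ r (r t)) ⊎ (e ≡ r s ⊎ e ≡ r (r s))
    stub-cases (inj₁ (inj₁ e) , h , _)        = ⊥-elim (h e)
    stub-cases (inj₁ (inj₂ e) , _)            = inj₁ e
    stub-cases (inj₂ (inj₁ e) , _ , h)        = ⊥-elim (h e)
    stub-cases (inj₂ (inj₂ e) , _)            = inj₂ e

    al⁻ : Fin N → Bool
    al⁻ d = al d ∧ not (does (dead? d))

    mate⁻ : Fin N → Fin N
    mate⁻ d = if does (dead? (mate d)) then mate (π (mate d)) else mate d

    lab⁻ : Fin N → Fin K
    lab⁻ d = μ (lab d)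

    alive⁻ : ∀ {d} → al d ≡ true → ¬ Dead d → al⁻ d ≡ true
    alive⁻ {d} h ¬x with dead? d
    ... | yes x = ⊥-elim (¬x x)
    ... | no _  = trans (𝔹.∧-identityʳ (al d)) h

    alive : ∀ {d} → al⁻ d ≡ true → al d ≡ true
    alive {d} h with al d
    ... | true = refl

    ¬dead : ∀ {d} → al⁻ d ≡ true → ¬ Dead d
    ¬dead {d} h x with dead? d
    ... | yes _ = true≢false h (𝔹.∧-zeroʳ (al d))
    ... | no ¬x = ¬x x

    mate⁻-keep : ∀ {d} → ¬ Dead (mate d) → mate⁻ d ≡ mate d
    mate⁻-keep {d} ¬x with dead? (mate d)
    ... | yes x = ⊥-elim (¬x x)
    ... | no _  = refl

    mate⁻-join : ∀ {d} → Dead (mate d) → mate⁻ d ≡ mate (π (mate d))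
    mate⁻-join {d} x with dead? (mate d)
    ... | yes _ = refl
    ... | no ¬x = ⊥-elim (¬x x)

    mate⁻-stub : ∀ {e} → Stub e → mate⁻ (mate e) ≡ mate (π e)
    mate⁻-stub {e} (x , _) = trans (mate⁻-join (subst Dead (sym (mate-mate (dead-al x))) x)) (cong (λ y → mate (π y)) (mate-mate (dead-al x)))

    stub-mate : ∀ {d} → al d ≡ true → ¬ Dead d → Dead (mate d) → Stub (mate d)
    stub-mate h ¬x y = y , (λ e → ¬x (inj₂ (inj₁ (mate-swap h e)))) , λ e → ¬x (inj₁ (inj₁ (mate-injective h ht e)))

    Mate-inv : (Fin N → Bool) → Set
    Mate-inv F = ∀ {d} → al⁻ d ≡ true → F (mate⁻ d) ≡ F d

    r-inv : (Fin N → Bool) → Set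
    r-inv F = ∀ {d} → al⁻ d ≡ true → F (r d) ≡ F d

    -- Mark the removed vertices and all darts where `X` is `α`. The face of `e` leaves the marked
    -- region at `e` and has to come back; since `X` is constant along the surviving edges, it can
    -- only come back through a stub.
    other-crossing : ∀ X → r-inv X → Mate-inv X → ∀ α {e} → Stub e → ¬ Dead (mate e) → X (mate e) ≢ α →
      ∃[ e′ ] (Stub e′ × X (mate e′) ≢ α × lab (r e′) ≡ lab e)
    other-crossing X X-r X-mate α {e} x free ne = found
      where
      Y : Fin N → Bool
      Y d = if does (dead? d) then true else does (X d 𝔹.≟ α)
      killed : ∀ {d} → Dead d → Y d ≡ true
      killed {d} x with dead? d
      ... | yes _ = refl
      ... | no ¬x = ⊥-elim (¬x x)
      live : ∀ {d} → ¬ Dead d → Y d ≡ does (X d 𝔹.≟ α)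
      live {d} ¬x with dead? d
      ... | yes x = ⊥-elim (¬x x)
      ... | no _  = refl
      no-α : ∀ {b} → b ≢ α → does (b 𝔹.≟ α) ≡ false
      no-α {b} h with b 𝔹.≟ α
      ... | yes e = ⊥-elim (h e)
      ... | no _  = refl
      is-α : ∀ {b} → b ≡ α → does (b 𝔹.≟ α) ≡ true
      is-α {b} h with b 𝔹.≟ α
      ... | yes _ = refl
      ... | no ¬h = ⊥-elim (¬h h)
      Y-r : ∀ {d} → al d ≡ true → Y (r d) ≡ Y d
      Y-r {d} h = by (dead? d)
        where
        by : Dec (Dead d) → Y (r d) ≡ Y d
        by (yes x) = trans (killed (dead-r x)) (sym (killed x))
        by (no ¬x) = trans (live (λ y → ¬x (dead-r⁻ y))) (trans (cong (λ b → does (b 𝔹.≟ α)) (X-r (alive⁻ h ¬x))) (sym (live ¬x)))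
      found : ∃[ e′ ] (Stub e′ × X (mate e′) ≢ α × lab (r e′) ≡ lab e)
      found with crosses-back Y Y-r (dead-al (proj₁ x)) (killed (proj₁ x)) (trans (live free) (no-α ne))
      ... | d , h , ld , Yd , Ym = by (dead? d) (dead? (mate d))
        where
        by : Dec (Dead d) → Dec (Dead (mate d)) → ∃[ e′ ] (Stub e′ × X (mate e′) ≢ α × lab (r e′) ≡ lab e)
        by (yes y) _ = ⊥-elim (true≢false (killed y) Yd)
        by (no ¬y) (no ¬z) = ⊥-elim (true≢false (trans (sym (trans (live ¬z) (cong (λ b → does (b 𝔹.≟ α)) (trans (cong X (sym (mate⁻-keep ¬z))) (X-mate (alive⁻ h ¬y)))))) Ym) (trans (sym (live ¬y)) Yd))
        by (no ¬y) (yes z) = mate d , stub-mate h ¬y z , (λ q → true≢false (is-α (trans (cong X (sym (mate-mate h))) q)) (trans (sym (live ¬y)) Yd)) , trans (lab-mate h) ld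

    -- `A` and `B` are the sides of the edge of `t`, `U` and `W` the faces at its ends. An edge
    -- joining two stubs would identify two of these four, and looplessness keeps apart every pair
    -- except `U` and `W`.
    free-of-digons : lab (r (r t)) ≢ lab (r (r s)) → ∀ {e} → Stub e → ¬ Dead (mate e)
    free-of-digons U≢W {e} x y = by (stub-cases x) (stub-cases (y , (λ q → proj₂ (proj₂ x) (mate-swap (dead-al (proj₁ x)) q)) , (λ q → proj₁ (proj₂ x) (mate-injective (dead-al (proj₁ x)) ht q))))
      where
      A≢B : lab t ≢ lab (r t)
      A≢B = loopless ht
      B≢U : lab (r t) ≢ lab (r (r t))
      B≢U = loopless (al-rr ht)
      A≢U : lab t ≢ lab (r (r t))
      A≢U = loopless₂ ht
      A≢W : lab t ≢ lab (r (r s))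
      A≢W q = loopless (al-rr hs) (trans lab-rs q)
      B≢W : lab (r t) ≢ lab (r (r s))
      B≢W q = loopless₂ hs (trans lab-s q)
      by : (e ≡ r t ⊎ e ≡ r (r t)) ⊎ (e ≡ r s ⊎ e ≡ r (r s)) → (mate e ≡ r t ⊎ mate e ≡ r (r t)) ⊎ (mate e ≡ r s ⊎ mate e ≡ r (r s)) → ⊥
      by (inj₁ p) (inj₁ q) = tt p q
        where
        tt : e ≡ r t ⊎ e ≡ r (r t) → mate e ≡ r t ⊎ mate e ≡ r (r t) → ⊥
        tt (inj₁ refl) (inj₁ q) = B≢U (trans (cong lab (sym q)) (lab-mate′ (al-rr ht)))
        tt (inj₁ refl) (inj₂ q) = A≢B (trans (cong lab (sym (r³ t))) (trans (cong (λ w → lab (r w)) (sym q)) (lab-mate (al-rr ht))))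
        tt (inj₂ refl) (inj₁ q) = A≢B (sym (trans (cong lab (sym q)) (trans (lab-mate′ (al-rr (al-rr ht))) (cong lab (r³ t)))))
        tt (inj₂ refl) (inj₂ q) = A≢U (sym (trans (cong lab (sym q)) (trans (lab-mate′ (al-rr (al-rr ht))) (cong lab (r³ t)))))
      by (inj₂ p) (inj₂ q) = ss p q
        where
        ss : e ≡ r s ⊎ e ≡ r (r s) → mate e ≡ r s ⊎ mate e ≡ r (r s) → ⊥
        ss (inj₁ refl) (inj₁ q) = A≢W (trans (sym lab-rs) (trans (cong lab (sym q)) (lab-mate′ (al-rr hs))))
        ss (inj₁ refl) (inj₂ q) = A≢B (trans (trans (sym lab-rs) (sym (lab-mate (al-rr hs)))) (trans (cong (λ w → lab (r w)) q) (trans (cong lab (r³ s)) lab-s)))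
        ss (inj₂ refl) (inj₁ q) = A≢B (trans (sym lab-rs) (trans (cong lab (sym q)) (trans (lab-mate′ (al-rr (al-rr hs))) (trans (cong lab (r³ s)) lab-s))))
        ss (inj₂ refl) (inj₂ q) = B≢W (sym (trans (cong lab (sym q)) (trans (lab-mate′ (al-rr (al-rr hs))) (trans (cong lab (r³ s)) lab-s))))
      by (inj₁ p) (inj₂ q) = ts p q
        where
        ts : e ≡ r t ⊎ e ≡ r (r t) → mate e ≡ r s ⊎ mate e ≡ r (r s) → ⊥
        ts (inj₁ refl) (inj₁ q) = A≢U (trans (sym lab-rs) (trans (cong lab (sym q)) (lab-mate′ (al-rr ht))))
        ts (inj₁ refl) (inj₂ q) = U≢W (sym (trans (cong lab (sym q)) (lab-mate′ (al-rr ht))))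
        ts (inj₂ refl) (inj₁ q) = U≢W (sym (trans (cong (λ w → lab (r w)) (sym q)) (lab-mate (al-rr (al-rr ht)))))
        ts (inj₂ refl) (inj₂ q) = A≢W (sym (trans (cong lab (sym q)) (trans (lab-mate′ (al-rr (al-rr ht))) (cong lab (r³ t)))))
      by (inj₂ p) (inj₁ q) = st p q
        where
        st : e ≡ r s ⊎ e ≡ r (r s) → mate e ≡ r t ⊎ mate e ≡ r (r t) → ⊥
        st (inj₁ refl) (inj₁ q) = B≢W (trans (cong lab (sym q)) (lab-mate′ (al-rr hs)))
        st (inj₁ refl) (inj₂ q) = U≢W (trans (cong lab (sym q)) (lab-mate′ (al-rr hs)))
        st (inj₂ refl) (inj₁ q) = U≢W (trans (cong (λ w → lab (r w)) (sym q)) (lab-mate (al-rr (al-rr hs))))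
        st (inj₂ refl) (inj₂ q) = B≢U (sym (trans (cong lab (sym q)) (trans (lab-mate′ (al-rr (al-rr hs))) (trans (cong lab (r³ s)) lab-s))))

    module Build
      (π-stub : ∀ {e} → Stub e → Stub (π e) × π (π e) ≡ e × μ (lab (π e)) ≡ μ (lab (r e)))
      (free : ∀ {e} → Stub e → ¬ Dead (mate e))
      (loopless⁻ : ∀ {d} → al⁻ d ≡ true → lab⁻ d ≢ lab⁻ (r d))
      (connected : ∀ X → r-inv X → Mate-inv X → ∀ {e e′} → Stub e → Stub e′ → X (mate e) ≡ X (mate e′))
      (balanced : ∀ F → Mate-inv F → F (mate (r t)) xor F (mate (r (r t))) ≡ F (mate (r s)) xor F (mate (r (r s))))
      (sound : ∀ F → Mate-inv F → (c : Fin K → Bool) → (∀ {e} → Stub e → F (mate e) ≡ c (lab e) xor c (lab (r e))) →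
               F (mate (r t)) xor F (mate (r (r t))) ≡ c (lab t) xor c (lab (r t)) → ∀ l → c (μ l) ≡ c l)
      where

      stub-alive⁻ : ∀ {e} → Stub e → al⁻ (mate e) ≡ true
      stub-alive⁻ x = alive⁻ (al-mate (dead-al (proj₁ x))) (free x)

      conn⁻ : ∀ X → r-inv X → Mate-inv X → ∀ {d d′} → al⁻ d ≡ true → al⁻ d′ ≡ true → X d ≡ X d′
      conn⁻ X X-r X-mate {d} {d′} h h′ = trans (sym (live (¬dead h))) (trans (conn Y Y-r Y-mate (alive h) (alive h′)) (live (¬dead h′)))
        where
        Y : Fin N → Bool
        Y d = if does (dead? d) then X (mate (r t)) else X d
        live : ∀ {d} → ¬ Dead d → Y d ≡ X d
        live {d} ¬x with dead? d
        ... | yes x = ⊥-elim (¬x x)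
        ... | no _  = refl
        killed : ∀ {d} → Dead d → Y d ≡ X (mate (r t))
        killed {d} x with dead? d
        ... | yes _ = refl
        ... | no ¬x = ⊥-elim (¬x x)
        Y-r : ∀ {d} → al d ≡ true → Y (r d) ≡ Y d
        Y-r {d} h = by (dead? d)
          where
          by : Dec (Dead d) → Y (r d) ≡ Y d
          by (yes x) = trans (killed (dead-r x)) (sym (killed x))
          by (no ¬x) = trans (live (λ y → ¬x (dead-r⁻ y))) (trans (X-r (alive⁻ h ¬x)) (sym (live ¬x)))
        outside : ∀ {d} → al d ≡ true → ¬ Dead d → Dead (mate d) → X (mate (r t)) ≡ X d
        outside h ¬x y = trans (connected X X-r X-mate stub-rt (stub-mate h ¬x y)) (cong X (mate-mate h))
        Y-mate : ∀ {d} → al d ≡ true → Y (mate d) ≡ Y d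
        Y-mate {d} h = by (dead? d) (dead? (mate d))
          where
          by : Dec (Dead d) → Dec (Dead (mate d)) → Y (mate d) ≡ Y d
          by (yes x) (yes y) = trans (killed y) (sym (killed x))
          by (no ¬x) (no ¬y) = trans (live ¬y) (trans (cong X (sym (mate⁻-keep ¬y))) (trans (X-mate (alive⁻ h ¬x)) (sym (live ¬x))))
          by (no ¬x) (yes y) = trans (killed y) (trans (outside h ¬x y) (sym (live ¬x)))
          by (yes x) (no ¬y) = trans (live ¬y) (trans (sym (outside (al-mate h) ¬y (subst Dead (sym (mate-mate h)) x))) (sym (killed x)))

      -- An even subgraph `F` is continued to `M`: a stub takes the value at its outer end, and the
      -- edge of `t` takes the sum `τ` that makes one end even. By `balanced` the other end is even
      -- too, and by `sound` the resulting set of faces respects the merging.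
      cyc⁻ : ∀ F → Mate-inv F → (∀ {d} → al⁻ d ≡ true → F d xor (F (r d) xor F (r (r d))) ≡ false) →
             Σ (Fin K → Bool) λ c → ∀ {d} → al⁻ d ≡ true → F d ≡ c (lab⁻ d) xor c (lab⁻ (r d))
      cyc⁻ F F-mate F-even = c , λ {d} h → trans (sym (live (¬dead h))) (trans (G≡δc (alive h)) (sym (cong₂ _xor_ (c-μ (lab d)) (c-μ (lab (r d))))))
        where
        τ : Bool
        τ = F (mate (r t)) xor F (mate (r (r t)))
        G : Fin N → Bool
        G d = if does (dead? d) then (if does (middle? d) then τ else F (mate d)) else F d
        live : ∀ {d} → ¬ Dead d → G d ≡ F d
        live {d} ¬x with dead? d
        ... | yes x = ⊥-elim (¬x x)
        ... | no _  = refl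
        stub : ∀ {d} → Stub d → G d ≡ F (mate d)
        stub {d} (x , ¬t , ¬s) with dead? d | middle? d
        ... | no ¬x | _           = ⊥-elim (¬x x)
        ... | yes _ | no _        = refl
        ... | yes _ | yes (inj₁ e) = ⊥-elim (¬t e)
        ... | yes _ | yes (inj₂ e) = ⊥-elim (¬s e)
        middle : ∀ {d} → d ≡ t ⊎ d ≡ s → G d ≡ τ
        middle {d} e with dead? d | middle? d
        ... | no ¬x | _ = ⊥-elim (¬x (dd e))
          where
          dd : d ≡ t ⊎ d ≡ s → Dead d
          dd (inj₁ e) = inj₁ (inj₁ e)
          dd (inj₂ e) = inj₂ (inj₁ e)
        ... | yes _ | yes _ = refl
        ... | yes _ | no ¬e = ⊥-elim (¬e e)
        G-mate : ∀ {d} → al d ≡ true → G (mate d) ≡ G d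
        G-mate {d} h = by (dead? d) (dead? (mate d)) (d ≟ t) (d ≟ s)
          where
          by : Dec (Dead d) → Dec (Dead (mate d)) → Dec (d ≡ t) → Dec (d ≡ s) → G (mate d) ≡ G d
          by _ _ (yes refl) _ = trans (middle (inj₂ refl)) (sym (middle (inj₁ refl)))
          by _ _ _ (yes refl) = trans (middle (inj₁ (mate-mate ht))) (sym (middle (inj₂ refl)))
          by (no ¬x) (no ¬y) _ _ = trans (live ¬y) (trans (cong F (sym (mate⁻-keep ¬y))) (trans (F-mate (alive⁻ h ¬x)) (sym (live ¬x))))
          by (no ¬x) (yes y) _ _ = trans (stub (stub-mate h ¬x y)) (trans (cong F (mate-mate h)) (sym (live ¬x)))
          by (yes x) _ (no ¬t) (no ¬s) = trans (live (free (x , ¬t , ¬s))) (sym (stub (x , ¬t , ¬s)))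
        Even : Fin N → Set
        Even d = G d xor (G (r d) xor G (r (r d))) ≡ false
        even-r : ∀ {d} → Even d → Even (r d)
        even-r {d} h = trans (cong (λ x → G (r d) xor (G (r (r d)) xor G x)) (r³ d)) (rot (G d) (G (r d)) (G (r (r d))) h)
          where
          rot : ∀ a b c → a xor (b xor c) ≡ false → b xor (c xor a) ≡ false
          rot a b c h = trans (sym (𝔹.xor-assoc b c a)) (trans (𝔹.xor-comm (b xor c) a) h)
        G-even : ∀ {d} → al d ≡ true → Even d
        G-even {d} h = by (dead? d)
          where
          by : Dec (Dead d) → Even d
          by (yes (inj₁ x)) = at-transport Even even-r (trans (cong₂ _xor_ (middle (inj₁ refl)) (cong₂ _xor_ (stub stub-rt) (stub stub-rrt))) (𝔹.xor-same τ)) x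
          by (yes (inj₂ x)) = at-transport Even even-r (trans (cong₂ _xor_ (middle (inj₂ refl)) (trans (cong₂ _xor_ (stub stub-rs) (stub stub-rrs)) (sym (balanced F F-mate)))) (𝔹.xor-same τ)) x
          by (no ¬x) = trans (cong₂ _xor_ (live ¬x) (cong₂ _xor_ (live (λ y → ¬x (dead-r⁻ y))) (live (λ y → ¬x (dead-r⁻ (dead-r⁻ y)))))) (F-even (alive⁻ h ¬x))
        c : Fin K → Bool
        c = proj₁ (cyc G G-mate G-even)
        G≡δc : ∀ {d} → al d ≡ true → G d ≡ c (lab d) xor c (lab (r d))
        G≡δc = proj₂ (cyc G G-mate G-even)
        c-μ : ∀ l → c (μ l) ≡ c l
        c-μ = sound F F-mate c (λ x → trans (sym (stub x)) (G≡δc (dead-al (proj₁ x)))) (trans (sym (middle (inj₁ refl))) (G≡δc ht))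

      rewired : Map
      rewired = record
        { al = al⁻ ; mate = mate⁻ ; lab = lab⁻
        ; al-r = al-r⁻
        ; al-mate = λ {d} h → al-m h (dead? (mate d))
        ; mate-mate = λ {d} h → m-m h (dead? (mate d))
        ; lab-mate = λ {d} h → l-m h (dead? (mate d))
        ; loopless = loopless⁻
        ; conn = conn⁻
        ; cyc = cyc⁻
        }
        where
        al-r⁻ : ∀ d → al⁻ (r d) ≡ al⁻ d
        al-r⁻ d with dead? d | dead? (r d)
        ... | yes _ | yes _ = cong (_∧ false) (al-r d)
        ... | no _  | no _  = cong (_∧ true) (al-r d)
        ... | yes x | no ¬y = ⊥-elim (¬y (dead-r x))
        ... | no ¬x | yes y = ⊥-elim (¬x (dead-r⁻ y))
        π-of : ∀ {d} → al⁻ d ≡ true → Dead (mate d) → Stub (mate d)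
        π-of h y = stub-mate (alive h) (¬dead h) y
        al-m : ∀ {d} → al⁻ d ≡ true → Dec (Dead (mate d)) → al⁻ (mate⁻ d) ≡ true
        al-m h (no ¬y) = subst (λ x → al⁻ x ≡ true) (sym (mate⁻-keep ¬y)) (alive⁻ (al-mate (alive h)) ¬y)
        al-m h (yes y) = subst (λ x → al⁻ x ≡ true) (sym (mate⁻-join y)) (stub-alive⁻ (proj₁ (π-stub (π-of h y))))
        m-m : ∀ {d} → al⁻ d ≡ true → Dec (Dead (mate d)) → mate⁻ (mate⁻ d) ≡ d
        m-m h (no ¬y) = trans (cong mate⁻ (mate⁻-keep ¬y)) (trans (mate⁻-keep (λ x → ¬dead h (subst Dead (mate-mate (alive h)) x))) (mate-mate (alive h)))
        m-m h (yes y) = trans (cong mate⁻ (mate⁻-join y)) (trans (mate⁻-stub (proj₁ (π-stub (π-of h y)))) (trans (cong mate (proj₁ (proj₂ (π-stub (π-of h y))))) (mate-mate (alive h))))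
        l-m : ∀ {d} → al⁻ d ≡ true → Dec (Dead (mate d)) → lab⁻ (r (mate⁻ d)) ≡ lab⁻ d
        l-m h (no ¬y) = cong μ (trans (cong (λ x → lab (r x)) (mate⁻-keep ¬y)) (lab-mate (alive h)))
        l-m {d} h (yes y) = trans (cong (λ x → μ (lab (r x))) (mate⁻-join y)) (trans (cong μ (lab-mate (dead-al (proj₁ (proj₁ (π-stub (π-of h y)))))))
          (trans (proj₂ (proj₂ (π-stub (π-of h y)))) (cong μ (lab-mate (alive h)))))

      smaller : size rewired < size M
      smaller = count-< (λ d → alive) t ht (¬true⇒false (λ h → ¬dead h (inj₁ (inj₁ refl))))

      lift-proper : ∀ {c} → Proper rewired c → MixedAt M (λ l → c (μ l)) t → MixedAt M (λ l → c (μ l)) s → Proper M (λ l → c (μ l))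
      lift-proper {c} p mt ms {d} h with dead? d
      ... | yes (inj₁ x) = at-transport (MixedAt M (λ l → c (μ l))) (mixedAt-r M {λ l → c (μ l)}) mt x
      ... | yes (inj₂ x) = at-transport (MixedAt M (λ l → c (μ l))) (mixedAt-r M {λ l → c (μ l)}) ms x
      ... | no ¬x = p (alive⁻ h ¬x)

      -- `fixed` holds as soon as the merged face is false. The true faces are then untouched by
      -- `μ`, so links and representatives carry over unchanged.
      module Lift {c : Fin K → Bool} (fixed : ∀ l → c (μ l) ≡ true → μ l ≡ l) where

        lift-linked : ∀ {f g} → Linked rewired c f g → Linked M (λ l → c (μ l)) f g
        lift-linked L k te = L k λ {d} h e e′ → trans (cong k (fixed (lab d) e)) (trans (te (alive h) e e′) (cong k (sym (fixed (lab (r d)) e′))))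

        lift-rep : ∀ τ {f} → Rep rewired c τ f → Rep M (λ l → c (μ l)) τ f
        lift-rep (edge d) (refl , h) = fixed _ h , trans (cong c (cong μ (fixed _ h))) h
        lift-rep (corner d) (h , inj₁ (refl , h′)) = trans (cong c (cong μ (fixed _ h))) h , inj₁ (fixed _ h , h′)
        lift-rep (corner d) (h , inj₂ (refl , h′)) = trans (cong c (cong μ (fixed _ h))) h , inj₂ (fixed _ h , h′)

  fixed-merge : ∀ {u z} {c : Fin K → Bool} → c z ≡ false → ∀ l → c (merge u z l) ≡ true → merge u z l ≡ l
  fixed-merge {u} {z} {c} cz l h with merge-cases u z l
  ... | inj₁ (e , _) = e
  ... | inj₂ (e , _) = ⊥-elim (true≢false h (trans (cong c e) cz))

  -- Among the stubs, `r e` is `t` or `mate t` only for `r (r t)` and `r (r (mate t))`: the case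
  -- distinction separates the stubs that precede the removed edge in the rotation from those that
  -- follow it.
  near : (M : Map) → Fin N → (f g : Fin N → Fin N) → Fin N → Fin N
  near M t f g e = if does (r e ≟ t) then f e else if does (r e ≟ Map.mate M t) then f e else g e

  module _ (M : Map) {t : Fin N} where
    near-yes : ∀ f g {e} → r e ≡ t ⊎ r e ≡ Map.mate M t → near M t f g e ≡ f e
    near-yes f g {e} h with r e ≟ t | r e ≟ Map.mate M t
    near-yes f g h | yes _ | _ = refl
    near-yes f g h | no _ | yes _ = refl
    near-yes f g (inj₁ p) | no ¬p | no _ = ⊥-elim (¬p p)
    near-yes f g (inj₂ p) | no _ | no ¬p = ⊥-elim (¬p p)

    near-no : ∀ f g {e} → r e ≢ t → r e ≢ Map.mate M t → near M t f g e ≡ g e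
    near-no f g {e} h h′ with r e ≟ t | r e ≟ Map.mate M t
    ... | yes p | _ = ⊥-elim (h p)
    ... | no _ | yes p = ⊥-elim (h′ p)
    ... | no _ | no _ = refl

  xor-cancelʳ : ∀ u a w → u xor a ≡ a xor w → w ≡ u
  xor-cancelʳ u true  w e = 𝔹.not-injective (trans (sym e) (𝔹.xor-comm u true))
  xor-cancelʳ u false w e = trans (sym e) (𝔹.xor-identityʳ u)

  -- Removing the edge of t with its ends and joining the four loose ends crosswise, so that the two
  -- faces lab (r (r t)) and lab (r (r s)) at its ends become one.
  module Splice (M : Map) {t : Fin N} (ht : Map.al M t ≡ true)
    (U≢W : Map.lab M (r (r t)) ≢ Map.lab M (r (r (Map.mate M t))))
    (apart : ∀ {d} → Map.al M d ≡ true → Map.lab M d ≡ Map.lab M (r (r t)) → Map.lab M (r d) ≢ Map.lab M (r (r (Map.mate M t)))) where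
    open Laws M using (mate; lab; al-mate; mate-mate; lab-mate; loopless; al-rr; lab-mate′; loopless₂)
    open Rewire M ht (near M t (λ e → r (mate (r e))) (λ e → r (r (mate (r (r e)))))) (merge (lab (r (r (mate t)))) (lab (r (r t)))) public
    private
      via₁ via₂ : Fin N → Fin N
      via₁ e = r (mate (r e))
      via₂ e = r (r (mate (r (r e))))
      π : Fin N → Fin N
      π = near M t (λ e → r (mate (r e))) (λ e → r (r (mate (r (r e)))))
      μ : Fin K → Fin K
      μ = merge (lab (r (r (mate t)))) (lab (r (r t)))

    π-rrt : π (r (r t)) ≡ r s
    π-rrt = trans (near-yes M via₁ via₂ (inj₁ (r³ t))) (cong (λ x → r (mate x)) (r³ t))

    π-rrs : π (r (r s)) ≡ r t
    π-rrs = trans (near-yes M via₁ via₂ (inj₂ (r³ s))) (cong r (trans (cong mate (r³ s)) (mate-mate ht)))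

    π-rt : π (r t) ≡ r (r s)
    π-rt = trans (near-no M via₁ via₂ (proj₁ (proj₂ stub-rrt)) (proj₂ (proj₂ stub-rrt))) (cong (λ x → r (r (mate x))) (r³ t))

    π-rs : π (r s) ≡ r (r t)
    π-rs = trans (near-no M via₁ via₂ (proj₁ (proj₂ stub-rrs)) (proj₂ (proj₂ stub-rrs))) (cong (λ x → r (r x)) (trans (cong mate (r³ s)) (mate-mate ht)))

    μW : ∀ {l} → l ≡ lab (r (r s)) → μ l ≡ lab (r (r t))
    μW e = merge-hit e

    μU : ∀ {l} → l ≡ lab (r (r t)) → μ l ≡ lab (r (r t))
    μU refl = merge-target

    π-stub : ∀ {e} → Stub e → Stub (π e) × π (π e) ≡ e × μ (lab (π e)) ≡ μ (lab (r e))
    π-stub x with stub-cases x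
    ... | inj₁ (inj₁ refl) = subst Stub (sym π-rt) stub-rrs , trans (cong π π-rt) π-rrs , trans (μW (cong lab π-rt)) (sym (μU refl))
    ... | inj₁ (inj₂ refl) = subst Stub (sym π-rrt) stub-rs , trans (cong π π-rrt) π-rs , cong μ (trans (cong lab π-rrt) (trans lab-rs (cong lab (sym (r³ t)))))
    ... | inj₂ (inj₁ refl) = subst Stub (sym π-rs) stub-rrt , trans (cong π π-rs) π-rrt , trans (μU (cong lab π-rs)) (sym (μW refl))
    ... | inj₂ (inj₂ refl) = subst Stub (sym π-rrs) stub-rt , trans (cong π π-rrs) π-rt , cong μ (trans (cong lab π-rrs) (trans (sym lab-s) (cong lab (sym (r³ s)))))

    loopless⁻ : ∀ {d} → al⁻ d ≡ true → lab⁻ d ≢ lab⁻ (r d)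
    loopless⁻ {d} h e with merge-≡ {l = lab d} e
    ... | inj₁ q = loopless (alive h) q
    ... | inj₂ (inj₂ (p , q)) = apart (alive h) p q
    ... | inj₂ (inj₁ (p , q)) = apart (al-mate (alive h)) (trans (lab-mate′ (alive h)) q) (trans (lab-mate (alive h)) p)

    join₁ : ∀ {F} → Mate-inv F → F (mate (r t)) ≡ F (mate (r (r s)))
    join₁ {F} inv = sym (trans (cong F (trans (cong mate (sym π-rt)) (sym (mate⁻-stub stub-rt)))) (inv (alive⁻ (al-mate (al-rr ht)) (free-of-digons U≢W stub-rt))))

    join₂ : ∀ {F} → Mate-inv F → F (mate (r (r t))) ≡ F (mate (r s))
    join₂ {F} inv = sym (trans (cong F (trans (cong mate (sym π-rrt)) (sym (mate⁻-stub stub-rrt)))) (inv (alive⁻ (al-mate (al-rr (al-rr ht))) (free-of-digons U≢W stub-rrt))))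

    connected : ∀ X → r-inv X → Mate-inv X → ∀ {e e′} → Stub e → Stub e′ → X (mate e) ≡ X (mate e′)
    connected X X-r X-mate {e} {e′} x x′ = trans (to-rt x) (sym (to-rt x′))
      where
      -- If the values differed, the face `lab (r (r t))` would have to come back at a stub that
      -- differs from `r t` as well. The labels leave only `r t` itself and `r (r s)`, whose outer
      -- end has been joined to that of `r t`.
      key : X (mate (r (r t))) ≡ X (mate (r t))
      key with X (mate (r (r t))) 𝔹.≟ X (mate (r t))
      ... | yes q = q
      ... | no ¬q with other-crossing X X-r X-mate (X (mate (r t))) stub-rrt (free-of-digons U≢W stub-rrt) ¬q
      ... | e , x , ne , le with stub-cases x
      ... | inj₁ (inj₁ refl) = ⊥-elim (ne refl)
      ... | inj₁ (inj₂ refl) = ⊥-elim (loopless₂ ht (trans (cong lab (sym (r³ t))) le))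
      ... | inj₂ (inj₁ refl) = ⊥-elim (U≢W (sym le))
      ... | inj₂ (inj₂ refl) = ⊥-elim (ne (sym (join₁ {X} X-mate)))
      to-rt : ∀ {e} → Stub e → X (mate e) ≡ X (mate (r t))
      to-rt x with stub-cases x
      ... | inj₁ (inj₁ refl) = refl
      ... | inj₁ (inj₂ refl) = key
      ... | inj₂ (inj₁ refl) = trans (sym (join₂ {X} X-mate)) key
      ... | inj₂ (inj₂ refl) = sym (join₁ {X} X-mate)

    open Build π-stub (free-of-digons U≢W) loopless⁻ connected
      (λ F inv → trans (cong₂ _xor_ (join₁ {F} inv) (join₂ {F} inv)) (𝔹.xor-comm (F (mate (r (r s)))) (F (mate (r s)))))
      (λ F inv c F≡ _ → merge-sound c (xor-cancelʳ (c (lab (r (r t)))) (c (lab t)) (c (lab (r (r s))))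
        (trans (cong (λ x → c (lab (r (r t))) xor c (lab x)) (sym (r³ t))) (trans (sym (F≡ stub-rrt)) (trans (join₂ {F} inv) (trans (F≡ stub-rs) (cong (λ x → c x xor c (lab (r (r s)))) lab-rs)))))))
      public

  -- Deleting the edge of t and suppressing its ends, so that its two sides lab t and lab (r t) become
  -- one face.
  module Contract (M : Map) {t : Fin N} (ht : Map.al M t ≡ true)
    (U≢W : Map.lab M (r (r t)) ≢ Map.lab M (r (r (Map.mate M t))))
    (only : ∀ {d} → Map.al M d ≡ true → Map.lab M d ≡ Map.lab M t → Map.lab M (r d) ≡ Map.lab M (r t) → d ≡ t) where
    open Laws M using (mate; lab; al-mate; lab-mate; loopless; al-rr; lab-mate′; mate-swap)
    open Rewire M ht (near M t (λ e → r (r e)) r) (merge (lab (r t)) (lab t)) public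
    private
      π : Fin N → Fin N
      π = near M t (λ e → r (r e)) r
      μ : Fin K → Fin K
      μ = merge (lab (r t)) (lab t)

    π-rrt : π (r (r t)) ≡ r t
    π-rrt = trans (near-yes M (λ e → r (r e)) r (inj₁ (r³ t))) (r³ (r t))

    π-rrs : π (r (r s)) ≡ r s
    π-rrs = trans (near-yes M (λ e → r (r e)) r (inj₂ (r³ s))) (r³ (r s))

    π-rt : π (r t) ≡ r (r t)
    π-rt = near-no M (λ e → r (r e)) r (proj₁ (proj₂ stub-rrt)) (proj₂ (proj₂ stub-rrt))

    π-rs : π (r s) ≡ r (r s)
    π-rs = near-no M (λ e → r (r e)) r (proj₁ (proj₂ stub-rrs)) (proj₂ (proj₂ stub-rrs))

    μA : ∀ {l} → l ≡ lab t → μ l ≡ lab t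
    μA refl = merge-target

    μB : ∀ {l} → l ≡ lab (r t) → μ l ≡ lab t
    μB e = merge-hit e

    π-stub : ∀ {e} → Stub e → Stub (π e) × π (π e) ≡ e × μ (lab (π e)) ≡ μ (lab (r e))
    π-stub x with stub-cases x
    ... | inj₁ (inj₁ refl) = subst Stub (sym π-rt) stub-rrt , trans (cong π π-rt) π-rrt , cong (λ x → μ (lab x)) π-rt
    ... | inj₁ (inj₂ refl) = subst Stub (sym π-rrt) stub-rt , trans (cong π π-rrt) π-rt , trans (μB (cong lab π-rrt)) (sym (μA (cong lab (r³ t))))
    ... | inj₂ (inj₁ refl) = subst Stub (sym π-rs) stub-rrs , trans (cong π π-rs) π-rrs , cong (λ x → μ (lab x)) π-rs
    ... | inj₂ (inj₂ refl) = subst Stub (sym π-rrs) stub-rs , trans (cong π π-rrs) π-rs , trans (μA (trans (cong lab π-rrs) lab-rs)) (sym (μB (trans (cong lab (r³ s)) lab-s)))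

    loopless⁻ : ∀ {d} → al⁻ d ≡ true → lab⁻ d ≢ lab⁻ (r d)
    loopless⁻ {d} h e with merge-≡ {l = lab d} e
    ... | inj₁ q = loopless (alive h) q
    ... | inj₂ (inj₂ (p , q)) = ¬dead h (inj₁ (inj₁ (only (alive h) p q)))
    ... | inj₂ (inj₁ (p , q)) = ¬dead h (inj₂ (inj₁ (mate-swap (alive h) (only (al-mate (alive h)) (trans (lab-mate′ (alive h)) q) (trans (lab-mate (alive h)) p)))))

    join₁ : ∀ {F} → Mate-inv F → F (mate (r t)) ≡ F (mate (r (r t)))
    join₁ {F} inv = sym (trans (cong F (trans (cong mate (sym π-rt)) (sym (mate⁻-stub stub-rt)))) (inv (alive⁻ (al-mate (al-rr ht)) (free-of-digons U≢W stub-rt))))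

    join₂ : ∀ {F} → Mate-inv F → F (mate (r s)) ≡ F (mate (r (r s)))
    join₂ {F} inv = sym (trans (cong F (trans (cong mate (sym π-rs)) (sym (mate⁻-stub stub-rs)))) (inv (alive⁻ (al-mate (al-rr hs)) (free-of-digons U≢W stub-rs))))

    connected : ∀ X → r-inv X → Mate-inv X → ∀ {e e′} → Stub e → Stub e′ → X (mate e) ≡ X (mate e′)
    connected X X-r X-mate {e} {e′} x x′ = trans (to-rt x) (sym (to-rt x′))
      where
      key : X (mate (r s)) ≡ X (mate (r t))
      key with X (mate (r s)) 𝔹.≟ X (mate (r t))
      ... | yes q = q
      ... | no ¬q with other-crossing X X-r X-mate (X (mate (r t))) stub-rs (free-of-digons U≢W stub-rs) ¬q
      ... | e , x , ne , le with stub-cases x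
      ... | inj₁ (inj₁ refl) = ⊥-elim (ne refl)
      ... | inj₁ (inj₂ refl) = ⊥-elim (ne (sym (join₁ {X} X-mate)))
      ... | inj₂ (inj₁ refl) = ⊥-elim (loopless (al-rr hs) (sym le))
      ... | inj₂ (inj₂ refl) = ⊥-elim (loopless hs (trans (cong lab (sym (r³ s))) le))
      to-rt : ∀ {e} → Stub e → X (mate e) ≡ X (mate (r t))
      to-rt x with stub-cases x
      ... | inj₁ (inj₁ refl) = refl
      ... | inj₁ (inj₂ refl) = sym (join₁ {X} X-mate)
      ... | inj₂ (inj₁ refl) = key
      ... | inj₂ (inj₂ refl) = trans (sym (join₂ {X} X-mate)) key

    open Build π-stub (free-of-digons U≢W) loopless⁻ connected
      (λ F inv → trans (trans (cong (_xor F (mate (r (r t)))) (join₁ {F} inv)) (𝔹.xor-same (F (mate (r (r t))))))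
        (sym (trans (cong (_xor F (mate (r (r s)))) (join₂ {F} inv)) (𝔹.xor-same (F (mate (r (r s))))))))
      (λ F inv c _ τ → merge-sound c (sym (xor-cancel (trans (sym τ) (trans (cong (_xor F (mate (r (r t)))) (join₁ {F} inv)) (𝔹.xor-same (F (mate (r (r t)))))))))) public

  -- What solving after the deletion of the edge of `p` yields. Besides producing the chord in the
  -- end, it settles terminals inside the induction whose representatives are the faces at the two
  -- ends of an edge of `z`.
  record Bridged (M : Map) (p : Fin N) : Set where
    constructor bridged
    open Map M
    field
      c      : Fin K → Bool
      proper : Proper M c
      c-p    : c (lab p) ≡ false
      c-rp   : c (lab (r p)) ≡ false
      c-rrp  : c (lab (r (r p))) ≡ true
      c-opp  : c (lab (r (r (mate p)))) ≡ true
      linked : Linked M c (lab (r (r p))) (lab (r (r (mate p))))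

  module _ (M : Map) {t : Fin N} (ht : Map.al M t ≡ true)
    (U≢W : Map.lab M (r (r t)) ≢ Map.lab M (r (r (Map.mate M t))))
    (only : ∀ {d} → Map.al M d ≡ true → Map.lab M d ≡ Map.lab M t → Map.lab M (r d) ≡ Map.lab M (r t) → d ≡ t) where
    open Laws M using (mate; lab; lab-mate; al-rr; lab-mate′)
    open Contract M ht U≢W only using (s; hs; lab-s; stub-rrt; stub-rrs; stub-alive⁻; rewired; lift-proper; module Lift; μA; μB)

    -- The ends of `t` are suppressed inside two edges of the merged face, those of `mate (r (r t))`
    -- and `mate (r (r s))`. Across them lie the faces at the ends of `t`. Taking them as edge
    -- terminals makes these faces true and linked, while both sides of `t` are false.
    contract-bridged : EdgeSolvable rewired → Bridged M t
    contract-bridged solve = by (solve {lab t} {mate (r (r t))} {mate (r (r s))}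
        (stub-alive⁻ stub-rrt , μA (trans (lab-mate′ (al-rr (al-rr ht))) (cong lab (r³ t))))
        (stub-alive⁻ stub-rrs , μB (trans (lab-mate′ (al-rr (al-rr hs))) (trans (cong lab (r³ s)) lab-s))))
      where
      by : Sol rewired (lab t) (edge (mate (r (r t)))) (edge (mate (r (r s)))) → Bridged M t
      by (sol c p cz f g (refl , cf) (refl , cg) l) = record
        { c = λ l → c (merge (lab (r t)) (lab t) l)
        ; proper = lift-proper {c} p (mixed₁₃ cA cU) (mixed₁₃ (trans (cong (λ x → c (merge (lab (r t)) (lab t) x)) lab-s) cB) cW)
        ; c-p = cA ; c-rp = cB ; c-rrp = cU ; c-opp = cW
        ; linked = λ k te → trans (cong k (sym f≡)) (trans (lift-linked l k te) (cong k g≡)) }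
        where
        open Lift {c} (fixed-merge {c = c} cz)
        cA = trans (cong c (μA refl)) cz
        cB = trans (cong c (μB refl)) cz
        cU = trans (cong (λ x → c (merge (lab (r t)) (lab t) x)) (sym (lab-mate (al-rr (al-rr ht))))) cf
        cW = trans (cong (λ x → c (merge (lab (r t)) (lab t) x)) (sym (lab-mate (al-rr (al-rr hs))))) cg
        f≡ = trans (fixed-merge {c = c} cz _ cf) (lab-mate (al-rr (al-rr ht)))
        g≡ = trans (fixed-merge {c = c} cz _ cg) (lab-mate (al-rr (al-rr hs)))

  -- Cutting along two or three edges

  opaque
    _[_↦_] : ∀ {A : Set} → (Fin N → A) → Fin N → A → Fin N → A
    (f [ a ↦ b ]) d = if does (d ≟ a) then b else f d

    ↦-hit : ∀ {A : Set} (f : Fin N → A) {a b d} → d ≡ a → (f [ a ↦ b ]) d ≡ b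
    ↦-hit f {a} {b} {d} e with d ≟ a
    ... | yes _ = refl
    ... | no h  = ⊥-elim (h e)

    ↦-miss : ∀ {A : Set} (f : Fin N → A) {a b d} → d ≢ a → (f [ a ↦ b ]) d ≡ f d
    ↦-miss f {a} {b} {d} h with d ≟ a
    ... | yes e = ⊥-elim (h e)
    ... | no _  = refl

  ∧-true : ∀ {a b} → a ≡ true → b ≡ true → a ∧ b ≡ true
  ∧-true refl refl = refl

  ∧-trueˡ : ∀ {a b} → a ∧ b ≡ true → a ≡ true
  ∧-trueˡ {true} _ = refl

  ∧-trueʳ : ∀ {a b} → a ∧ b ≡ true → b ≡ true
  ∧-trueʳ {true} h = h

  apart-by : ∀ {A : Set} {X : A → Bool} {d d′} → X d ≡ true → X d′ ≡ false → d ≢ d′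
  apart-by h h′ refl = true≢false h h′

  module Side (M : Map) (X : Fin N → Bool) (X-r : ∀ {d} → Map.al M d ≡ true → X (r d) ≡ X d) where
    open Laws M using (al; mate; lab; al-mate; mate-mate; lab-mate; conn; cyc; al-rr; lab-mate′)

    -- The other side is shrunk to a point of value `α`, so that the connectedness of `M` can be
    -- applied.
    side-conn : ∀ (Y : Fin N → Bool) α →
      (∀ {d} → al d ≡ true → X d ≡ false → Y (r d) ≡ Y d) →
      (∀ {d} → al d ≡ true → X d ≡ false → X (mate d) ≡ false → Y (mate d) ≡ Y d) →
      (∀ {d} → al d ≡ true → X d ≡ false → X (mate d) ≡ true → Y d ≡ α) →
      ∀ {d d′} → al d ≡ true → al d′ ≡ true → X d ≡ false → X d′ ≡ false → Y d ≡ Y d′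
    side-conn Y α Y-r Y-mate Y-cross {d} {d′} h h′ x x′ = trans (sym (kept x)) (trans (conn Z Z-r Z-mate h h′) (kept x′))
      where
      Z : Fin N → Bool
      Z d = if X d then α else Y d
      kept : ∀ {d} → X d ≡ false → Z d ≡ Y d
      kept {d} x = cong (λ b → if b then α else Y d) x
      lost : ∀ {d} → X d ≡ true → Z d ≡ α
      lost {d} x = cong (λ b → if b then α else Y d) x
      Z-r : ∀ {d} → al d ≡ true → Z (r d) ≡ Z d
      Z-r {d} h with X d in x
      ... | true  = lost (trans (X-r h) x)
      ... | false = trans (kept (trans (X-r h) x)) (Y-r h x)
      Z-mate : ∀ {d} → al d ≡ true → Z (mate d) ≡ Z d
      Z-mate {d} h with X d in x | X (mate d) in y
      ... | true  | true  = refl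
      ... | false | false = Y-mate h x y
      ... | false | true  = sym (Y-cross h x y)
      ... | true  | false = Y-cross (al-mate h) y (trans (cong X (mate-mate h)) x)

    -- On the other side `F` is continued by the boundary of `c₀`, which is automatically even
    -- there. Hence `c₀` has to match `F` only on the crossing edges.
    side-cyc : ∀ (F : Fin N → Bool) (c₀ : Fin K → Bool) →
      (∀ {d} → al d ≡ true → X d ≡ false → X (mate d) ≡ false → F (mate d) ≡ F d) →
      (∀ {d} → al d ≡ true → X d ≡ false → F d xor (F (r d) xor F (r (r d))) ≡ false) →
      (∀ {d} → al d ≡ true → X d ≡ false → X (mate d) ≡ true → F d ≡ c₀ (lab d) xor c₀ (lab (r d))) →
      Σ (Fin K → Bool) λ c → ∀ {d} → al d ≡ true → X d ≡ false → F d ≡ c (lab d) xor c (lab (r d))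
    side-cyc F c₀ F-mate F-even F-cross = proj₁ all , λ h x → trans (sym (kept x)) (proj₂ all h)
      where
      δ G : Fin N → Bool
      δ d = c₀ (lab d) xor c₀ (lab (r d))
      G d = if X d then δ d else F d
      kept : ∀ {d} → X d ≡ false → G d ≡ F d
      kept {d} x = cong (λ b → if b then δ d else F d) x
      lost : ∀ {d} → X d ≡ true → G d ≡ δ d
      lost {d} x = cong (λ b → if b then δ d else F d) x
      δ-mate : ∀ {d} → al d ≡ true → δ (mate d) ≡ δ d
      δ-mate {d} h = trans (cong₂ (λ a b → c₀ a xor c₀ b) (lab-mate′ h) (lab-mate h)) (𝔹.xor-comm (c₀ (lab (r d))) (c₀ (lab d)))
      δ-even : ∀ d → δ d xor (δ (r d) xor δ (r (r d))) ≡ false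
      δ-even d = trans (cong (λ x → δ d xor (δ (r d) xor (c₀ (lab (r (r d))) xor c₀ (lab x)))) (r³ d)) (xor-triangle (c₀ (lab d)) (c₀ (lab (r d))) (c₀ (lab (r (r d)))))
      G-mate : ∀ {d} → al d ≡ true → G (mate d) ≡ G d
      G-mate {d} h with X d in x | X (mate d) in y
      ... | true  | true  = δ-mate h
      ... | false | false = F-mate h x y
      ... | false | true  = trans (δ-mate h) (sym (F-cross h x y))
      ... | true  | false = trans (F-cross (al-mate h) y (trans (cong X (mate-mate h)) x)) (δ-mate h)
      G-even : ∀ {d} → al d ≡ true → G d xor (G (r d) xor G (r (r d))) ≡ false
      G-even {d} h with X d in x
      ... | true  = trans (cong₂ (λ a b → δ d xor (a xor b)) (lost (trans (X-r h) x)) (lost (trans (X-r (al-rr h)) (trans (X-r h) x)))) (δ-even d)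
      ... | false = trans (cong₂ (λ a b → F d xor (a xor b)) (kept (trans (X-r h) x)) (kept (trans (X-r (al-rr h)) (trans (X-r h) x)))) (F-even h x)
      all : Σ (Fin K → Bool) λ c → ∀ {d} → al d ≡ true → G d ≡ c (lab d) xor c (lab (r d))
      all = cyc G G-mate G-even

  -- The side X d ≡ false of the cut formed by the edges of p and q, which get joined to one edge.
  module Cut₂ (M : Map) (X : Fin N → Bool) (X-r : ∀ {d} → Map.al M d ≡ true → X (r d) ≡ X d)
    {p q : Fin N} (hp : Map.al M p ≡ true) (hq : Map.al M q ≡ true)
    (Xp : X p ≡ false) (Xq : X q ≡ false) (Xmp : X (Map.mate M p) ≡ true) (Xmq : X (Map.mate M q) ≡ true)
    (p≢q : p ≢ q)
    (lab-p : Map.lab M p ≡ Map.lab M (r q)) (lab-q : Map.lab M q ≡ Map.lab M (r p))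
    (crossing : ∀ {d} → Map.al M d ≡ true → X d ≡ false → X (Map.mate M d) ≡ true → d ≡ p ⊎ d ≡ q) where
    open Laws M using (al; mate; lab; al-r; al-mate; mate-mate; lab-mate; loopless; conn; cyc; al-rr)
    open Side M X X-r using (side-conn; side-cyc)

    al⁻ : Fin N → Bool
    al⁻ d = al d ∧ not (X d)

    mate⁻ : Fin N → Fin N
    mate⁻ = (mate [ q ↦ p ]) [ p ↦ q ]

    alive⁻ : ∀ {d} → al d ≡ true → X d ≡ false → al⁻ d ≡ true
    alive⁻ h x = ∧-true h (cong not x)

    alive : ∀ {d} → al⁻ d ≡ true → al d ≡ true
    alive = ∧-trueˡ

    side : ∀ {d} → al⁻ d ≡ true → X d ≡ false
    side {d} h = 𝔹.not-injective (∧-trueʳ {al d} h)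

    mate-p : mate⁻ p ≡ q
    mate-p = ↦-hit (mate [ q ↦ p ]) refl

    mate-q : mate⁻ q ≡ p
    mate-q = trans (↦-miss (mate [ q ↦ p ]) (λ e → p≢q (sym e))) (↦-hit mate refl)

    mate-else : ∀ {d} → d ≢ p → d ≢ q → mate⁻ d ≡ mate d
    mate-else ¬p ¬q = trans (↦-miss (mate [ q ↦ p ]) ¬p) (↦-miss mate ¬q)

    mate-in : ∀ {d} → X d ≡ false → X (mate d) ≡ false → mate⁻ d ≡ mate d
    mate-in x y = mate-else (λ { refl → true≢false Xmp y }) (λ { refl → true≢false Xmq y })

    cases : (P : Fin N → Set) → P p → P q → (∀ {d} → al d ≡ true → X d ≡ false → X (mate d) ≡ false → P d) → ∀ {d} → al⁻ d ≡ true → P d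
    cases P Pp Pq Pin {d} h with X (mate d) in y
    ... | false = Pin (alive h) (side h) y
    ... | true with crossing (alive h) (side h) y
    ... | inj₁ refl = Pp
    ... | inj₂ refl = Pq

    cut : Map
    cut = record
      { al = al⁻ ; mate = mate⁻ ; lab = lab
      ; al-r = al-r⁻
      ; al-mate = λ {d} → cases (λ d → al⁻ (mate⁻ d) ≡ true)
          (subst (λ x → al⁻ x ≡ true) (sym mate-p) (alive⁻ hq Xq))
          (subst (λ x → al⁻ x ≡ true) (sym mate-q) (alive⁻ hp Xp))
          (λ h x y → subst (λ x → al⁻ x ≡ true) (sym (mate-in x y)) (alive⁻ (al-mate h) y))
      ; mate-mate = λ {d} → cases (λ d → mate⁻ (mate⁻ d) ≡ d)
          (trans (cong mate⁻ mate-p) mate-q)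
          (trans (cong mate⁻ mate-q) mate-p)
          (λ h x y → trans (cong mate⁻ (mate-in x y)) (trans (mate-in y (trans (cong X (mate-mate h)) x)) (mate-mate h)))
      ; lab-mate = λ {d} → cases (λ d → lab (r (mate⁻ d)) ≡ lab d)
          (trans (cong (λ x → lab (r x)) mate-p) (sym lab-p))
          (trans (cong (λ x → lab (r x)) mate-q) (sym lab-q))
          (λ h x y → trans (cong (λ x → lab (r x)) (mate-in x y)) (lab-mate h))
      ; loopless = λ h → loopless (alive h)
      ; conn = λ Y Y-r Y-mate h h′ → side-conn Y (Y p)
          (λ h x → Y-r (alive⁻ h x))
          (λ h x y → trans (cong Y (sym (mate-in x y))) (Y-mate (alive⁻ h x)))
          (λ h x y → to-p Y Y-mate (crossing h x y))
          (alive h) (alive h′) (side h) (side h′)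
      -- Both crossing edges border the face `lab p` and carry the same value of `F`, so the
      -- boundary of this face, or nothing, continues `F`.
      ; cyc = λ F F-mate F-even → let c , F≡ = side-cyc F (λ l → F p ∧ [ l ]≟ lab p)
                                        (λ h x y → trans (cong F (sym (mate-in x y))) (F-mate (alive⁻ h x)))
                                        (λ h x → F-even (alive⁻ h x))
                                        (λ h x y → at-cross F F-mate (crossing h x y))
                                  in c , λ h → F≡ (alive h) (side h)
      }
      where
      al-r⁻ : ∀ d → al⁻ (r d) ≡ al⁻ d
      al-r⁻ d with al d in e
      ... | true  = trans (cong (_∧ not (X (r d))) (al-rr e)) (cong not (X-r e))
      ... | false = cong (_∧ not (X (r d))) (trans (al-r d) e)
      to-p : ∀ (Y : Fin N → Bool) → (∀ {d} → al⁻ d ≡ true → Y (mate⁻ d) ≡ Y d) → ∀ {d} → d ≡ p ⊎ d ≡ q → Y d ≡ Y p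
      to-p Y Y-mate (inj₁ refl) = refl
      to-p Y Y-mate (inj₂ refl) = sym (trans (cong Y (sym mate-q)) (Y-mate (alive⁻ hq Xq)))
      at-cross : ∀ (F : Fin N → Bool) → (∀ {d} → al⁻ d ≡ true → F (mate⁻ d) ≡ F d) → ∀ {d} → d ≡ p ⊎ d ≡ q → F d ≡ (F p ∧ [ lab d ]≟ lab p) xor (F p ∧ [ lab (r d) ]≟ lab p)
      at-cross F F-mate (inj₁ refl) = sym (trans (cong₂ (λ a b → (F p ∧ a) xor (F p ∧ b)) (does-refl (lab p)) (does-false (λ e → loopless hp (sym e)))) (ar (F p)))
        where
        ar : ∀ a → (a ∧ true) xor (a ∧ false) ≡ a
        ar true  = refl
        ar false = refl
      at-cross F F-mate (inj₂ refl) = trans (to-p F F-mate (inj₂ refl)) (sym (trans (cong₂ (λ a b → (F p ∧ [ a ]≟ lab p) xor (F p ∧ [ b ]≟ lab p)) lab-q (sym lab-p))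
          (trans (cong₂ (λ a b → (F p ∧ a) xor (F p ∧ b)) (does-false (λ e → loopless hp (sym e))) (does-refl (lab p))) (ar (F p)))))
        where
        ar : ∀ a → (a ∧ false) xor (a ∧ true) ≡ a
        ar true  = refl
        ar false = refl

    smaller : size cut < size M
    smaller = count-< (λ d → alive) (mate p) (al-mate hp) (trans (cong (λ b → al (mate p) ∧ not b) Xmp) (𝔹.∧-zeroʳ _))

  -- The side X d ≡ false of the cut formed by the edges of d₁, d₂ and d₃; the vertex of d₁ is kept and
  -- takes over the other ends of the three edges.
  module Cut₃ (M : Map) (X : Fin N → Bool) (X-r : ∀ {d} → Map.al M d ≡ true → X (r d) ≡ X d)
    {d₁ d₂ d₃ : Fin N} (h₁ : Map.al M d₁ ≡ true) (h₂ : Map.al M d₂ ≡ true) (h₃ : Map.al M d₃ ≡ true)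
    (X₁ : X d₁ ≡ true) (X₂ : X d₂ ≡ true) (X₃ : X d₃ ≡ true)
    (Y₁ : X (Map.mate M d₁) ≡ false) (Y₂ : X (Map.mate M d₂) ≡ false) (Y₃ : X (Map.mate M d₃) ≡ false)
    (l₁ : Map.lab M (r d₁) ≡ Map.lab M d₂) (l₂ : Map.lab M (r d₂) ≡ Map.lab M d₃) (l₃ : Map.lab M (r d₃) ≡ Map.lab M d₁)
    (crossing : ∀ {d} → Map.al M d ≡ true → X d ≡ false → X (Map.mate M d) ≡ true → d ≡ Map.mate M d₁ ⊎ d ≡ Map.mate M d₂ ⊎ d ≡ Map.mate M d₃)
    where
    open Laws M using (al; mate; lab; al-r; al-mate; mate-mate; lab-mate; loopless; conn; cyc; al-rr; al-rr⁻; lab-mate′; loopless₂; mate-injective)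
    open Side M X X-r using (side-conn; side-cyc)

    opaque
      kept? : ∀ d → Dec (al d ≡ true × X d ≡ false ⊎ At d₁ d)
      kept? d = ((al d 𝔹.≟ true) ×-dec (X d 𝔹.≟ false)) ⊎-dec at? d₁ d

    al⁻ : Fin N → Bool
    al⁻ d = does (kept? d)

    mate⁻ : Fin N → Fin N
    mate⁻ = (((mate [ r d₁ ↦ mate d₂ ]) [ r (r d₁) ↦ mate d₃ ]) [ mate d₂ ↦ r d₁ ]) [ mate d₃ ↦ r (r d₁) ]

    lab⁻ : Fin N → Fin K
    -- Only the third corner of the kept vertex needs a new label: `d₁` has its own, and `r d₁` has
    -- that of `d₂` by `l₁`.
    lab⁻ = lab [ r (r d₁) ↦ lab d₃ ]

    alive⁻ : ∀ {d} → al d ≡ true × X d ≡ false ⊎ At d₁ d → al⁻ d ≡ true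
    alive⁻ {d} h with kept? d
    ... | yes _ = refl
    ... | no ¬h = ⊥-elim (¬h h)

    alive⁻-in : ∀ {d} → al d ≡ true → X d ≡ false → al⁻ d ≡ true
    alive⁻-in h x = alive⁻ (inj₁ (h , x))

    kept : ∀ {d} → al⁻ d ≡ true → al d ≡ true × X d ≡ false ⊎ At d₁ d
    kept {d} h with kept? d
    ... | yes q = q

    alive : ∀ {d} → al⁻ d ≡ true → al d ≡ true
    alive {d} h with kept h
    ... | inj₁ (q , _) = q
    ... | inj₂ x = at-transport (λ d → al d ≡ true) al-rr h₁ x

    X-at : ∀ {d} → At d₁ d → X d ≡ true
    X-at x = proj₂ (at-transport (λ d → al d ≡ true × X d ≡ true) (λ (h , x) → al-rr h , trans (X-r h) x) (h₁ , X₁) x)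

    mate-ne : mate d₂ ≢ mate d₃
    mate-ne e = loopless h₂ (sym (trans l₂ (cong lab (mate-injective h₃ h₂ (sym e)))))

    ne-in : ∀ {d e} → X d ≡ false → At d₁ e → d ≢ e
    ne-in x y refl = true≢false (X-at y) x

    at₁ : At d₁ (r d₁)
    at₁ = inj₂ (inj₁ refl)

    at₂ : At d₁ (r (r d₁))
    at₂ = inj₂ (inj₂ refl)

    mate-r : mate⁻ (r d₁) ≡ mate d₂
    mate-r = trans (↦-miss _ (λ e → ne-in Y₃ at₁ (sym e))) (trans (↦-miss _ (λ e → ne-in Y₂ at₁ (sym e))) (trans (↦-miss _ (λ e → loopless (al-rr h₁) (cong lab e))) (↦-hit mate refl)))

    mate-rr : mate⁻ (r (r d₁)) ≡ mate d₃
    mate-rr = trans (↦-miss _ (λ e → ne-in Y₃ at₂ (sym e))) (trans (↦-miss _ (λ e → ne-in Y₂ at₂ (sym e))) (↦-hit _ refl))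

    mate-m₂ : mate⁻ (mate d₂) ≡ r d₁
    mate-m₂ = trans (↦-miss _ mate-ne) (↦-hit _ refl)

    mate-m₃ : mate⁻ (mate d₃) ≡ r (r d₁)
    mate-m₃ = ↦-hit _ refl

    mate-else : ∀ {d} → d ≢ r d₁ → d ≢ r (r d₁) → d ≢ mate d₂ → d ≢ mate d₃ → mate⁻ d ≡ mate d
    mate-else a b c e = trans (↦-miss _ e) (trans (↦-miss _ c) (trans (↦-miss _ b) (↦-miss mate a)))

    mate-1 : mate⁻ d₁ ≡ mate d₁
    mate-1 = mate-else (λ e → loopless h₁ (cong lab e)) (λ e → loopless₂ h₁ (cong lab e)) (apart-by X₁ Y₂) (apart-by X₁ Y₃)

    mate-m₁ : mate⁻ (mate d₁) ≡ d₁
    mate-m₁ = trans (mate-else (ne-in Y₁ at₁) (ne-in Y₁ at₂)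
      (λ e → loopless h₁ (trans (cong lab (mate-injective h₁ h₂ e)) (sym l₁)))
      (λ e → loopless h₃ (trans (cong lab (mate-injective h₃ h₁ (sym e))) (sym l₃)))) (mate-mate h₁)

    mate-in : ∀ {d} → al d ≡ true → X d ≡ false → X (mate d) ≡ false → mate⁻ d ≡ mate d
    mate-in h x y = mate-else (ne-in x at₁) (ne-in x at₂)
      (λ { refl → true≢false X₂ (trans (cong X (sym (mate-mate h₂))) y) })
      (λ { refl → true≢false X₃ (trans (cong X (sym (mate-mate h₃))) y) })

    lab-in : ∀ {d} → X d ≡ false → lab⁻ d ≡ lab d
    lab-in x = ↦-miss lab (ne-in x at₂)

    lab-1 : lab⁻ d₁ ≡ lab d₁
    lab-1 = ↦-miss lab (λ e → loopless₂ h₁ (cong lab e))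

    lab-2 : lab⁻ (r d₁) ≡ lab d₂
    lab-2 = trans (↦-miss lab (λ e → loopless (al-rr h₁) (cong lab e))) l₁

    lab-3 : lab⁻ (r (r d₁)) ≡ lab d₃
    lab-3 = ↦-hit lab refl

    cases : (P : Fin N → Set) → P d₁ → P (r d₁) → P (r (r d₁)) → P (mate d₁) → P (mate d₂) → P (mate d₃) →
      (∀ {d} → al d ≡ true → X d ≡ false → X (mate d) ≡ false → P d) → ∀ {d} → al⁻ d ≡ true → P d
    cases P a b c a′ b′ c′ i {d} h with kept h
    ... | inj₂ (inj₁ refl) = a
    ... | inj₂ (inj₂ (inj₁ refl)) = b
    ... | inj₂ (inj₂ (inj₂ refl)) = c
    ... | inj₁ (q , x) with X (mate d) in y
    ... | false = i q x y
    ... | true with crossing q x y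
    ... | inj₁ refl = a′
    ... | inj₂ (inj₁ refl) = b′
    ... | inj₂ (inj₂ refl) = c′

    X-in : ∀ {d} → al d ≡ true → X d ≡ false → X (r d) ≡ false
    X-in h x = trans (X-r h) x

    edges : ∀ {d} → al⁻ d ≡ true → ∃[ e ] (al e ≡ true × lab e ≡ lab⁻ d × lab (r e) ≡ lab⁻ (r d))
    edges {d} h with kept h
    ... | inj₁ (q , x) = d , q , sym (lab-in x) , sym (lab-in (X-in q x))
    ... | inj₂ (inj₁ refl) = d₁ , h₁ , sym lab-1 , trans l₁ (sym lab-2)
    ... | inj₂ (inj₂ (inj₁ refl)) = d₂ , h₂ , sym lab-2 , trans l₂ (sym lab-3)
    ... | inj₂ (inj₂ (inj₂ refl)) = d₃ , h₃ , sym lab-3 , trans l₃ (trans (sym lab-1) (cong lab⁻ (sym (r³ d₁))))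

    cut : Map
    cut = record
      { al = al⁻ ; mate = mate⁻ ; lab = lab⁻
      ; al-r = al-r⁻
      ; al-mate = λ {d} → cases (λ d → al⁻ (mate⁻ d) ≡ true)
          (sb mate-1 (alive⁻-in (al-mate h₁) Y₁)) (sb mate-r (alive⁻-in (al-mate h₂) Y₂)) (sb mate-rr (alive⁻-in (al-mate h₃) Y₃))
          (sb mate-m₁ (alive⁻ (inj₂ (inj₁ refl)))) (sb mate-m₂ (alive⁻ (inj₂ at₁))) (sb mate-m₃ (alive⁻ (inj₂ at₂)))
          (λ h x y → sb (mate-in h x y) (alive⁻-in (al-mate h) y))
      ; mate-mate = λ {d} → cases (λ d → mate⁻ (mate⁻ d) ≡ d)
          (trans (cong mate⁻ mate-1) mate-m₁) (trans (cong mate⁻ mate-r) mate-m₂) (trans (cong mate⁻ mate-rr) mate-m₃)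
          (trans (cong mate⁻ mate-m₁) mate-1) (trans (cong mate⁻ mate-m₂) mate-r) (trans (cong mate⁻ mate-m₃) mate-rr)
          (λ h x y → trans (cong mate⁻ (mate-in h x y)) (trans (mate-in (al-mate h) y (trans (cong X (mate-mate h)) x)) (mate-mate h)))
      ; lab-mate = λ {d} → cases (λ d → lab⁻ (r (mate⁻ d)) ≡ lab⁻ d)
          (trans (cong (λ x → lab⁻ (r x)) mate-1) (trans (lab-in (X-in (al-mate h₁) Y₁)) (trans (lab-mate h₁) (sym lab-1))))
          (trans (cong (λ x → lab⁻ (r x)) mate-r) (trans (lab-in (X-in (al-mate h₂) Y₂)) (trans (lab-mate h₂) (sym lab-2))))
          (trans (cong (λ x → lab⁻ (r x)) mate-rr) (trans (lab-in (X-in (al-mate h₃) Y₃)) (trans (lab-mate h₃) (sym lab-3))))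
          (trans (cong (λ x → lab⁻ (r x)) mate-m₁) (trans lab-2 (trans (sym l₁) (trans (sym (lab-mate′ h₁)) (sym (lab-in Y₁))))))
          (trans (cong (λ x → lab⁻ (r x)) mate-m₂) (trans lab-3 (trans (sym l₂) (trans (sym (lab-mate′ h₂)) (sym (lab-in Y₂))))))
          (trans (cong (λ x → lab⁻ (r x)) mate-m₃) (trans (trans (cong lab⁻ (r³ d₁)) lab-1) (trans (sym l₃) (trans (sym (lab-mate′ h₃)) (sym (lab-in Y₃))))))
          (λ h x y → trans (cong (λ x → lab⁻ (r x)) (mate-in h x y)) (trans (lab-in (X-in (al-mate h) y)) (trans (lab-mate h) (sym (lab-in x)))))
      ; loopless = λ h e → let d , q , a , b = edges h in loopless q (trans a (trans e (sym b)))
      ; conn = λ Y Y-r Y-mate h h′ → trans (to-d₁ Y Y-r Y-mate h) (sym (to-d₁ Y Y-r Y-mate h′))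
      ; cyc = cyc⁻
      }
      where
      sb : ∀ {x y} → x ≡ y → al⁻ y ≡ true → al⁻ x ≡ true
      sb refl h = h
      al-r⁻ : ∀ d → al⁻ (r d) ≡ al⁻ d
      al-r⁻ d with kept? d | kept? (r d)
      ... | yes _ | yes _ = refl
      ... | no _  | no _  = refl
      ... | yes (inj₁ (h , x)) | no ¬k = ⊥-elim (¬k (inj₁ (al-rr h , X-in h x)))
      ... | yes (inj₂ x)       | no ¬k = ⊥-elim (¬k (inj₂ (at-r x)))
      ... | no ¬k | yes (inj₁ (h , x)) = ⊥-elim (¬k (inj₁ (al-rr⁻ h , trans (sym (X-r (al-rr⁻ h))) x)))
      ... | no ¬k | yes (inj₂ x) = ⊥-elim (¬k (inj₂ (at-r⁻ x)))
      hd : ∀ {x} → At d₁ x → al⁻ x ≡ true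
      hd x = alive⁻ (inj₂ x)
      to-d₁ : ∀ (Y : Fin N → Bool) → (∀ {d} → al⁻ d ≡ true → Y (r d) ≡ Y d) → (∀ {d} → al⁻ d ≡ true → Y (mate⁻ d) ≡ Y d) → ∀ {d} → al⁻ d ≡ true → Y d ≡ Y d₁
      to-d₁ Y Y-r Y-mate {d} h with kept h
      ... | inj₂ x = at-transport (λ x → al⁻ x ≡ true × Y x ≡ Y d₁) (λ (h , e) → trans (al-r⁻ _) h , trans (Y-r h) e) (hd (inj₁ refl) , refl) x .proj₂
      ... | inj₁ (q , x) = trans (side-conn Y (Y d₁) (λ h x → Y-r (alive⁻-in h x))
              (λ h x y → trans (cong Y (sym (mate-in h x y))) (Y-mate (alive⁻-in h x)))
              (λ h x y → at-crossing (crossing h x y)) q (al-mate h₁) x Y₁) (at-crossing (inj₁ refl))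
        where
        at-crossing : ∀ {d} → d ≡ mate d₁ ⊎ d ≡ mate d₂ ⊎ d ≡ mate d₃ → Y d ≡ Y d₁
        at-crossing (inj₁ refl)        = trans (cong Y (sym mate-1)) (Y-mate (hd (inj₁ refl)))
        at-crossing (inj₂ (inj₁ refl)) = trans (cong Y (sym mate-r)) (trans (Y-mate (hd at₁)) (Y-r (hd (inj₁ refl))))
        at-crossing (inj₂ (inj₂ refl)) = trans (cong Y (sym mate-rr)) (trans (Y-mate (hd at₂)) (trans (Y-r (hd at₁)) (Y-r (hd (inj₁ refl)))))
      cyc⁻ : ∀ (F : Fin N → Bool) → (∀ {d} → al⁻ d ≡ true → F (mate⁻ d) ≡ F d) → (∀ {d} → al⁻ d ≡ true → F d xor (F (r d) xor F (r (r d))) ≡ false) →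
        Σ (Fin K → Bool) λ c → ∀ {d} → al⁻ d ≡ true → F d ≡ c (lab⁻ d) xor c (lab⁻ (r d))
      cyc⁻ F F-mate F-even = c , F≡
        where
        F₁ F₂ F₃ : Bool
        F₁ = F d₁
        F₂ = F (r d₁)
        F₃ = F (r (r d₁))
        m₁ : F (mate d₁) ≡ F₁
        m₁ = trans (cong F (sym mate-1)) (F-mate (hd (inj₁ refl)))
        m₂ : F (mate d₂) ≡ F₂
        m₂ = trans (cong F (sym mate-r)) (F-mate (hd at₁))
        m₃ : F (mate d₃) ≡ F₃
        m₃ = trans (cong F (sym mate-rr)) (F-mate (hd at₂))
        -- The cut edges separate the faces of `d₁`, `d₂`, `d₃` cyclically. With false on `lab d₁`,
        -- the values of `F` at `d₁` and `d₃` determine the colours of the other two faces; the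
        -- value at `d₂` then agrees because `F` is even at the kept vertex.
        c₀ : Fin K → Bool
        c₀ l = if does (l ≟ lab d₂) then F₁ else (if does (l ≟ lab d₃) then F₃ else false)
        z≢x : lab d₁ ≢ lab d₂
        z≢x e = loopless h₁ (trans e (sym l₁))
        x≢y : lab d₂ ≢ lab d₃
        x≢y e = loopless h₂ (trans e (sym l₂))
        y≢z : lab d₃ ≢ lab d₁
        y≢z e = loopless h₃ (trans e (sym l₃))
        c₀-x : c₀ (lab d₂) ≡ F₁
        c₀-x = cong (λ b → if b then F₁ else (if does (lab d₂ ≟ lab d₃) then F₃ else false)) (does-refl (lab d₂))
        c₀-y : c₀ (lab d₃) ≡ F₃
        c₀-y = trans (cong (λ b → if b then F₁ else (if does (lab d₃ ≟ lab d₃) then F₃ else false)) (does-false (λ e → x≢y (sym e)))) (cong (λ b → if b then F₃ else false) (does-refl (lab d₃)))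
        c₀-z : c₀ (lab d₁) ≡ false
        c₀-z = trans (cong (λ b → if b then F₁ else (if does (lab d₁ ≟ lab d₃) then F₃ else false)) (does-false z≢x)) (cong (λ b → if b then F₃ else false) (does-false (λ e → y≢z (sym e))))
        F₂≡ : F₂ ≡ F₃ xor F₁
        F₂≡ = ar F₁ F₂ F₃ (F-even (hd (inj₁ refl)))
          where
          ar : ∀ a b c → a xor (b xor c) ≡ false → b ≡ c xor a
          ar a b c h = xor-cancel (trans (sym (𝔹.xor-assoc b c a)) (trans (𝔹.xor-comm (b xor c) a) h))
        at-crossing : ∀ {d} → d ≡ mate d₁ ⊎ d ≡ mate d₂ ⊎ d ≡ mate d₃ → F d ≡ c₀ (lab d) xor c₀ (lab (r d))
        at-crossing (inj₁ refl)        = trans m₁ (sym (trans (cong₂ (λ a b → c₀ a xor c₀ b) (trans (lab-mate′ h₁) l₁) (lab-mate h₁)) (trans (cong₂ _xor_ c₀-x c₀-z) (𝔹.xor-identityʳ F₁))))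
        at-crossing (inj₂ (inj₁ refl)) = trans m₂ (trans F₂≡ (sym (trans (cong₂ (λ a b → c₀ a xor c₀ b) (trans (lab-mate′ h₂) l₂) (lab-mate h₂)) (cong₂ _xor_ c₀-y c₀-x))))
        at-crossing (inj₂ (inj₂ refl)) = trans m₃ (sym (trans (cong₂ (λ a b → c₀ a xor c₀ b) (trans (lab-mate′ h₃) l₃) (lab-mate h₃)) (cong₂ _xor_ c₀-z c₀-y)))
        sc : Σ (Fin K → Bool) λ c → ∀ {d} → al d ≡ true → X d ≡ false → F d ≡ c (lab d) xor c (lab (r d))
        sc = side-cyc F c₀ (λ h x y → trans (cong F (sym (mate-in h x y))) (F-mate (alive⁻-in h x))) (λ h x → F-even (alive⁻-in h x)) (λ h x y → at-crossing (crossing h x y))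
        c : Fin K → Bool
        c = proj₁ sc
        back : ∀ {d} → al d ≡ true → X (mate d) ≡ false → F (mate d) ≡ c (lab d) xor c (lab (r d))
        back {d} h y = trans (proj₂ sc (al-mate h) y) (trans (cong₂ (λ a b → c a xor c b) (lab-mate′ h) (lab-mate h)) (𝔹.xor-comm (c (lab (r d))) (c (lab d))))
        F≡ : ∀ {d} → al⁻ d ≡ true → F d ≡ c (lab⁻ d) xor c (lab⁻ (r d))
        F≡ {d} h with kept h
        ... | inj₁ (q , x) = trans (proj₂ sc q x) (sym (cong₂ (λ a b → c a xor c b) (lab-in x) (lab-in (X-in q x))))
        ... | inj₂ (inj₁ refl) = trans (sym m₁) (trans (back h₁ Y₁) (cong₂ (λ a b → c a xor c b) (sym lab-1) (trans l₁ (sym lab-2))))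
        ... | inj₂ (inj₂ (inj₁ refl)) = trans (sym m₂) (trans (back h₂ Y₂) (cong₂ (λ a b → c a xor c b) (sym lab-2) (trans l₂ (sym lab-3))))
        ... | inj₂ (inj₂ (inj₂ refl)) = trans (sym m₃) (trans (back h₃ Y₃) (cong₂ (λ a b → c a xor c b) (sym lab-3) (trans l₃ (trans (sym lab-1) (cong lab⁻ (sym (r³ d₁)))))))

    -- A dart `d₂` or `d₃` that is not at the kept vertex gets lost. If both were at it, the face
    -- labels would make `d₁`, `d₂`, `d₃` the successive darts of one vertex.
    smaller : ¬ (d₂ ≡ r d₁ × d₃ ≡ r d₂) → size cut < size M
    smaller nonfacial with at? d₁ d₂ | at? d₁ d₃
    ... | no ¬x | _ = count-< (λ d → alive) d₂ h₂ (¬true⇒false (λ h → lost (kept h)))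
      where
      lost : ¬ (al d₂ ≡ true × X d₂ ≡ false ⊎ At d₁ d₂)
      lost (inj₁ (_ , x)) = true≢false X₂ x
      lost (inj₂ x) = ¬x x
    ... | yes _ | no ¬x = count-< (λ d → alive) d₃ h₃ (¬true⇒false (λ h → lost (kept h)))
      where
      lost : ¬ (al d₃ ≡ true × X d₃ ≡ false ⊎ At d₁ d₃)
      lost (inj₁ (_ , x)) = true≢false X₃ x
      lost (inj₂ x) = ¬x x
    ... | yes x | yes y = ⊥-elim (nonfacial (e₂ x , e₃ y))
      where
      e₂ : At d₁ d₂ → d₂ ≡ r d₁
      e₂ (inj₁ e) = ⊥-elim (loopless h₁ (trans (cong lab (sym e)) (sym l₁)))
      e₂ (inj₂ (inj₁ e)) = e
      e₂ (inj₂ (inj₂ e)) = ⊥-elim (loopless (al-rr h₁) (trans l₁ (cong lab e)))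
      e₃ : At d₁ d₃ → d₃ ≡ r d₂
      e₃ (inj₁ e) = ⊥-elim (loopless h₃ (trans (cong lab e) (sym l₃)))
      e₃ (inj₂ (inj₁ e)) = ⊥-elim (loopless h₂ (sym (trans l₂ (trans (cong lab e) l₁))))
      e₃ (inj₂ (inj₂ e)) = trans e (cong r (sym (e₂ x)))

  -- Gluing colourings of the two sides of a cut

  -- What makes colourings of one side transferable: by `edges`, faces adjacent in `S` are adjacent
  -- in `M`, which carries links over; by `occurs`, every face of `S` really touches the side, which
  -- fixes its colour after gluing.
  record SideMap (M : Map) (X : Fin N → Bool) (S : Map) : Set where
    open Map M
    field
      kept   : ∀ {d} → al d ≡ true → X d ≡ false → Map.al S d ≡ true
      same   : ∀ {d} → al d ≡ true → X d ≡ false → Map.lab S d ≡ lab d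
      edges  : ∀ {d} → Map.al S d ≡ true → ∃[ e ] (al e ≡ true × lab e ≡ Map.lab S d × lab (r e) ≡ Map.lab S (r d))
      occurs : ∀ {d} → Map.al S d ≡ true → ∃[ e ] (al e ≡ true × X e ≡ false × lab e ≡ Map.lab S d)

  not-true : ∀ {b} → not b ≡ false → b ≡ true
  not-true {true} _ = refl

  module Gluing (M : Map) (X : Fin N → Bool) (X-r : ∀ {d} → Map.al M d ≡ true → X (r d) ≡ X d)
    {S₁ S₂ : Map} (side₁ : SideMap M (λ d → not (X d)) S₁) (side₂ : SideMap M X S₂)
    {c₁ c₂ : Fin K → Bool} (proper₁ : Proper S₁ c₁) (proper₂ : Proper S₂ c₂)
    (agree : ∀ {d d′} → Map.al M d ≡ true → Map.al M d′ ≡ true → X d ≡ true → X d′ ≡ false → Map.lab M d ≡ Map.lab M d′ → c₁ (Map.lab M d) ≡ c₂ (Map.lab M d)) where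
    open Laws M using (al; lab; al-rr)

    Occ : Bool → Fin K → Set
    Occ b l = ∃[ d ] (al d ≡ true × X d ≡ b × lab d ≡ l)

    opaque
      occ? : ∀ l → Dec (Occ true l)
      occ? l = any? (λ d → (al d 𝔹.≟ true) ×-dec (X d 𝔹.≟ true) ×-dec (lab d ≟ l))

    -- A face that occurs on both sides may take either colour, by `agree`.
    c : Fin K → Bool
    c l = if does (occ? l) then c₁ l else c₂ l

    on₁ : ∀ {l} → Occ true l → c l ≡ c₁ l
    on₁ {l} o with occ? l
    ... | yes _ = refl
    ... | no ¬o = ⊥-elim (¬o o)

    on₂ : ∀ {l} → Occ false l → c l ≡ c₂ l
    on₂ {l} (d′ , h′ , x′ , e′) with occ? l
    ... | no _ = refl
    ... | yes (d , h , x , e) = subst (λ l → c₁ l ≡ c₂ l) e (agree h h′ x x′ (trans e (sym e′)))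

    module Half {Y : Fin N → Bool} (Y-r : ∀ {d} → al d ≡ true → Y (r d) ≡ Y d) {S : Map} (side : SideMap M Y S) {c′ : Fin K → Bool}
      (on : ∀ {l} → ∃[ e ] (al e ≡ true × Y e ≡ false × lab e ≡ l) → c l ≡ c′ l) where
      open SideMap side

      at : ∀ {d} → al d ≡ true → Y d ≡ false → c (lab d) ≡ c′ (Map.lab S d)
      at h y = trans (on (_ , h , y , refl)) (cong c′ (sym (same h y)))

      mixed : Proper S c′ → ∀ {d} → al d ≡ true → Y d ≡ false → MixedAt M c d
      mixed p {d} h y (e , e′) = p (kept h y)
        (trans (sym (at h y)) (trans e (at (al-rr h) yr)) , trans (sym (at (al-rr h) yr)) (trans e′ (at (al-rr (al-rr h)) (trans (Y-r (al-rr h)) yr))))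
        where
        yr : Y (r d) ≡ false
        yr = trans (Y-r h) y

      linked : ∀ {k} → TrueEdges M c k → TrueEdges S c′ k
      linked {k} te {d} h e e′ with edges h
      ... | d′ , h′ , l , l′ = trans (cong k (sym l)) (trans (te h′ (lift {d} h l e) (lift {r d} (trans (Map.al-r S d) h) l′ e′)) (cong k l′))
        where
        lift : ∀ {d m} → Map.al S d ≡ true → lab m ≡ Map.lab S d → c′ (Map.lab S d) ≡ true → c (lab m) ≡ true
        lift {d} h l e = trans (cong c l) (trans (on (occurs h)) e)

      rep : ∀ τ {f} → al (dart τ) ≡ true → Y (dart τ) ≡ false → Rep S c′ τ f → Rep M c τ f
      rep (edge d) h y (refl , e) = same (al-rr h) (trans (Y-r h) y) , trans (on (occurs (trans (Map.al-r S d) (kept h y)))) e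
      rep (corner d) h y (e , inj₁ (refl , e′)) = trans (on (occurs (trans (Map.al-r S d) (kept h y)))) e ,
        inj₁ (same (al-rr h) (trans (Y-r h) y) , trans (at (al-rr (al-rr h)) (trans (Y-r (al-rr h)) (trans (Y-r h) y))) e′)
      rep (corner d) h y (e , inj₂ (refl , e′)) = trans (on (occurs (trans (Map.al-r S (r d)) (trans (Map.al-r S d) (kept h y))))) e ,
        inj₂ (same (al-rr (al-rr h)) (trans (Y-r (al-rr h)) (trans (Y-r h) y)) , trans (at (al-rr h) (trans (Y-r h) y)) e′)

    module H₁ = Half {λ d → not (X d)} (λ h → cong not (X-r h)) side₁ {c₁} (λ (e , h , y , l) → on₁ (e , h , not-true y , l))
    module H₂ = Half {X} X-r side₂ {c₂} on₂

    proper : Proper M c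
    proper {d} h with X d in x
    ... | true  = H₁.mixed proper₁ h (cong not x)
    ... | false = H₂.mixed proper₂ h x

  -- Otherwise X would be constant on the φ-orbit of the face.
  shared-face : (M : Map) (X : Fin N → Bool) → let open Map M in (∀ {d} → al d ≡ true → X (r d) ≡ X d) →
    ∀ {d d′} → al d ≡ true → al d′ ≡ true → X d ≡ true → X d′ ≡ false → lab d ≡ lab d′ →
    ∃[ e ] (al e ≡ true × lab e ≡ lab d × X e ≢ X (mate e))
  shared-face M X X-r {d} {d′} h h′ x x′ l
    with any? (λ e → (Map.al M e 𝔹.≟ true) ×-dec (Map.lab M e ≟ Map.lab M d) ×-dec ¬? (X e 𝔹.≟ X (Map.mate M e)))
  ... | yes found = found
  ... | no none = ⊥-elim (true≢false x (trans (face-orbit (lab d) X inv h h′ refl (sym l)) x′))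
    where
    open Laws M using (al; mate; lab; al-mate; φ; face-orbit)
    inv : ∀ {e} → al e ≡ true → lab e ≡ lab d → X (φ e) ≡ X e
    inv {e} h le with X e 𝔹.≟ X (mate e)
    ... | yes q = trans (X-r (al-mate h)) (sym q)
    ... | no ¬q = ⊥-elim (none (e , h , le , ¬q))

  ∂-member : (M : Map) → let open Laws M in ∀ es {d} → ∂ es d ≡ true → Any (λ e → e ≡ d ⊎ mate e ≡ d) es
  ∂-member M (e ∷ es) {d} h = by (e ≟ d) (mate e ≟ d)
    where
    open Laws M using (mate; ∂)
    by : Dec (e ≡ d) → Dec (mate e ≡ d) → Any (λ e → e ≡ d ⊎ mate e ≡ d) (e ∷ es)
    by (yes q) _ = here (inj₁ q)
    by _ (yes q) = here (inj₂ q)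
    by (no ¬q) (no ¬p) = there (∂-member M es (trans (cong₂ (λ a b → (a xor b) xor ∂ es d) (sym (does-false ¬q)) (sym (does-false ¬p))) h))

  xor-≢ : ∀ {a b} → a ≢ b → a xor b ≡ true
  xor-≢ {true}  {true}  h = ⊥-elim (h refl)
  xor-≢ {true}  {false} h = refl
  xor-≢ {false} {true}  h = refl
  xor-≢ {false} {false} h = ⊥-elim (h refl)

  record Oriented (M : Map) (e : Fin N) (es : List (Fin N)) : Set where
    open Map M
    field
      X     : Fin N → Bool
      X-r   : ∀ {d} → al d ≡ true → X (r d) ≡ X d
      X-e   : X e ≡ true
      X-me  : X (mate e) ≡ false
      cross : ∀ {d} → al d ≡ true → X d ≢ X (mate d) → Any (λ e → e ≡ d ⊎ mate e ≡ d) (e ∷ es)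

  -- Odd parity at `e` says that `e` crosses the cut; passing to the complement, if necessary, puts
  -- `e` on the true side.
  orient : (M : Map) → let open Laws M in ∀ {e es} → al e ≡ true → Cut (e ∷ es) → ∂ (e ∷ es) e ≡ true → Oriented M e es
  orient M {e} {es} h (X , X-r , X-∂) odd = by (X e) (X (mate e)) refl refl
    where
    open Laws M using (al; mate; ∂; Cut)
    by : ∀ a b → X e ≡ a → X (mate e) ≡ b → Oriented M e es
    by true  false p q = record { X = X ; X-r = X-r ; X-e = p ; X-me = q ; cross = λ h ne → ∂-member M (e ∷ es) (trans (sym (X-∂ h)) (xor-≢ ne)) }
    by false true  p q = record { X = λ d → not (X d) ; X-r = λ h → cong not (X-r h) ; X-e = cong not p ; X-me = cong not q
                                ; cross = λ h ne → ∂-member M (e ∷ es) (trans (sym (X-∂ h)) (xor-≢ (λ q → ne (cong not q)))) }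
    by true  true  p q = ⊥-elim (true≢false odd (trans (sym (X-∂ h)) (cong₂ _xor_ p q)))
    by false false p q = ⊥-elim (true≢false odd (trans (sym (X-∂ h)) (cong₂ _xor_ p q)))

  -- Two edges between the same pair of faces

  record Double (M : Map) (X : Fin N → Bool) (d d′ : Fin N) : Set where
    open Map M
    field
      X-r : ∀ {d} → al d ≡ true → X (r d) ≡ X d
      h   : al d ≡ true
      h′  : al d′ ≡ true
      l   : lab d ≡ lab d′
      l′  : lab (r d) ≡ lab (r d′)
      x   : X d ≡ true
      xm  : X (mate d) ≡ false
      x′  : X d′ ≡ false
      xm′ : X (mate d′) ≡ true
      cross : ∀ {e} → al e ≡ true → X e ≢ X (mate e) → (d ≡ e ⊎ mate d ≡ e) ⊎ (d′ ≡ e ⊎ mate d′ ≡ e)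

  double-flip : ∀ {M X d d′} → Double M X d d′ → Double M (λ d → not (X d)) d′ d
  double-flip D = record { X-r = λ h → cong not (X-r h) ; h = h′ ; h′ = h ; l = sym l ; l′ = sym l′ ; x = cong not x′ ; xm = cong not xm′ ; x′ = cong not x ; xm′ = cong not xm
                         ; cross = λ h ne → swap (cross h (λ q → ne (cong not q))) }
    where
    open Double D
    swap : ∀ {A B : Set} → A ⊎ B → B ⊎ A
    swap (inj₁ a) = inj₂ a
    swap (inj₂ b) = inj₁ b

  -- A set of faces has both edges or neither on its boundary, so by `separation` they form a cut.
  -- Along the common face the cut is crossed at `d`, and the only place left for crossing back is
  -- `d′`.
  double : (M : Map) → let open Map M in ∀ {d d′} → al d ≡ true → al d′ ≡ true → d ≢ d′ → lab d ≡ lab d′ → lab (r d) ≡ lab (r d′) →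
    Σ (Fin N → Bool) λ X → Double M X d d′
  double M {d} {d′} h h′ d≢d′ l l′ = X , record { X-r = X-r ; h = h ; h′ = h′ ; l = l ; l′ = l′ ; x = X-e ; xm = X-me ; x′ = proj₁ back ; xm′ = proj₂ back ; cross = λ h ne → split (cross h ne) }
    where
    open Laws M using (al; mate; lab; loopless; lab-mate′; crosses-back; ∂; total; separation)
    even : ∀ (c : Fin K → Bool) → total (λ d → c (lab d) xor c (lab (r d))) (d ∷ d′ ∷ []) ≡ false
    even c = trans (cong₂ (λ a b → (c (lab d) xor c (lab (r d))) xor ((c a xor c b) xor false)) (sym l) (sym l′)) (ar (c (lab d) xor c (lab (r d))))
      where
      ar : ∀ a → a xor (a xor false) ≡ false
      ar true  = refl
      ar false = refl
    odd : ∂ (d ∷ d′ ∷ []) d ≡ true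
    odd = trans (cong₂ (λ a b → (a xor b) xor (([ d′ ]≟ d xor [ mate d′ ]≟ d) xor false)) (does-refl d) (does-false (λ e → loopless h (trans (cong lab (sym e)) (lab-mate′ h)))))
      (cong₂ (λ a b → true xor ((a xor b) xor false)) (does-false (λ e → d≢d′ (sym e))) (does-false (λ e → loopless h (trans (cong lab (sym e)) (trans (lab-mate′ h′) (sym l′))))))
    O : Oriented M d (d′ ∷ [])
    O = orient M h (separation (d ∷ d′ ∷ []) even (h ∷ h′ ∷ [])) odd
    open Oriented O
    split : ∀ {e} → Any (λ a → a ≡ e ⊎ mate a ≡ e) (d ∷ d′ ∷ []) → (d ≡ e ⊎ mate d ≡ e) ⊎ (d′ ≡ e ⊎ mate d′ ≡ e)
    split (here p) = inj₁ p
    split (there (here p)) = inj₂ p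
    back : X d′ ≡ false × X (mate d′) ≡ true
    back with crosses-back X X-r h X-e X-me
    ... | e , he , le , xe , ye with split (cross he (λ q → true≢false ye (trans (sym q) xe)))
    ... | inj₁ (inj₁ refl) = ⊥-elim (true≢false X-e xe)
    ... | inj₁ (inj₂ refl) = ⊥-elim (loopless h (trans (sym le) (lab-mate′ h)))
    ... | inj₂ (inj₁ refl) = xe , ye
    ... | inj₂ (inj₂ refl) = ⊥-elim (loopless h (trans (sym le) (trans (lab-mate′ h′) (sym l′))))

  module Double-cut (M : Map) {X : Fin N → Bool} {d d′ : Fin N} (D : Double M X d d′) where
    open Laws M using (mate; lab; al-mate; mate-mate; lab-mate; loopless; lab-mate′)
    open Double D

    private
      in-false : ∀ {e} → X e ≡ false → (d ≡ e ⊎ mate d ≡ e) ⊎ (d′ ≡ e ⊎ mate d′ ≡ e) → e ≡ mate d ⊎ e ≡ d′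
      in-false xe (inj₁ (inj₁ refl)) = ⊥-elim (true≢false x xe)
      in-false xe (inj₁ (inj₂ refl)) = inj₁ refl
      in-false xe (inj₂ (inj₁ refl)) = inj₂ refl
      in-false xe (inj₂ (inj₂ refl)) = ⊥-elim (true≢false xm′ xe)

    open Cut₂ M X X-r (al-mate h) h′ xm x′ (trans (cong X (mate-mate h)) x) xm′
      (λ e → loopless h (sym (trans (sym (lab-mate′ h)) (trans (cong lab e) (sym l)))))
      (trans (lab-mate′ h) l′) (trans (sym l) (sym (lab-mate h)))
      (λ he xe ye → in-false xe (cross he (λ q → true≢false ye (trans (sym q) xe)))) public

    cut-side : SideMap M X cut
    cut-side = record { kept = alive⁻ ; same = λ _ _ → refl ; edges = λ {d} h → d , alive h , refl , refl ; occurs = λ {d} h → d , alive h , side h , refl }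

  -- A colouring of one side only has to be extended to the other side; for terminals on different
  -- sides both sides are solved with the common edge as second terminal.
  module _ (M : Map) {X : Fin N → Bool} {d d′ : Fin N} (D : Double M X d d′)
    (IH : ∀ M′ → size M′ < size M → Solvable M′) where
    open Laws M using (al; mate; lab; al-mate; lab-mate; al-rr; lab-mate′)
    open Double D
    private
      module C₂ = Double-cut M D using (alive⁻; cut; smaller; cut-side)
      module C₁ = Double-cut M (double-flip D) using (alive⁻; cut; smaller; cut-side)
      solve₂ : Solvable C₂.cut
      solve₂ = IH C₂.cut C₂.smaller
      solve₁ : Solvable C₁.cut
      solve₁ = IH C₁.cut C₁.smaller
      shared-lab : ∀ {e e′} → al e ≡ true → al e′ ≡ true → X e ≡ true → X e′ ≡ false → lab e ≡ lab e′ → lab e ≡ lab d ⊎ lab e ≡ lab (r d)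
      shared-lab he he′ xe xe′ le with shared-face M X X-r he he′ xe xe′ le
      ... | a , ha , la , ne with cross ha ne
      ... | inj₁ (inj₁ refl) = inj₁ (sym la)
      ... | inj₁ (inj₂ refl) = inj₂ (trans (sym la) (lab-mate′ h))
      ... | inj₂ (inj₁ refl) = inj₁ (trans (sym la) (sym l))
      ... | inj₂ (inj₂ refl) = inj₂ (trans (sym la) (trans (lab-mate′ h′) (sym l′)))

    double-same : ∀ {z τ₁ τ₂} → On M z τ₁ → On M z τ₂ → X (dart τ₁) ≡ false → X (dart τ₂) ≡ false → Sol M z τ₁ τ₂
    double-same {z} {τ₁} {τ₂} (h₁ , e₁) (h₂ , e₂) x₁ x₂ = by (solve₂ {z} {τ₁} {τ₂} (C₂.alive⁻ h₁ x₁ , e₁) (C₂.alive⁻ h₂ x₂ , e₂))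
      where
      hd : Map.al C₁.cut d ≡ true
      hd = C₁.alive⁻ h (cong not x)
      -- For equal colours the third face at the vertex of `d` is made the odd one out, for
      -- different colours `lab d`.
      match : ∀ a b → Σ (Fin K → Bool) λ c → Proper C₁.cut c × c (lab d) ≡ a × c (lab (r d)) ≡ b
      match a b with a 𝔹.≟ b
      ... | yes refl = let c , p , _ , q , q′ = odd-one-out {C₁.cut} solve₁ {r (r d)} (C₁.alive⁻ (al-rr (al-rr h)) (cong not (trans (X-r (al-rr h)) (trans (X-r h) x)))) (not a)
                       in c , p , trans (cong (λ y → c (lab y)) (sym (r³ d))) (trans q (𝔹.not-involutive a)) , trans (cong (λ y → c (lab (r y))) (sym (r³ d))) (trans q′ (𝔹.not-involutive a))
      ... | no a≢b   = let c , p , q , q′ , _ = odd-one-out {C₁.cut} solve₁ {d} hd a in c , p , q , trans q′ (sym (𝔹.¬-not (λ e → a≢b (sym e))))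
      by : Sol C₂.cut z τ₁ τ₂ → Sol M z τ₁ τ₂
      by (sol c₂ p₂ cz f g rep₁ rep₂ lk) = glued (match (c₂ (lab d)) (c₂ (lab (r d))))
        where
        glued : (Σ (Fin K → Bool) λ c → Proper C₁.cut c × c (lab d) ≡ c₂ (lab d) × c (lab (r d)) ≡ c₂ (lab (r d))) → Sol M z τ₁ τ₂
        glued (c₁ , p₁ , q , q′) = sol c proper (trans (on₂ (_ , h₁ , x₁ , e₁)) cz) f g (H₂.rep τ₁ h₁ x₁ rep₁) (H₂.rep τ₂ h₂ x₂ rep₂) (λ k te → lk k (H₂.linked {k} te))
          where
          agree : ∀ {e e′} → al e ≡ true → al e′ ≡ true → X e ≡ true → X e′ ≡ false → lab e ≡ lab e′ → c₁ (lab e) ≡ c₂ (lab e)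
          agree he he′ xe xe′ le with shared-lab he he′ xe xe′ le
          ... | inj₁ p = subst (λ m → c₁ m ≡ c₂ m) (sym p) q
          ... | inj₂ p = subst (λ m → c₁ m ≡ c₂ m) (sym p) q′
          open Gluing M X X-r C₁.cut-side C₂.cut-side {c₁} {c₂} p₁ p₂ agree using (c; on₂; module H₂; proper)

    double-apart : ∀ {z τ₁ τ₂} → On M z τ₁ → On M z τ₂ → X (dart τ₁) ≡ true → X (dart τ₂) ≡ false → Sol M z τ₁ τ₂
    double-apart {z} {τ₁} {τ₂} (h₁ , e₁) (h₂ , e₂) x₁ x₂ = by (shared-lab h₁ h₂ x₁ x₂ (trans e₁ (sym e₂)))
      where
      via : ∀ a b → al a ≡ true → al b ≡ true → X a ≡ true → X b ≡ false → lab a ≡ z → lab b ≡ z → lab (r a) ≡ lab (r b) →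
        (∀ {m} → m ≡ lab d ⊎ m ≡ lab (r d) → m ≡ lab a ⊎ m ≡ lab (r a)) → Sol M z τ₁ τ₂
      via a b ha hb xa xb la lb lr incl = join (solve₁ {z} {τ₁} {edge a} (C₁.alive⁻ h₁ (cong not x₁) , e₁) (C₁.alive⁻ ha (cong not xa) , la))
                                            (solve₂ {z} {edge b} {τ₂} (C₂.alive⁻ hb xb , lb) (C₂.alive⁻ h₂ x₂ , e₂))
        where
        join : Sol C₁.cut z τ₁ (edge a) → Sol C₂.cut z (edge b) τ₂ → Sol M z τ₁ τ₂
        join (sol c₁ p₁ cz₁ f₁ g₁ rep₁ (refl , q₁) lk₁) (sol c₂ p₂ cz₂ f₂ g₂ (refl , q₂) rep₂ lk₂) =
            sol c proper (trans (on₂ (_ , h₂ , x₂ , e₂)) cz₂) f₁ g₂ (H₁.rep τ₁ h₁ (cong not x₁) rep₁) (H₂.rep τ₂ h₂ x₂ rep₂)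
              (λ k te → trans (lk₁ k (H₁.linked {k} te)) (trans (cong k lr) (lk₂ k (H₂.linked {k} te))))
          where
          agree : ∀ {e e′} → al e ≡ true → al e′ ≡ true → X e ≡ true → X e′ ≡ false → lab e ≡ lab e′ → c₁ (lab e) ≡ c₂ (lab e)
          agree he he′ xe xe′ le with incl (shared-lab he he′ xe xe′ le)
          ... | inj₁ p = trans (cong c₁ (trans p la)) (trans cz₁ (sym (trans (cong c₂ (trans p la)) cz₂)))
          ... | inj₂ p = trans (cong c₁ p) (trans q₁ (sym (trans (cong c₂ (trans p lr)) q₂)))
          open Gluing M X X-r C₁.cut-side C₂.cut-side {c₁} {c₂} p₁ p₂ agree using (c; on₂; module H₁; module H₂; proper)
      by : lab (dart τ₁) ≡ lab d ⊎ lab (dart τ₁) ≡ lab (r d) → Sol M z τ₁ τ₂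
      by (inj₁ p) = via d d′ h h′ x x′ (trans (sym p) e₁) (trans (sym l) (trans (sym p) e₁)) l′ (λ { (inj₁ q) → inj₁ q ; (inj₂ q) → inj₂ q })
      by (inj₂ p) = via (mate d′) (mate d) (al-mate h′) (al-mate h) xm′ xm (trans (lab-mate′ h′) (trans (sym l′) (trans (sym p) e₁))) (trans (lab-mate′ h) (trans (sym p) e₁))
                     (trans (lab-mate h′) (trans (sym l) (sym (lab-mate h)))) (λ { (inj₁ q) → inj₂ (trans q (trans l (sym (lab-mate h′)))) ; (inj₂ q) → inj₁ (trans q (trans l′ (sym (lab-mate′ h′)))) })

  double-solve : (M : Map) → let open Map M in ∀ {d d′} → al d ≡ true → al d′ ≡ true → d ≢ d′ → lab d ≡ lab d′ → lab (r d) ≡ lab (r d′) →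
    (∀ M′ → size M′ < size M → Solvable M′) → Solvable M
  double-solve M h h′ ne l l′ IH {z} {τ₁} {τ₂} o₁ o₂ = by (double M h h′ ne l l′)
    where
    by : (Σ (Fin N → Bool) λ X → Double M X _ _) → Sol M z τ₁ τ₂
    by (X , D) with X (dart τ₁) in x₁ | X (dart τ₂) in x₂
    ... | false | false = double-same M D IH {z} {τ₁} {τ₂} o₁ o₂ x₁ x₂
    ... | true  | true  = double-same M (double-flip D) IH {z} {τ₁} {τ₂} o₁ o₂ (cong not x₁) (cong not x₂)
    ... | true  | false = double-apart M D IH {z} {τ₁} {τ₂} o₁ o₂ x₁ x₂
    ... | false | true  = swap-sol M (double-apart M D IH {z} {τ₂} {τ₁} o₂ o₁ x₂ x₁)

  -- Three edges between three pairwise adjacent faces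

  record Triple (M : Map) (X : Fin N → Bool) (d₁ d₂ d₃ : Fin N) : Set where
    open Map M
    field
      X-r : ∀ {d} → al d ≡ true → X (r d) ≡ X d
      h₁  : al d₁ ≡ true
      h₂  : al d₂ ≡ true
      h₃  : al d₃ ≡ true
      X₁  : X d₁ ≡ true
      X₂  : X d₂ ≡ true
      X₃  : X d₃ ≡ true
      Y₁  : X (mate d₁) ≡ false
      Y₂  : X (mate d₂) ≡ false
      Y₃  : X (mate d₃) ≡ false
      l₁  : lab (r d₁) ≡ lab d₂
      l₂  : lab (r d₂) ≡ lab d₃
      l₃  : lab (r d₃) ≡ lab d₁
      cross : ∀ {e} → al e ≡ true → X e ≢ X (mate e) → (d₁ ≡ e ⊎ mate d₁ ≡ e) ⊎ (d₂ ≡ e ⊎ mate d₂ ≡ e) ⊎ (d₃ ≡ e ⊎ mate d₃ ≡ e)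
      nonfacial  : ¬ (d₂ ≡ r d₁ × d₃ ≡ r d₂)
      nonfacial′ : ¬ (mate d₁ ≡ r (mate d₂) × mate d₂ ≡ r (mate d₃))

  triple-rotate : ∀ {M X d₁ d₂ d₃} → Triple M X d₁ d₂ d₃ → Triple M X d₂ d₃ d₁
  triple-rotate {M} T = record
    { X-r = X-r ; h₁ = h₂ ; h₂ = h₃ ; h₃ = h₁ ; X₁ = X₂ ; X₂ = X₃ ; X₃ = X₁ ; Y₁ = Y₂ ; Y₂ = Y₃ ; Y₃ = Y₁ ; l₁ = l₂ ; l₂ = l₃ ; l₃ = l₁
    ; cross = λ h ne → rot (cross h ne)
    ; nonfacial = λ { (refl , refl) → nonfacial (sym (r³ _) , refl) }
    ; nonfacial′ = λ (p , q) → nonfacial′ (trans (sym (r³ _)) (cong r (trans (cong r (sym q)) (sym p))) , p)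
    }
    where
    open Triple T
    open Map M
    rot : ∀ {A B C : Set} → A ⊎ B ⊎ C → B ⊎ C ⊎ A
    rot (inj₁ a) = inj₂ (inj₂ a)
    rot (inj₂ (inj₁ b)) = inj₁ b
    rot (inj₂ (inj₂ c)) = inj₂ (inj₁ c)

  -- Seen from the other side the three faces follow each other in the opposite cyclic order, hence
  -- the exchange of the second and the third edge.
  triple-flip : ∀ {M X d₁ d₂ d₃} → Triple M X d₁ d₂ d₃ → Triple M (λ d → not (X d)) (Map.mate M d₁) (Map.mate M d₃) (Map.mate M d₂)
  triple-flip {M} {X} {d₁} {d₂} {d₃} T = record
    { X-r = λ h → cong not (X-r h) ; h₁ = al-mate h₁ ; h₂ = al-mate h₃ ; h₃ = al-mate h₂
    ; X₁ = cong not Y₁ ; X₂ = cong not Y₃ ; X₃ = cong not Y₂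
    ; Y₁ = cong not (mm h₁ X₁) ; Y₂ = cong not (mm h₃ X₃) ; Y₃ = cong not (mm h₂ X₂)
    ; l₁ = trans (lab-mate h₁) (trans (sym l₃) (sym (lab-mate′ h₃)))
    ; l₂ = trans (lab-mate h₃) (trans (sym l₂) (sym (lab-mate′ h₂)))
    ; l₃ = trans (lab-mate h₂) (trans (sym l₁) (sym (lab-mate′ h₁)))
    ; cross = λ h ne → perm h₁ h₂ h₃ (cross h (λ q → ne (cong not q)))
    ; nonfacial = λ (p , q) → nonfacial′ (trans (sym (r³ (mate d₁))) (cong r (sym (trans q (cong r p)))) , q)
    ; nonfacial′ = λ (p , q) → nonfacial (trans (sym (mate-mate h₂)) (trans (sym (r³ (mate (mate d₂)))) (cong r (trans (cong r (sym q)) (trans (sym p) (mate-mate h₁))))) ,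
                                          trans (sym (mate-mate h₃)) (trans q (cong r (mate-mate h₂))))
    }
    where
    open Triple T
    open Laws M using (al; mate; al-mate; mate-mate; lab-mate; lab-mate′)
    mm : ∀ {d} → al d ≡ true → X d ≡ true → X (mate (mate d)) ≡ true
    mm h x = trans (cong X (mate-mate h)) x
    sw : ∀ {d e} → al d ≡ true → d ≡ e ⊎ mate d ≡ e → mate d ≡ e ⊎ mate (mate d) ≡ e
    sw h (inj₁ p) = inj₂ (trans (mate-mate h) p)
    sw h (inj₂ p) = inj₁ p
    perm : ∀ {a b c e} → al a ≡ true → al b ≡ true → al c ≡ true → (a ≡ e ⊎ mate a ≡ e) ⊎ (b ≡ e ⊎ mate b ≡ e) ⊎ (c ≡ e ⊎ mate c ≡ e) →
      (mate a ≡ e ⊎ mate (mate a) ≡ e) ⊎ (mate c ≡ e ⊎ mate (mate c) ≡ e) ⊎ (mate b ≡ e ⊎ mate (mate b) ≡ e)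
    perm ha hb hc (inj₁ p) = inj₁ (sw ha p)
    perm ha hb hc (inj₂ (inj₁ p)) = inj₂ (inj₂ (sw hb p))
    perm ha hb hc (inj₂ (inj₂ p)) = inj₂ (inj₁ (sw hc p))

  -- The boundary of a set of faces meets a triangle of the dual evenly, so `separation` gives a
  -- cut. That all three edges cross it in the same direction follows by going around two of the
  -- faces: the crossing at `d₁` is undone at `d₃` along `lab d₁`, and the one at `d₃` is undone at
  -- `d₂` along `lab d₃`.
  triple : (M : Map) → let open Map M in ∀ {d₁ d₂ d₃} → al d₁ ≡ true → al d₂ ≡ true → al d₃ ≡ true →
    lab (r d₁) ≡ lab d₂ → lab (r d₂) ≡ lab d₃ → lab (r d₃) ≡ lab d₁ →
    ¬ (d₂ ≡ r d₁ × d₃ ≡ r d₂) → ¬ (mate d₁ ≡ r (mate d₂) × mate d₂ ≡ r (mate d₃)) →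
    Σ (Fin N → Bool) λ X → Triple M X d₁ d₂ d₃
  triple M {d₁} {d₂} {d₃} h₁ h₂ h₃ l₁ l₂ l₃ nf nf′ = X , record
    { X-r = X-r ; h₁ = h₁ ; h₂ = h₂ ; h₃ = h₃ ; X₁ = X-e ; X₂ = proj₁ back₂ ; X₃ = proj₁ back₃ ; Y₁ = X-me ; Y₂ = proj₂ back₂ ; Y₃ = proj₂ back₃
    ; l₁ = l₁ ; l₂ = l₂ ; l₃ = l₃ ; cross = λ h ne → split (cross h ne) ; nonfacial = nf ; nonfacial′ = nf′ }
    where
    open Laws M using (al; mate; lab; mate-mate; lab-mate; loopless; lab-mate′; crosses-back; ∂; total; separation)
    es : List (Fin N)
    es = d₁ ∷ d₂ ∷ d₃ ∷ []
    z≢x : lab d₁ ≢ lab d₂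
    z≢x e = loopless h₁ (trans e (sym l₁))
    x≢y : lab d₂ ≢ lab d₃
    x≢y e = loopless h₂ (trans e (sym l₂))
    y≢z : lab d₃ ≢ lab d₁
    y≢z e = loopless h₃ (trans e (sym l₃))
    even : ∀ (c : Fin K → Bool) → total (λ d → c (lab d) xor c (lab (r d))) es ≡ false
    even c = trans (cong₂ (λ a b → (c (lab d₁) xor c a) xor ((c (lab d₂) xor c b) xor ((c (lab d₃) xor c (lab (r d₃))) xor false))) l₁ l₂)
      (trans (cong (λ a → (c (lab d₁) xor c (lab d₂)) xor ((c (lab d₂) xor c (lab d₃)) xor ((c (lab d₃) xor c a) xor false))) l₃) (ar (c (lab d₁)) (c (lab d₂)) (c (lab d₃))))
      where
      ar : ∀ a b c → (a xor b) xor ((b xor c) xor ((c xor a) xor false)) ≡ false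
      ar true  true  true  = refl
      ar true  true  false = refl
      ar true  false true  = refl
      ar true  false false = refl
      ar false true  true  = refl
      ar false true  false = refl
      ar false false true  = refl
      ar false false false = refl
    odd : ∂ es d₁ ≡ true
    odd = trans (cong₂ (λ a b → (a xor b) xor ∂ (d₂ ∷ d₃ ∷ []) d₁) (does-refl d₁) (does-false (λ e → z≢x (trans (cong lab (sym e)) (trans (lab-mate′ h₁) l₁)))))
      (trans (cong₂ (λ a b → true xor ((a xor b) xor ∂ (d₃ ∷ []) d₁)) (does-false (λ e → z≢x (cong lab (sym e)))) (does-false (λ e → y≢z (trans (sym (trans (lab-mate′ h₂) l₂)) (cong lab e)))))
      (cong₂ (λ a b → true xor ((a xor b) xor false)) (does-false (λ e → y≢z (cong lab e))) (does-false (λ e → x≢y (trans (sym l₁) (trans (cong (λ x → lab (r x)) (sym e)) (lab-mate h₃)))))))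
    O : Oriented M d₁ (d₂ ∷ d₃ ∷ [])
    O = orient M h₁ (separation es even (h₁ ∷ h₂ ∷ h₃ ∷ [])) odd
    open Oriented O
    split : ∀ {e} → Any (λ a → a ≡ e ⊎ mate a ≡ e) es → (d₁ ≡ e ⊎ mate d₁ ≡ e) ⊎ (d₂ ≡ e ⊎ mate d₂ ≡ e) ⊎ (d₃ ≡ e ⊎ mate d₃ ≡ e)
    split (here p) = inj₁ p
    split (there (here p)) = inj₂ (inj₁ p)
    split (there (there (here p))) = inj₂ (inj₂ p)
    back₃ : X d₃ ≡ true × X (mate d₃) ≡ false
    back₃ = by (crosses-back X X-r h₁ X-e X-me)
      where
      by : ∃[ e ] (al e ≡ true × lab e ≡ lab d₁ × X e ≡ false × X (mate e) ≡ true) → X d₃ ≡ true × X (mate d₃) ≡ false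
      by (e , he , le , xe , ye) = go (split (cross he (λ q → true≢false ye (trans (sym q) xe))))
        where
        go : (d₁ ≡ e ⊎ mate d₁ ≡ e) ⊎ (d₂ ≡ e ⊎ mate d₂ ≡ e) ⊎ (d₃ ≡ e ⊎ mate d₃ ≡ e) → X d₃ ≡ true × X (mate d₃) ≡ false
        go (inj₁ (inj₁ refl)) = ⊥-elim (true≢false X-e xe)
        go (inj₁ (inj₂ refl)) = ⊥-elim (loopless h₁ (trans (sym le) (lab-mate′ h₁)))
        go (inj₂ (inj₁ (inj₁ refl))) = ⊥-elim (z≢x (sym le))
        go (inj₂ (inj₁ (inj₂ refl))) = ⊥-elim (y≢z (trans (sym (trans (lab-mate′ h₂) l₂)) le))
        go (inj₂ (inj₂ (inj₁ refl))) = ⊥-elim (y≢z le)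
        go (inj₂ (inj₂ (inj₂ refl))) = trans (cong X (sym (mate-mate h₃))) ye , xe
    back₂ : X d₂ ≡ true × X (mate d₂) ≡ false
    back₂ = by (crosses-back X X-r h₃ (proj₁ back₃) (proj₂ back₃))
      where
      by : ∃[ e ] (al e ≡ true × lab e ≡ lab d₃ × X e ≡ false × X (mate e) ≡ true) → X d₂ ≡ true × X (mate d₂) ≡ false
      by (e , he , le , xe , ye) = go (split (cross he (λ q → true≢false ye (trans (sym q) xe))))
        where
        go : (d₁ ≡ e ⊎ mate d₁ ≡ e) ⊎ (d₂ ≡ e ⊎ mate d₂ ≡ e) ⊎ (d₃ ≡ e ⊎ mate d₃ ≡ e) → X d₂ ≡ true × X (mate d₂) ≡ false
        go (inj₁ (inj₁ refl)) = ⊥-elim (true≢false X-e xe)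
        go (inj₁ (inj₂ refl)) = ⊥-elim (x≢y (trans (sym (trans (lab-mate′ h₁) l₁)) le))
        go (inj₂ (inj₁ (inj₁ refl))) = ⊥-elim (x≢y le)
        go (inj₂ (inj₁ (inj₂ refl))) = trans (cong X (sym (mate-mate h₂))) ye , xe
        go (inj₂ (inj₂ (inj₁ refl))) = ⊥-elim (true≢false (proj₁ back₃) xe)
        go (inj₂ (inj₂ (inj₂ refl))) = ⊥-elim (loopless h₃ (trans (sym le) (lab-mate′ h₃)))

  module Triple-cut (M : Map) {X : Fin N → Bool} {d₁ d₂ d₃ : Fin N} (T : Triple M X d₁ d₂ d₃) where
    open Laws M using (al; mate; lab; al-mate; lab-mate; al-φ)
    open Triple T

    private
      in-false : ∀ {e} → X e ≡ false → (d₁ ≡ e ⊎ mate d₁ ≡ e) ⊎ (d₂ ≡ e ⊎ mate d₂ ≡ e) ⊎ (d₃ ≡ e ⊎ mate d₃ ≡ e) → e ≡ mate d₁ ⊎ e ≡ mate d₂ ⊎ e ≡ mate d₃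
      in-false xe (inj₁ (inj₁ refl)) = ⊥-elim (true≢false X₁ xe)
      in-false xe (inj₁ (inj₂ refl)) = inj₁ refl
      in-false xe (inj₂ (inj₁ (inj₁ refl))) = ⊥-elim (true≢false X₂ xe)
      in-false xe (inj₂ (inj₁ (inj₂ refl))) = inj₂ (inj₁ refl)
      in-false xe (inj₂ (inj₂ (inj₁ refl))) = ⊥-elim (true≢false X₃ xe)
      in-false xe (inj₂ (inj₂ (inj₂ refl))) = inj₂ (inj₂ refl)

    open Cut₃ M X X-r h₁ h₂ h₃ X₁ X₂ X₃ Y₁ Y₂ Y₃ l₁ l₂ l₃
      (λ he xe ye → in-false xe (cross he (λ q → true≢false ye (trans (sym q) xe)))) public

    cut-side : SideMap M X cut
    cut-side = record { kept = alive⁻-in ; same = λ _ x → lab-in x ; edges = edges ; occurs = occurs }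
      where
      occurs : ∀ {d} → al⁻ d ≡ true → ∃[ e ] (al e ≡ true × X e ≡ false × lab e ≡ lab⁻ d)
      occurs {d} q with kept q
      ... | inj₁ (h , x) = d , h , x , sym (lab-in x)
      ... | inj₂ (inj₁ refl) = r (mate d₁) , al-φ h₁ , X-in (al-mate h₁) Y₁ , trans (lab-mate h₁) (sym lab-1)
      ... | inj₂ (inj₂ (inj₁ refl)) = r (mate d₂) , al-φ h₂ , X-in (al-mate h₂) Y₂ , trans (lab-mate h₂) (sym lab-2)
      ... | inj₂ (inj₂ (inj₂ refl)) = r (mate d₃) , al-φ h₃ , X-in (al-mate h₃) Y₃ , trans (lab-mate h₃) (sym lab-3)

  -- A colouring of one side serving the terminal τ, with the colours of the three faces at the vertex
  -- of w prescribed and the true ones among them linked to τ.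
  record Half (S : Map) (w : Fin N) (τ : Terminal) (a b : Bool) : Set where
    open Map S
    field
      c      : Fin K → Bool
      proper : Proper S c
      c-w    : c (lab w) ≡ false
      c-rw   : c (lab (r w)) ≡ a
      c-rrw  : c (lab (r (r w))) ≡ b
      f      : Fin K
      rep    : Rep S c τ f
      to-rw  : a ≡ true → Linked S c f (lab (r w))
      to-rrw : b ≡ true → Linked S c f (lab (r (r w)))

  TwoOfThree : (Bool → Bool → Set) → Set
  TwoOfThree P = P true true × P true false ⊎ P true true × P false true ⊎ P true false × P false true

  -- The terminal `edge w` rules out the pattern false/true, `edge (ν w)` rules out true/false and
  -- `corner w` rules out true/true. Each of the three solutions realises one of the two remaining
  -- patterns, so together they realise at least two. In the pattern true/true the two faces are
  -- adjacent, so a link to one is a link to both.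
  halves : ∀ {S} → Solvable S → ∀ {w τ} → Map.al S w ≡ true → On S (Map.lab S w) τ → TwoOfThree (Half S w τ)
  halves {S} solve {w} {τ} h o = combine (via-rw (solve {lab w} {τ} {edge w} o (h , refl))) (via-rrw (solve {lab w} {τ} {edge (ν w)} o (al-ν h , lab-ν h))) (via-corner (solve {lab w} {τ} {corner w} o (h , refl)))
    where
    open Laws S using (lab; al-rr; ν; al-ν; lab-ν; lab-r-ν)
    side : ∀ {c k} → TrueEdges S c k → c (lab (r w)) ≡ true → c (lab (r (r w))) ≡ true → k (lab (r w)) ≡ k (lab (r (r w)))
    side te p q = te (al-rr h) p q
    via-rw : Sol S (lab w) τ (edge w) → Half S w τ true true ⊎ Half S w τ true false
    via-rw (sol c p cz f g rep (refl , q) lk) with c (lab (r (r w))) in e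
    ... | true  = inj₁ (record { c = c ; proper = p ; c-w = cz ; c-rw = q ; c-rrw = e ; f = f ; rep = rep ; to-rw = λ _ → lk ; to-rrw = λ _ k te → trans (lk k te) (side {c} {k} te q e) })
    ... | false = inj₂ (record { c = c ; proper = p ; c-w = cz ; c-rw = q ; c-rrw = e ; f = f ; rep = rep ; to-rw = λ _ → lk ; to-rrw = λ () })
    via-rrw : Sol S (lab w) τ (edge (ν w)) → Half S w τ true true ⊎ Half S w τ false true
    via-rrw (sol c p cz f g rep (refl , q) lk) = by (c (lab (r w))) refl
      where
      q′ : c (lab (r (r w))) ≡ true
      q′ = trans (cong c (sym (lab-r-ν h))) q
      lk′ : Linked S c f (lab (r (r w)))
      lk′ k te = trans (lk k te) (cong k (lab-r-ν h))
      by : ∀ a → c (lab (r w)) ≡ a → Half S w τ true true ⊎ Half S w τ false true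
      by true  e = inj₁ (record { c = c ; proper = p ; c-w = cz ; c-rw = e ; c-rrw = q′ ; f = f ; rep = rep ; to-rw = λ _ k te → trans (lk′ k te) (sym (side {c} {k} te e q′)) ; to-rrw = λ _ → lk′ })
      by false e = inj₂ (record { c = c ; proper = p ; c-w = cz ; c-rw = e ; c-rrw = q′ ; f = f ; rep = rep ; to-rw = λ () ; to-rrw = λ _ → lk′ })
    via-corner : Sol S (lab w) τ (corner w) → Half S w τ true false ⊎ Half S w τ false true
    via-corner (sol c p cz f g rep (q , inj₁ (refl , e)) lk) = inj₁ (record { c = c ; proper = p ; c-w = cz ; c-rw = q ; c-rrw = e ; f = f ; rep = rep ; to-rw = λ _ → lk ; to-rrw = λ () })
    via-corner (sol c p cz f g rep (q , inj₂ (refl , e)) lk) = inj₂ (record { c = c ; proper = p ; c-w = cz ; c-rw = e ; c-rrw = q ; f = f ; rep = rep ; to-rw = λ () ; to-rrw = λ _ → lk })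
    combine : ∀ {A B C : Set} → A ⊎ B → A ⊎ C → B ⊎ C → A × B ⊎ A × C ⊎ B × C
    combine (inj₁ a) (inj₁ _) (inj₁ b) = inj₁ (a , b)
    combine (inj₁ a) (inj₁ _) (inj₂ c) = inj₂ (inj₁ (a , c))
    combine (inj₁ a) (inj₂ c) _        = inj₂ (inj₁ (a , c))
    combine (inj₂ b) (inj₁ a) _        = inj₁ (a , b)
    combine (inj₂ b) (inj₂ c) _        = inj₂ (inj₂ (b , c))

  -- Two subsets with two elements each of a set with three elements meet. The arguments of `Q` are
  -- exchanged since the other side sees the two faces in reverse order; every pattern contains a
  -- true face, through which the halves can be linked.
  common : ∀ {P Q : Bool → Bool → Set} → TwoOfThree P → TwoOfThree Q → ∃[ a ] ∃[ b ] (P a b × Q b a × (a ≡ true ⊎ b ≡ true))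
  common (inj₁ (p , p′))        (inj₁ (q , q′))        = _ , _ , p , q , inj₁ refl
  common (inj₁ (p , p′))        (inj₂ (inj₁ (q , q′))) = _ , _ , p , q , inj₁ refl
  common (inj₁ (p , p′))        (inj₂ (inj₂ (q , q′))) = _ , _ , p′ , q′ , inj₁ refl
  common (inj₂ (inj₁ (p , p′))) (inj₁ (q , q′))        = _ , _ , p , q , inj₁ refl
  common (inj₂ (inj₁ (p , p′))) (inj₂ (inj₁ (q , q′))) = _ , _ , p , q , inj₁ refl
  common (inj₂ (inj₁ (p , p′))) (inj₂ (inj₂ (q , q′))) = _ , _ , p′ , q , inj₂ refl
  common (inj₂ (inj₂ (p , p′))) (inj₁ (q , q′))        = _ , _ , p′ , q′ , inj₂ refl
  common (inj₂ (inj₂ (p , p′))) (inj₂ (inj₁ (q , q′))) = _ , _ , p , q′ , inj₁ refl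
  common (inj₂ (inj₂ (p , p′))) (inj₂ (inj₂ (q , q′))) = _ , _ , p , q′ , inj₁ refl

  module _ (M : Map) {X : Fin N → Bool} {d₁ d₂ d₃ : Fin N} (T : Triple M X d₁ d₂ d₃)
    (IH : ∀ M′ → size M′ < size M → Solvable M′) where
    open Laws M using (al; mate; lab; lab-mate′)
    open Triple T
    private
      module C₂ = Triple-cut M T using (alive⁻; alive⁻-in; lab-in; lab-1; lab-2; lab-3; cut; smaller; cut-side)
      module C₁ = Triple-cut M (triple-flip {M} T) using (alive⁻; alive⁻-in; lab-in; lab-1; lab-2; lab-3; cut; smaller; cut-side)
      solve₂ : Solvable C₂.cut
      solve₂ = IH C₂.cut (C₂.smaller nonfacial)
      solve₁ : Solvable C₁.cut
      solve₁ = IH C₁.cut (C₁.smaller (Triple.nonfacial (triple-flip {M} T)))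

    triple-faces : ∀ {e e′} → al e ≡ true → al e′ ≡ true → X e ≡ true → X e′ ≡ false → lab e ≡ lab e′ → lab e ≡ lab d₁ ⊎ lab e ≡ lab d₂ ⊎ lab e ≡ lab d₃
    triple-faces he he′ xe xe′ le with shared-face M X X-r he he′ xe xe′ le
    ... | a , ha , la , ne with cross ha ne
    ... | inj₁ (inj₁ refl) = inj₁ (sym la)
    ... | inj₁ (inj₂ refl) = inj₂ (inj₁ (trans (sym la) (trans (lab-mate′ h₁) l₁)))
    ... | inj₂ (inj₁ (inj₁ refl)) = inj₂ (inj₁ (sym la))
    ... | inj₂ (inj₁ (inj₂ refl)) = inj₂ (inj₂ (trans (sym la) (trans (lab-mate′ h₂) l₂)))
    ... | inj₂ (inj₂ (inj₁ refl)) = inj₂ (inj₂ (sym la))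
    ... | inj₂ (inj₂ (inj₂ refl)) = inj₁ (trans (sym la) (trans (lab-mate′ h₃) l₃))

    private
      agreement : ∀ {c₁ c₂ : Fin K → Bool} → c₁ (lab d₁) ≡ c₂ (lab d₁) → c₁ (lab d₂) ≡ c₂ (lab d₂) → c₁ (lab d₃) ≡ c₂ (lab d₃) →
        ∀ {e e′} → al e ≡ true → al e′ ≡ true → X e ≡ true → X e′ ≡ false → lab e ≡ lab e′ → c₁ (lab e) ≡ c₂ (lab e)
      agreement {c₁} {c₂} q₁ q₂ q₃ he he′ xe xe′ le with triple-faces he he′ xe xe′ le
      ... | inj₁ p        = subst (λ m → c₁ m ≡ c₂ m) (sym p) q₁
      ... | inj₂ (inj₁ p) = subst (λ m → c₁ m ≡ c₂ m) (sym p) q₂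
      ... | inj₂ (inj₂ p) = subst (λ m → c₁ m ≡ c₂ m) (sym p) q₃

      -- The vertex kept for the other side is that of `mate d₁`; its corners at `v`, `r v`,
      -- `r (r v)` lie in the faces of `d₂`, `d₁`, `d₃`.
      v : Fin N
      v = mate d₁
      hv : Map.al C₁.cut v ≡ true
      hv = C₁.alive⁻ (inj₂ (inj₁ refl))
      hrv : Map.al C₁.cut (r v) ≡ true
      hrv = C₁.alive⁻ (inj₂ (inj₂ (inj₁ refl)))
      hrrv : Map.al C₁.cut (r (r v)) ≡ true
      hrrv = C₁.alive⁻ (inj₂ (inj₂ (inj₂ refl)))
      lv : Map.lab C₁.cut v ≡ lab d₂
      lv = trans C₁.lab-1 (trans (lab-mate′ h₁) l₁)
      lrv : Map.lab C₁.cut (r v) ≡ lab d₁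
      lrv = trans C₁.lab-2 (trans (lab-mate′ h₃) l₃)
      lrrv : Map.lab C₁.cut (r (r v)) ≡ lab d₃
      lrrv = trans C₁.lab-3 (trans (lab-mate′ h₂) l₂)
      hd₁ : Map.al C₂.cut d₁ ≡ true
      hd₁ = C₂.alive⁻ (inj₂ (inj₁ refl))

    triple-same : ∀ {z τ₁ τ₂} → On M z τ₁ → On M z τ₂ → X (dart τ₁) ≡ false → X (dart τ₂) ≡ false → Sol M z τ₁ τ₂
    triple-same {z} {τ₁} {τ₂} (g₁ , e₁) (g₂ , e₂) x₁ x₂ =
        by (solve₂ {z} {τ₁} {τ₂} (C₂.alive⁻-in g₁ x₁ , trans (C₂.lab-in x₁) e₁) (C₂.alive⁻-in g₂ x₂ , trans (C₂.lab-in x₂) e₂))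
      where
      Match : Bool → Bool → Bool → Set
      Match a b e = Σ (Fin K → Bool) λ c → Proper C₁.cut c × c (lab d₁) ≡ a × c (lab d₂) ≡ b × c (lab d₃) ≡ e
      odd-z : ∀ a → Match a (not a) (not a)
      odd-z a = let c , p , q , q′ , q″ = odd-one-out {C₁.cut} solve₁ {r v} hrv a
                in c , p , trans (cong c (sym lrv)) q , trans (cong c (trans (sym lv) (cong (Map.lab C₁.cut) (sym (r³ v))))) q″ , trans (cong c (sym lrrv)) q′
      odd-x : ∀ a → Match (not a) a (not a)
      odd-x a = let c , p , q , q′ , q″ = odd-one-out {C₁.cut} solve₁ {v} hv a
                in c , p , trans (cong c (sym lrv)) q′ , trans (cong c (sym lv)) q , trans (cong c (sym lrrv)) q″
      odd-y : ∀ a → Match (not a) (not a) a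
      odd-y a = let c , p , q , q′ , q″ = odd-one-out {C₁.cut} solve₁ {r (r v)} hrrv a
                in c , p , trans (cong c (trans (sym lrv) (cong (λ x → Map.lab C₁.cut (r x)) (sym (r³ v))))) q″ , trans (cong c (trans (sym lv) (cong (Map.lab C₁.cut) (sym (r³ v))))) q′ , trans (cong c (sym lrrv)) q
      -- In a non-constant pattern of three colours exactly one face is the odd one out.
      match : ∀ a b e → Mixed a b e → Match a b e
      match true  true  true  m = ⊥-elim (m (refl , refl))
      match true  true  false m = odd-y false
      match true  false true  m = odd-x false
      match true  false false m = odd-z true
      match false true  true  m = odd-z false
      match false true  false m = odd-x true
      match false false true  m = odd-y true
      match false false false m = ⊥-elim (m (refl , refl))
      by : Sol C₂.cut z τ₁ τ₂ → Sol M z τ₁ τ₂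
      by (sol c₂ p₂ cz f g rep₁ rep₂ lk) = glued (match (c₂ (lab d₁)) (c₂ (lab d₂)) (c₂ (lab d₃)) mixed₂)
        where
        mixed₂ : Mixed (c₂ (lab d₁)) (c₂ (lab d₂)) (c₂ (lab d₃))
        mixed₂ (p , q) = p₂ hd₁ (trans (cong c₂ C₂.lab-1) (trans p (cong c₂ (sym C₂.lab-2))) , trans (cong c₂ C₂.lab-2) (trans q (cong c₂ (sym C₂.lab-3))))
        glued : Match (c₂ (lab d₁)) (c₂ (lab d₂)) (c₂ (lab d₃)) → Sol M z τ₁ τ₂
        glued (c₁ , p₁ , q₁ , q₂ , q₃) = sol c proper (trans (on₂ (_ , g₁ , x₁ , e₁)) cz) f g (H₂.rep τ₁ g₁ x₁ rep₁) (H₂.rep τ₂ g₂ x₂ rep₂) (λ k te → lk k (H₂.linked {k} te))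
          where
          open Gluing M X X-r C₁.cut-side C₂.cut-side {c₁} {c₂} p₁ p₂ (agreement {c₁} {c₂} q₁ q₂ q₃) using (c; on₂; module H₂; proper)

    triple-apart : ∀ {τ₁ τ₂} → On M (lab d₁) τ₁ → On M (lab d₁) τ₂ → X (dart τ₁) ≡ true → X (dart τ₂) ≡ false → Sol M (lab d₁) τ₁ τ₂
    triple-apart {τ₁} {τ₂} (g₁ , e₁) (g₂ , e₂) x₁ x₂ = by (common
        (halves {C₂.cut} solve₂ {d₁} {τ₂} hd₁ (C₂.alive⁻-in g₂ x₂ , trans (C₂.lab-in x₂) (trans e₂ (sym C₂.lab-1))))
        (halves {C₁.cut} solve₁ {r v} {τ₁} hrv (C₁.alive⁻-in g₁ (cong not x₁) , trans (C₁.lab-in (cong not x₁)) (trans e₁ (sym lrv)))))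
      where
      by : ∃[ a ] ∃[ b ] (Half C₂.cut d₁ τ₂ a b × Half C₁.cut (r v) τ₁ b a × (a ≡ true ⊎ b ≡ true)) → Sol M (lab d₁) τ₁ τ₂
      by (a , b , A , B , ab) = sol c proper (trans (on₂ (_ , g₂ , x₂ , e₂)) (trans (cong A.c (sym C₂.lab-1)) A.c-w)) B.f A.f
          (H₁.rep τ₁ g₁ (cong not x₁) B.rep) (H₂.rep τ₂ g₂ x₂ A.rep) (λ k te → link ab k te)
        where
        module A = Half A
        module B = Half B
        lrrrv : Map.lab C₁.cut (r (r (r v))) ≡ lab d₂
        lrrrv = trans (cong (Map.lab C₁.cut) (r³ v)) lv
        open Gluing M X X-r C₁.cut-side C₂.cut-side {B.c} {A.c} B.proper A.proper (agreement {B.c} {A.c}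
          (trans (trans (cong B.c (sym lrv)) B.c-w) (sym (trans (cong A.c (sym C₂.lab-1)) A.c-w)))
          (trans (trans (cong B.c (sym lrrrv)) B.c-rrw) (sym (trans (cong A.c (sym C₂.lab-2)) A.c-rw)))
          (trans (trans (cong B.c (sym lrrv)) B.c-rw) (sym (trans (cong A.c (sym C₂.lab-3)) A.c-rrw)))) using (c; on₂; module H₁; module H₂; proper)
        link : a ≡ true ⊎ b ≡ true → ∀ k → TrueEdges M c k → k B.f ≡ k A.f
        link (inj₁ p) k te = trans (B.to-rrw p k (H₁.linked {k} te)) (trans (cong k (trans lrrrv (sym C₂.lab-2))) (sym (A.to-rw p k (H₂.linked {k} te))))
        link (inj₂ p) k te = trans (B.to-rw p k (H₁.linked {k} te)) (trans (cong k (trans lrrv (sym C₂.lab-3))) (sym (A.to-rrw p k (H₂.linked {k} te))))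

  triple-apart′ : (M : Map) {X : Fin N → Bool} {d₁ d₂ d₃ : Fin N} → Triple M X d₁ d₂ d₃ → (∀ M′ → size M′ < size M → Solvable M′) →
    ∀ {z τ₁ τ₂} → On M z τ₁ → On M z τ₂ → X (dart τ₁) ≡ true → X (dart τ₂) ≡ false → Sol M z τ₁ τ₂
  triple-apart′ M T IH {z} {τ₁} {τ₂} (g₁ , refl) (g₂ , e₂) x₁ x₂ with triple-faces M T IH g₁ g₂ x₁ x₂ (sym e₂)
  ... | inj₁ p        = subst (λ z → Sol M z τ₁ τ₂) (sym p) (triple-apart M T IH {τ₁} {τ₂} (g₁ , p) (g₂ , trans e₂ p) x₁ x₂)
  ... | inj₂ (inj₁ p) = subst (λ z → Sol M z τ₁ τ₂) (sym p) (triple-apart M (triple-rotate {M} T) IH {τ₁} {τ₂} (g₁ , p) (g₂ , trans e₂ p) x₁ x₂)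
  ... | inj₂ (inj₂ p) = subst (λ z → Sol M z τ₁ τ₂) (sym p) (triple-apart M (triple-rotate {M} (triple-rotate {M} T)) IH {τ₁} {τ₂} (g₁ , p) (g₂ , trans e₂ p) x₁ x₂)

  triple-solve : (M : Map) → let open Map M in ∀ {d₁ d₂ d₃} → al d₁ ≡ true → al d₂ ≡ true → al d₃ ≡ true →
    lab (r d₁) ≡ lab d₂ → lab (r d₂) ≡ lab d₃ → lab (r d₃) ≡ lab d₁ →
    ¬ (d₂ ≡ r d₁ × d₃ ≡ r d₂) → ¬ (mate d₁ ≡ r (mate d₂) × mate d₂ ≡ r (mate d₃)) →
    (∀ M′ → size M′ < size M → Solvable M′) → Solvable M
  triple-solve M {d₁} {d₂} {d₃} h₁ h₂ h₃ l₁ l₂ l₃ nf nf′ IH {z} {τ₁} {τ₂} o₁ o₂ = by (triple M h₁ h₂ h₃ l₁ l₂ l₃ nf nf′)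
    where
    by : (Σ (Fin N → Bool) λ X → Triple M X d₁ d₂ d₃) → Sol M z τ₁ τ₂
    by (X , T) with X (dart τ₁) in x₁ | X (dart τ₂) in x₂
    ... | false | false = triple-same M T IH {z} {τ₁} {τ₂} o₁ o₂ x₁ x₂
    ... | true  | true  = triple-same M (triple-flip {M} T) IH {z} {τ₁} {τ₂} o₁ o₂ (cong not x₁) (cong not x₂)
    ... | true  | false = triple-apart′ M T IH {z} {τ₁} {τ₂} o₁ o₂ x₁ x₂
    ... | false | true  = swap-sol M (triple-apart′ M T IH {z} {τ₂} {τ₁} o₂ o₁ x₂ x₁)

  -- Maps without cuts of two or three edges, except at single vertices

  Tight₂ : Map → Set
  Tight₂ M = let open Map M in ∀ {d d′} → al d ≡ true → al d′ ≡ true → lab d ≡ lab d′ → lab (r d) ≡ lab (r d′) → d ≡ d′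

  -- The alternatives are the two orientations in which the three edges can surround a vertex: by
  -- their own darts, or by their mates in reverse order.
  Tight₃ : Map → Set
  Tight₃ M = let open Map M in ∀ {d₁ d₂ d₃} → al d₁ ≡ true → al d₂ ≡ true → al d₃ ≡ true →
    lab (r d₁) ≡ lab d₂ → lab (r d₂) ≡ lab d₃ → lab (r d₃) ≡ lab d₁ →
    (d₂ ≡ r d₁ × d₃ ≡ r d₂) ⊎ (mate d₁ ≡ r (mate d₂) × mate d₂ ≡ r (mate d₃))

  Thick : Map → Set
  Thick M = let open Map M in ∀ {p} → al p ≡ true → lab (r (r p)) ≢ lab (r (r (mate p)))

  -- In the absence of parallel dual edges only the theta graph is not thick.
  module Theta (M : Map) (tight₂ : Tight₂ M) {p : Fin N} (hp : Map.al M p ≡ true) (thin : Map.lab M (r (r p)) ≡ Map.lab M (r (r (Map.mate M p)))) where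
    open Laws M using (al; mate; lab; al-mate; mate-mate; lab-mate; loopless; conn; al-rr; lab-mate′; loopless₂; φ)

    Θ : Fin N → Set
    Θ a = mate (r a) ≡ r (r (mate a)) × mate (r (r a)) ≡ r (mate a)

    Θ-p : Θ p
    Θ-p = tight₂ (al-mate (al-rr hp)) (al-rr (al-rr (al-mate hp))) (trans (lab-mate′ (al-rr hp)) thin)
            (trans (lab-mate (al-rr hp)) (trans (sym (lab-mate′ hp)) (cong lab (sym (r³ (mate p)))))) ,
          tight₂ (al-mate (al-rr (al-rr hp))) (al-rr (al-mate hp)) (trans (lab-mate′ (al-rr (al-rr hp))) (trans (cong lab (r³ p)) (sym (lab-mate hp))))
            (trans (lab-mate (al-rr (al-rr hp))) thin)

    Θ-r : ∀ {a} → Θ a → Θ (r a)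
    Θ-r {a} (e , e′) = trans e′ (trans (sym (r³ _)) (cong (λ x → r (r x)) (sym e))) , trans (cong mate (r³ a)) (trans (sym (r³ (mate a))) (cong r (sym e)))

    Θ-mate : ∀ {a} → al a ≡ true → Θ a → Θ (mate a)
    Θ-mate {a} h (e , e′) = trans (cong mate (sym e′)) (trans (mate-mate (al-rr (al-rr h))) (cong (λ x → r (r x)) (sym (mate-mate h)))) ,
                            trans (cong mate (sym e)) (trans (mate-mate (al-rr h)) (cong r (sym (mate-mate h))))

    cover : ∀ {a} → al a ≡ true → Θ a → ∀ {d} → al d ≡ true → At a d ⊎ At (mate a) d
    cover {a} ha (e , e′) {d} hd = from (trans (conn X X-r X-mate hd ha) (to (inj₁ (inj₁ refl))))
      where
      opaque
        in? : ∀ d → Dec (At a d ⊎ At (mate a) d)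
        in? d = at? a d ⊎-dec at? (mate a) d
      X : Fin N → Bool
      X d = does (in? d)
      to : ∀ {d} → At a d ⊎ At (mate a) d → X d ≡ true
      to {d} x with in? d
      ... | yes _ = refl
      ... | no ¬x = ⊥-elim (¬x x)
      from : ∀ {d} → X d ≡ true → At a d ⊎ At (mate a) d
      from {d} x with in? d
      ... | yes q = q
      same : ∀ {d d′} → (At a d ⊎ At (mate a) d → At a d′ ⊎ At (mate a) d′) → (At a d′ ⊎ At (mate a) d′ → At a d ⊎ At (mate a) d) → X d′ ≡ X d
      same {d} {d′} f g with in? d | in? d′
      ... | yes _ | yes _ = refl
      ... | no _  | no _  = refl
      ... | yes x | no ¬y = ⊥-elim (¬y (f x))
      ... | no ¬x | yes y = ⊥-elim (¬x (g y))
      X-r : ∀ {d} → al d ≡ true → X (r d) ≡ X d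
      X-r _ = same (λ { (inj₁ x) → inj₁ (at-r x) ; (inj₂ x) → inj₂ (at-r x) }) (λ { (inj₁ x) → inj₁ (at-r⁻ x) ; (inj₂ x) → inj₂ (at-r⁻ x) })
      across : ∀ {d} → At a d ⊎ At (mate a) d → At a (mate d) ⊎ At (mate a) (mate d)
      across (inj₁ (inj₁ refl))        = inj₂ (inj₁ refl)
      across (inj₁ (inj₂ (inj₁ refl))) = inj₂ (inj₂ (inj₂ e))
      across (inj₁ (inj₂ (inj₂ refl))) = inj₂ (inj₂ (inj₁ e′))
      across (inj₂ (inj₁ refl))        = inj₁ (inj₁ (mate-mate ha))
      across (inj₂ (inj₂ (inj₁ refl))) = inj₁ (inj₂ (inj₂ (trans (cong mate (sym e′)) (mate-mate (al-rr (al-rr ha))))))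
      across (inj₂ (inj₂ (inj₂ refl))) = inj₁ (inj₂ (inj₁ (trans (cong mate (sym e)) (mate-mate (al-rr ha)))))
      X-mate : ∀ {d} → al d ≡ true → X (mate d) ≡ X d
      X-mate h = same across (λ x → subst (λ y → At a y ⊎ At (mate a) y) (mate-mate h) (across x))

    Θ-all : ∀ {a} → al a ≡ true → Θ a
    Θ-all h with cover hp Θ-p h
    ... | inj₁ x = at-transport Θ Θ-r Θ-p x
    ... | inj₂ x = at-transport Θ Θ-r (Θ-mate hp Θ-p) x

    module _ {a : Fin N} (ha : al a ≡ true) where
      z f u : Fin K
      z = lab a
      f = lab (r a)
      u = lab (r (r a))

      z≢f : z ≢ f
      z≢f = loopless ha
      z≢u : z ≢ u
      z≢u = loopless₂ ha
      f≢u : f ≢ u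
      f≢u = loopless (al-rr ha)

      opp : lab (r (r (mate a))) ≡ u
      opp = trans (cong lab (sym (proj₁ (Θ-all ha)))) (lab-mate′ (al-rr ha))

      other : ∀ {b} → al b ≡ true → lab b ≡ z → b ≡ a ⊎ b ≡ φ a
      other hb e with cover ha (Θ-all ha) hb
      ... | inj₁ (inj₁ q) = inj₁ q
      ... | inj₁ (inj₂ (inj₁ refl)) = ⊥-elim (z≢f (sym e))
      ... | inj₁ (inj₂ (inj₂ refl)) = ⊥-elim (z≢u (sym e))
      ... | inj₂ (inj₁ refl) = ⊥-elim (z≢f (trans (sym e) (lab-mate′ ha)))
      ... | inj₂ (inj₂ (inj₁ q)) = inj₂ q
      ... | inj₂ (inj₂ (inj₂ refl)) = ⊥-elim (z≢u (trans (sym e) opp))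

      colour : Bool → Bool → Fin K → Bool
      colour α β l = if does (l ≟ f) then α else (if does (l ≟ u) then β else false)

      colour-f : ∀ α β → colour α β f ≡ α
      colour-f α β = cong (λ b → if b then α else (if does (f ≟ u) then β else false)) (does-refl f)

      colour-u : ∀ α β → colour α β u ≡ β
      colour-u α β = trans (cong (λ b → if b then α else (if does (u ≟ u) then β else false)) (does-false (λ e → f≢u (sym e)))) (cong (λ b → if b then β else false) (does-refl u))

      colour-z : ∀ α β → colour α β z ≡ false
      colour-z α β = trans (cong (λ b → if b then α else (if does (z ≟ u) then β else false)) (does-false z≢f)) (cong (λ b → if b then β else false) (does-false z≢u))

      colour-proper : ∀ α β → α ≡ true ⊎ β ≡ true → Proper M (colour α β)
      colour-proper α β αβ {d} h with cover ha (Θ-all ha) h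
      ... | inj₁ x = at-transport (MixedAt M (colour α β)) (mixedAt-r M {colour α β}) (at-a αβ) x
        where
        at-a : α ≡ true ⊎ β ≡ true → MixedAt M (colour α β) a
        at-a (inj₁ refl) = mixed₁₂ (colour-z α β) (colour-f α β)
        at-a (inj₂ refl) = mixed₁₃ (colour-z α β) (colour-u α β)
      ... | inj₂ x = at-transport (MixedAt M (colour α β)) (mixedAt-r M {colour α β}) (at-m αβ) x
        where
        at-m : α ≡ true ⊎ β ≡ true → MixedAt M (colour α β) (mate a)
        at-m (inj₁ refl) = mixed₂₁ (trans (cong (colour α β) (lab-mate′ ha)) (colour-f α β)) (trans (cong (colour α β) (lab-mate ha)) (colour-z α β))
        at-m (inj₂ refl) = mixed₂₃ (trans (cong (colour α β) (lab-mate ha)) (colour-z α β)) (trans (cong (colour α β) opp) (colour-u α β))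

      rr-φ : lab (r (r (φ a))) ≡ f
      rr-φ = trans (cong lab (r³ (mate a))) (lab-mate′ ha)

      theta-sol : ∀ α β → α ≡ true ⊎ β ≡ true → ∀ {τ₁ τ₂ f′ g′} → Rep M (colour α β) τ₁ f′ → Rep M (colour α β) τ₂ g′ → Linked M (colour α β) f′ g′ → Sol M z τ₁ τ₂
      theta-sol α β αβ = sol (colour α β) (colour-proper α β αβ) (colour-z α β) _ _

    -- Each face of the theta graph has two edges and two corners, so the colourings where `f`, `u`
    -- or both are true settle every pair of terminals.
    theta-solve : Solvable M
    theta-solve {z} {edge a} {edge b} (ha , refl) (hb , e) with other ha hb e
    ... | inj₁ refl = theta-sol ha true true (inj₁ refl) (refl , colour-f ha true true) (refl , colour-f ha true true) (λ _ _ → refl)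
    ... | inj₂ refl = theta-sol ha true true (inj₁ refl) (refl , colour-f ha true true) (refl , trans (cong (colour ha true true) (opp ha)) (colour-u ha true true))
                        (λ k te → trans (te (al-rr ha) (colour-f ha true true) (colour-u ha true true)) (cong k (sym (opp ha))))
    theta-solve {z} {edge a} {corner b} (ha , refl) (hb , e) with other ha hb e
    ... | inj₁ refl = theta-sol ha true false (inj₁ refl) (refl , colour-f ha true false) (colour-f ha true false , inj₁ (refl , colour-u ha true false)) (λ _ _ → refl)
    ... | inj₂ refl = theta-sol ha true false (inj₁ refl) (refl , colour-f ha true false) (colour-f ha true false , inj₂ (sym (rr-φ ha) , trans (cong (colour ha true false) (opp ha)) (colour-u ha true false))) (λ _ _ → refl)
    theta-solve {z} {corner a} {edge b} (ha , refl) (hb , e) with other ha hb e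
    ... | inj₁ refl = theta-sol ha true false (inj₁ refl) (colour-f ha true false , inj₁ (refl , colour-u ha true false)) (refl , colour-f ha true false) (λ _ _ → refl)
    ... | inj₂ refl = theta-sol ha false true (inj₂ refl) (colour-u ha false true , inj₂ (refl , colour-f ha false true)) (sym (opp ha) , colour-u ha false true) (λ _ _ → refl)
    theta-solve {z} {corner a} {corner b} (ha , refl) (hb , e) with other ha hb e
    ... | inj₁ refl = theta-sol ha true false (inj₁ refl) (colour-f ha true false , inj₁ (refl , colour-u ha true false)) (colour-f ha true false , inj₁ (refl , colour-u ha true false)) (λ _ _ → refl)
    ... | inj₂ refl = theta-sol ha true false (inj₁ refl) (colour-f ha true false , inj₁ (refl , colour-u ha true false)) (colour-f ha true false , inj₂ (sym (rr-φ ha) , trans (cong (colour ha true false) (opp ha)) (colour-u ha true false))) (λ _ _ → refl)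

  -- Tight maps with an edge terminal

  edge-solvable : ∀ {M} → Solvable M → EdgeSolvable M
  edge-solvable solve {z} {a} {b} = solve {z} {edge a} {edge b}

  contract-solve : (M : Map) {t : Fin N} (ht : Map.al M t ≡ true) →
    Map.lab M (r (r t)) ≢ Map.lab M (r (r (Map.mate M t))) →
    (∀ {d} → Map.al M d ≡ true → Map.lab M d ≡ Map.lab M t → Map.lab M (r d) ≡ Map.lab M (r t) → d ≡ t) →
    (∀ M′ → size M′ < size M → Solvable M′) → Bridged M t
  contract-solve M ht U≢W only IH = contract-bridged M ht U≢W only (edge-solvable {C.rewired} (IH C.rewired C.smaller))
    where
    module C = Contract M ht U≢W only using (rewired; smaller)

  module TightMap (M : Map) (tight₂ : Tight₂ M) (tight₃ : Tight₃ M) (thick : Thick M) (IH : ∀ M′ → size M′ < size M → Solvable M′) where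
    open Laws M using (al; mate; lab; al-mate; mate-mate; lab-mate; loopless; al-rr; lab-mate′; loopless₂; φ; ν; al-ν; lab-ν; lab-r-ν; φν; νφ; face-orbit)

    bridge : ∀ {p} → al p ≡ true → Bridged M p
    bridge h = contract-solve M h (thick h) (λ hd → tight₂ hd h) IH

    -- The case of a face a of length three, whose neighbours are the faces of a, ν a and δ.
    module Short {a δ : Fin N} (ha : al a ≡ true) (hδ : al δ ≡ true) (ν²a : ν (ν a) ≡ δ) (νδ : ν δ ≡ a) where
      z : Fin K
      z = lab a

      around : ∀ {b} → al b ≡ true → lab b ≡ z → b ≡ a ⊎ b ≡ ν a ⊎ b ≡ δ
      around {b} hb e = from (trans (face-orbit z k k-φ hb ha e refl) (to (inj₁ refl)))
        where
        opaque
          in? : ∀ b → Dec (b ≡ a ⊎ b ≡ ν a ⊎ b ≡ δ)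
          in? b = (b ≟ a) ⊎-dec ((b ≟ ν a) ⊎-dec (b ≟ δ))
        k : Fin N → Bool
        k b = does (in? b)
        to : ∀ {b} → b ≡ a ⊎ b ≡ ν a ⊎ b ≡ δ → k b ≡ true
        to {b} x with in? b
        ... | yes _ = refl
        ... | no ¬x = ⊥-elim (¬x x)
        from : ∀ {b} → k b ≡ true → b ≡ a ⊎ b ≡ ν a ⊎ b ≡ δ
        from {b} x with in? b
        ... | yes q = q
        back : ∀ {b} → b ≡ a ⊎ b ≡ ν a ⊎ b ≡ δ → φ b ≡ a ⊎ φ b ≡ ν a ⊎ φ b ≡ δ
        back (inj₁ refl)        = inj₂ (inj₂ (trans (cong φ (sym νδ)) (φν hδ)))
        back (inj₂ (inj₁ refl)) = inj₁ (φν ha)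
        back (inj₂ (inj₂ refl)) = inj₂ (inj₁ (trans (cong φ (sym ν²a)) (φν (al-ν ha))))
        forth : ∀ {b} → al b ≡ true → φ b ≡ a ⊎ φ b ≡ ν a ⊎ φ b ≡ δ → b ≡ a ⊎ b ≡ ν a ⊎ b ≡ δ
        forth h (inj₁ q)        = inj₂ (inj₁ (trans (sym (νφ h)) (cong ν q)))
        forth h (inj₂ (inj₁ q)) = inj₂ (inj₂ (trans (sym (νφ h)) (trans (cong ν q) ν²a)))
        forth h (inj₂ (inj₂ q)) = inj₁ (trans (sym (νφ h)) (trans (cong ν q) νδ))
        k-φ : ∀ {b} → al b ≡ true → lab b ≡ z → k (φ b) ≡ k b
        k-φ {b} h _ with in? b | in? (φ b)
        ... | yes _ | yes _ = refl
        ... | no _  | no _  = refl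
        ... | yes x | no ¬y = ⊥-elim (¬y (back x))
        ... | no ¬x | yes y = ⊥-elim (¬x (forth h y))

      lab-rrνa : lab (r (r (ν a))) ≡ lab (r δ)
      lab-rrνa = trans (sym (lab-r-ν (al-ν ha))) (cong (λ x → lab (r x)) ν²a)

      lab-rrδ : lab (r (r δ)) ≡ lab (r a)
      lab-rrδ = trans (sym (lab-r-ν hδ)) (cong (λ x → lab (r x)) νδ)

      opp-νa : lab (r (r (mate (ν a)))) ≡ lab (r a)
      opp-νa = trans (cong (λ x → lab (r (r x))) (mate-mate (al-rr (al-rr ha)))) (cong lab (r³ (r a)))

      opp-δ : lab (r (r (mate δ))) ≡ lab (r (ν a))
      opp-δ = trans (cong (λ x → lab (r (r (mate x)))) (sym ν²a)) (trans (cong (λ x → lab (r (r x))) (mate-mate (al-rr (al-rr (al-ν ha))))) (cong lab (r³ (r (ν a)))))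

      -- The faces at the ends of one edge of a triangle are those across its other two edges.
      -- Bridging `ν a` therefore links the edges `a` and `δ`, and bridging `δ` links `a` and `ν a`;
      -- the side of the bridged edge opposite `z` is false, which also suits the corners.
      short-solve : ∀ {τ₂} → On M z τ₂ → Sol M z (edge a) τ₂
      short-solve {edge b} (hb , e) with around hb e | bridge (al-ν ha) | bridge hδ
      ... | inj₁ refl | B | _ = let open Bridged B in sol c proper (trans (cong c (sym (lab-ν ha))) c-p) _ _ (refl , cf c c-opp) (refl , cf c c-opp) (λ _ _ → refl)
        where
        cf : ∀ c → c (lab (r (r (mate (ν a))))) ≡ true → c (lab (r a)) ≡ true
        cf c q = trans (cong c (sym opp-νa)) q
      ... | inj₂ (inj₁ refl) | _ | B = let open Bridged B in sol c proper (trans (cong c (trans (cong lab (sym νδ)) (lab-ν hδ))) c-p) _ _ (refl , trans (cong c (sym lab-rrδ)) c-rrp) (refl , trans (cong c (sym opp-δ)) c-opp)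
          (λ k te → trans (cong k (sym lab-rrδ)) (trans (linked k te) (cong k opp-δ)))
      ... | inj₂ (inj₂ refl) | B | _ = let open Bridged B in sol c proper (trans (cong c (sym (lab-ν ha))) c-p) _ _ (refl , trans (cong c (sym opp-νa)) c-opp) (refl , trans (cong c (sym lab-rrνa)) c-rrp)
          (λ k te → trans (cong k (sym opp-νa)) (trans (sym (linked k te)) (cong k lab-rrνa)))
      short-solve {corner b} (hb , e) with around hb e | bridge (al-ν ha) | bridge hδ
      ... | inj₁ refl | B | _ = let open Bridged B in sol c proper (trans (cong c (sym (lab-ν ha))) c-p) _ _ (refl , trans (cong c (sym opp-νa)) c-opp)
          (trans (cong c (sym opp-νa)) c-opp , inj₁ (refl , trans (cong c (sym (lab-r-ν ha))) c-rp)) (λ _ _ → refl)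
      ... | inj₂ (inj₁ refl) | B | _ = let open Bridged B in sol c proper (trans (cong c (sym (lab-ν ha))) c-p) _ _ (refl , trans (cong c (sym opp-νa)) c-opp)
          (c-rrp , inj₂ (refl , c-rp)) (λ k te → trans (cong k (sym opp-νa)) (sym (linked k te)))
      ... | inj₂ (inj₂ refl) | _ | B = let open Bridged B in sol c proper (trans (cong c (trans (cong lab (sym νδ)) (lab-ν hδ))) c-p) _ _ (refl , trans (cong c (sym lab-rrδ)) c-rrp)
          (trans (cong c (sym lab-rrδ)) c-rrp , inj₂ (sym lab-rrδ , c-rp)) (λ _ _ → refl)

    module EdgeSolve {a : Fin N} (ha : al a ≡ true) where
      t s : Fin N
      t = r a
      s = mate t
      ht : al t ≡ true
      ht = al-rr ha
      hs : al s ≡ true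
      hs = al-mate ht
      lab-rrt : lab (r (r t)) ≡ lab a
      lab-rrt = cong lab (r³ a)

      -- An edge `δ` between the faces at the two ends of `t` closes two triangles of the dual, one
      -- with each side of `t`. Both surround vertices by `tight₃`, and this makes `lab a` a face of
      -- length three.
      blocked : ∀ {δ} → al δ ≡ true → lab δ ≡ lab (r (r t)) → lab (r δ) ≡ lab (r (r s)) → ∀ {τ₂} → On M (lab a) τ₂ → Sol M (lab a) (edge a) τ₂
      blocked {δ} hδ e e′ = Short.short-solve ha hδ (ν²a (facial₂)) (νδ facial₁)
        where
        facial₁ : mate (r s) ≡ r δ × mate a ≡ r (mate (r s))
        facial₁ with tight₃ {δ} {mate (r s)} {mate a} hδ (al-mate (al-rr hs)) (al-mate ha) (trans e′ (sym (lab-mate′ (al-rr hs))))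
                       (trans (lab-mate (al-rr hs)) (trans (lab-mate ht) (sym (lab-mate′ ha)))) (trans (lab-mate ha) (trans (sym lab-rrt) (sym e)))
        ... | inj₁ q = q
        ... | inj₂ (_ , q) = ⊥-elim (loopless₂ ha (trans (cong lab (r-injective (trans (cong r (sym (mate-mate ha))) (trans (sym q) (mate-mate (al-rr hs)))))) (lab-mate′ ht)))
        facial₂ : mate δ ≡ r (mate (r (r s))) × mate (r (r s)) ≡ r (ν a)
        facial₂ with tight₃ {δ} {r (r s)} {r (r a)} hδ (al-rr (al-rr hs)) (al-rr ht) e′
                       (trans (cong lab (r³ s)) (lab-mate′ ht)) (trans lab-rrt (trans (sym lab-rrt) (sym e)))
        ... | inj₂ q = q
        ... | inj₁ (q , _) = ⊥-elim (loopless ha (trans (sym lab-rrt) (trans (sym e) (trans (cong lab (r-injective (sym q))) (lab-mate ht)))))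
        νδ : mate (r s) ≡ r δ × mate a ≡ r (mate (r s)) → ν δ ≡ a
        νδ (p , q) = trans (cong (λ x → mate (r x)) (sym p)) (trans (cong mate (sym q)) (mate-mate ha))
        ν²a : mate δ ≡ r (mate (r (r s))) × mate (r (r s)) ≡ r (ν a) → ν (ν a) ≡ δ
        ν²a (p , q) = trans (cong (λ x → mate (r x)) (sym q)) (trans (cong mate (sym p)) (mate-mate hδ))

      module Open (apart : ∀ {d} → al d ≡ true → lab d ≡ lab (r (r t)) → lab (r d) ≢ lab (r (r s))) where
        module P = Splice M ht (thick ht) apart using (Dead; stub-rs; al⁻; alive⁻; stub-alive⁻; rewired; smaller; lift-proper; module Lift; μW; μU)
        -- The stub `r (r t)` is `a` itself, and the splice joins its edge to that of `r s`. On the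
        -- face `z` the new edge has the dart `w`, with `lab (r a)` still across.
        w : Fin N
        w = mate (r s)
        z : Fin K
        z = lab (r (r t))
        on-w : On P.rewired z (edge w)
        on-w = P.stub-alive⁻ P.stub-rs , P.μW (lab-mate′ (al-rr hs))
        lab-rw : lab (r w) ≡ lab t
        lab-rw = trans (lab-mate (al-rr hs)) (lab-mate ht)
        survives : ∀ {b} → al b ≡ true → lab b ≡ z → b ≢ a → P.al⁻ b ≡ true
        survives {b} hb e ne = P.alive⁻ hb by
          where
          by : ¬ P.Dead b
          by (inj₁ (inj₁ refl)) = loopless ha (trans (sym lab-rrt) (sym e))
          by (inj₁ (inj₂ (inj₁ refl))) = loopless₂ ha (trans (sym lab-rrt) (sym e))
          by (inj₁ (inj₂ (inj₂ refl))) = ne (r³ a)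
          by (inj₂ (inj₁ refl)) = loopless₂ ha (trans (sym lab-rrt) (trans (sym e) (lab-mate′ ht)))
          by (inj₂ (inj₂ (inj₁ refl))) = loopless ha (trans (sym lab-rrt) (trans (sym e) (lab-mate ht)))
          by (inj₂ (inj₂ (inj₂ refl))) = thick ht (sym e)
        lift : ∀ {τ τ₂} → (∀ {c f} → c z ≡ false → Rep P.rewired c τ f → Rep M (λ l → c (merge (lab (r (r s))) z l)) τ₂ f) → Sol P.rewired z (edge w) τ → Sol M z (edge a) τ₂
        lift conv (sol c p cz f g (refl , q) rep lk) = sol (λ l → c (merge (lab (r (r s))) z l))
            -- The edge terminal forces `lab t` to be true, and the faces at both ends of `t` have
            -- become the false face `z`; so neither removed vertex sees only one colour.
            (P.lift-proper {c} p (mixed₃₁ cf (trans (cong c (P.μU refl)) cz)) (mixed₃₂ (trans (cong (λ x → c (merge (lab (r (r s))) z x)) (lab-mate ht)) cf) (trans (cong c (P.μW refl)) cz)))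
            (trans (cong c (P.μU refl)) cz) _ g (f≡ , trans (cong (λ x → c (merge (lab (r (r s))) z x)) f≡) cf) (conv {c} cz rep) (L.lift-linked lk)
          where
          module L = P.Lift {c} (fixed-merge {c = c} cz)
          cf : c (merge (lab (r (r s))) z (lab t)) ≡ true
          cf = trans (cong (λ x → c (merge (lab (r (r s))) z x)) (sym lab-rw)) q
          f≡ : merge (lab (r (r s))) z (lab (r w)) ≡ lab t
          f≡ = trans (fixed-merge {c = c} cz (lab (r w)) q) lab-rw
        rep-same : ∀ τ {c f} → c z ≡ false → Rep P.rewired c τ f → Rep M (λ l → c (merge (lab (r (r s))) z l)) τ f
        rep-same τ {c} cz = P.Lift.lift-rep {c} (fixed-merge {c = c} cz) τ
        rep-w : ∀ {c f} → c z ≡ false → Rep P.rewired c (edge w) f → Rep M (λ l → c (merge (lab (r (r s))) z l)) (edge a) f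
        rep-w {c} {f} cz rep = let e , q = P.Lift.lift-rep {c} (fixed-merge {c = c} cz) (edge w) rep in trans e lab-rw , q
        solve : Solvable P.rewired
        solve = IH P.rewired P.smaller
        open-solve : ∀ τ₂ → τ₂ ≢ corner a → On M z τ₂ → Sol M z (edge a) τ₂
        open-solve (edge b) ne (hb , e) with b ≟ a
        ... | yes refl = lift {edge w} rep-w (solve {z} {edge w} {edge w} on-w on-w)
        ... | no b≢a = lift {edge b} (rep-same (edge b)) (solve {z} {edge w} {edge b} on-w (survives hb e b≢a , P.μU e))
        open-solve (corner b) ne (hb , e) with b ≟ a
        ... | yes refl = ⊥-elim (ne refl)
        ... | no b≢a = lift {corner b} (rep-same (corner b)) (solve {z} {edge w} {corner b} on-w (survives hb e b≢a , P.μU e))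

      edge-solve : ∀ {τ₂} → τ₂ ≢ corner a → On M (lab a) τ₂ → Sol M (lab a) (edge a) τ₂
      edge-solve {τ₂} ne o with any? (λ δ → (al δ 𝔹.≟ true) ×-dec (lab δ ≟ lab (r (r t))) ×-dec (lab (r δ) ≟ lab (r (r s))))
      ... | yes (δ , h , e , e′) = blocked h e e′ o
      ... | no none = subst (λ l → Sol M l (edge a) τ₂) lab-rrt (Open.open-solve (λ h e e′ → none (_ , h , e , e′)) τ₂ ne (subst (λ l → On M l τ₂) (sym lab-rrt) o))

    edges-solve : EdgeSolvable M
    edges-solve {z} {a} {b} (ha , refl) o = EdgeSolve.edge-solve ha {edge b} (λ ()) o

    -- Two terminals at the vertex of `a` can share the representative `lab (r a)`; making this face
    -- the odd one out leaves nothing to link.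
    at-corner : ∀ {a} → al a ≡ true → ∀ {τ₁ τ₂} → (∀ {c} → c (lab (r a)) ≡ true → c (lab (r (r a))) ≡ false → Rep M c τ₁ (lab (r a)) × Rep M c τ₂ (lab (r a))) → Sol M (lab a) τ₁ τ₂
    at-corner {a} ha reps = let c , p , q , q′ , q″ = odd-one-out {M} edges-solve {r a} (al-rr ha) true
                                rep₁ , rep₂ = reps {c} q q′
                            in sol c p (trans (cong (λ x → c (lab x)) (sym (r³ a))) q″) (lab (r a)) (lab (r a)) rep₁ rep₂ (λ _ _ → refl)

    edge-any : ∀ {z a τ₂} → On M z (edge a) → On M z τ₂ → Sol M z (edge a) τ₂
    edge-any {z} {a} {edge b} o o₂ = edges-solve o o₂
    edge-any {z} {a} {corner b} (ha , refl) o₂ with b ≟ a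
    ... | yes refl = at-corner ha {edge a} {corner a} (λ q q′ → (refl , q) , (q , inj₁ (refl , q′)))
    ... | no b≢a   = EdgeSolve.edge-solve ha {corner b} (λ { refl → b≢a refl }) o₂

    corner-self : ∀ {a} → al a ≡ true → Sol M (lab a) (corner a) (corner a)
    corner-self {a} ha = at-corner ha {corner a} {corner a} (λ q q′ → (q , inj₁ (refl , q′)) , (q , inj₁ (refl , q′)))

  -- Eliminating a face of even length

  -- The face x, whose edges are coloured alternately by P, beginning with true at the edge of o; the
  -- faces across the edges of colour true are pairwise distinct and not adjacent.
  record Ring (M : Map) (x : Fin K) (o : Fin N) (P : Fin N → Bool) : Set where
    open Map M
    field
      ho    : al o ≡ true
      lo    : lab o ≡ x
      Po    : P o ≡ true
      alt   : ∀ {d} → al d ≡ true → lab d ≡ x → P (r (mate d)) ≡ not (P d)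
      indep : ∀ {d d′ e} → al d ≡ true → al d′ ≡ true → al e ≡ true → lab d ≡ x → lab d′ ≡ x → P d ≡ true → P d′ ≡ true →
              lab e ≡ lab (r d) → lab (r e) ≢ lab (r d′)
      inj   : ∀ {d d′} → al d ≡ true → al d′ ≡ true → lab d ≡ x → lab d′ ≡ x → P d ≡ true → P d′ ≡ true → lab (r d) ≡ lab (r d′) → d ≡ d′

  -- Ensures that the darts of the terminals survive the elimination of `x` and that making `x` true
  -- does not disturb their representatives.
  Away : Map → Fin K → Terminal → Set
  Away M x (edge b)   = Map.lab M (r b) ≢ x
  Away M x (corner b) = Map.lab M (r b) ≢ x × Map.lab M (r (r b)) ≢ x

  away-edge : ∀ {M x} τ → Away M x τ → Map.lab M (r (dart τ)) ≢ x
  away-edge (edge b)   h = h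
  away-edge (corner b) h = proj₁ h

  ElimSol : Map → Fin K → Fin K → Terminal → Terminal → Set
  ElimSol M x z τ₁ τ₂ = Σ (Sol M z τ₁ τ₂) λ S → Sol.c S x ≡ true

  module _ {M : Map} {x : Fin K} {o : Fin N} {P : Fin N → Bool} (R : Ring M x o P) {z : Fin K} (lz : Map.lab M (r o) ≡ z)
    {τ₁ τ₂ : Terminal} (o₁ : On M z τ₁) (o₂ : On M z τ₂) (away₁ : Away M x τ₁) (away₂ : Away M x τ₂) where
    open Laws M using (al; mate; lab; lab-mate; loopless; al-rr; lab-mate′; loopless₂; mate-injective; mate-swap; φ; al-φ; φ-injective; face-orbit)
    open Ring R

    -- Both vertices of a face `x` of length two lie on the false face `z` across `o`, so in any
    -- solution `x` may be recoloured true. A new true face only strengthens `TrueEdges`, so the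
    -- link persists.
    elim-digon : φ (φ o) ≡ o → Sol M z τ₁ τ₂ → ElimSol M x z τ₁ τ₂
    elim-digon φφo (sol c p cz f g rep₁ rep₂ lk) =
        sol c′ proper′ (trans (else z≢x) cz) f g (rep τ₁ away₁ rep₁) (rep τ₂ away₂ rep₂) (λ k te → lk k (λ h q q′ → te h (mono q) (mono q′))) , hit refl
      where
      z≢x : z ≢ x
      z≢x e = loopless ho (trans lo (trans (sym e) (sym lz)))
      c′ : Fin K → Bool
      c′ l = if does (l ≟ x) then true else c l
      hit : ∀ {l} → l ≡ x → c′ l ≡ true
      hit {l} e with l ≟ x
      ... | yes _ = refl
      ... | no ¬e = ⊥-elim (¬e e)
      else : ∀ {l} → l ≢ x → c′ l ≡ c l
      else {l} ¬e with l ≟ x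
      ... | yes e = ⊥-elim (¬e e)
      ... | no _  = refl
      mono : ∀ {l} → c l ≡ true → c′ l ≡ true
      mono {l} q with l ≟ x
      ... | yes _ = refl
      ... | no _  = q
      darts : ∀ {d} → al d ≡ true → lab d ≡ x → d ≡ o ⊎ d ≡ φ o
      darts {d} hd ld = from (trans (face-orbit x k k-φ hd ho ld lo) (to (inj₁ refl)))
        where
        opaque
          in? : ∀ b → Dec (b ≡ o ⊎ b ≡ φ o)
          in? b = (b ≟ o) ⊎-dec (b ≟ φ o)
        k : Fin N → Bool
        k b = does (in? b)
        to : ∀ {b} → b ≡ o ⊎ b ≡ φ o → k b ≡ true
        to {b} x with in? b
        ... | yes _ = refl
        ... | no ¬x = ⊥-elim (¬x x)
        from : ∀ {b} → k b ≡ true → b ≡ o ⊎ b ≡ φ o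
        from {b} x with in? b
        ... | yes q = q
        back : ∀ {b} → b ≡ o ⊎ b ≡ φ o → φ b ≡ o ⊎ φ b ≡ φ o
        back (inj₁ refl) = inj₂ refl
        back (inj₂ refl) = inj₁ φφo
        forth : ∀ {b} → al b ≡ true → φ b ≡ o ⊎ φ b ≡ φ o → b ≡ o ⊎ b ≡ φ o
        forth h (inj₁ q) = inj₂ (φ-injective h (al-φ ho) (trans q (sym φφo)))
        forth h (inj₂ q) = inj₁ (φ-injective h ho q)
        k-φ : ∀ {b} → al b ≡ true → lab b ≡ x → k (φ b) ≡ k b
        k-φ {b} h _ with in? b | in? (φ b)
        ... | yes _ | yes _ = refl
        ... | no _  | no _  = refl
        ... | yes x | no ¬y = ⊥-elim (¬y (back x))
        ... | no ¬x | yes y = ⊥-elim (¬x (forth h y))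
      at-x : ∀ {d} → al d ≡ true → lab d ≡ x → MixedAt M c′ d
      at-x h e with darts h e
      ... | inj₁ refl = mixed₂₁ (hit e) (trans (cong c′ lz) (trans (else z≢x) cz))
      ... | inj₂ refl = mixed₃₁ (hit e) (trans (cong c′ (trans (cong lab (r³ (mate o))) (trans (lab-mate′ ho) lz))) (trans (else z≢x) cz))
      proper′ : Proper M c′
      proper′ {d} h = by (lab d ≟ x) (lab (r d) ≟ x) (lab (r (r d)) ≟ x)
        where
        by : Dec (lab d ≡ x) → Dec (lab (r d) ≡ x) → Dec (lab (r (r d)) ≡ x) → MixedAt M c′ d
        by (yes e) _ _ = at-x h e
        by (no _) (yes e) _ = subst (MixedAt M c′) (r³ d) (mixedAt-r M {c′} (mixedAt-r M {c′} (at-x (al-rr h) e)))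
        by (no _) (no _) (yes e) = subst (MixedAt M c′) (r³ d) (mixedAt-r M {c′} (at-x (al-rr (al-rr h)) e))
        by (no a) (no b) (no b′) (q , q′) = p h (trans (sym (else a)) (trans q (else b)) , trans (sym (else b)) (trans q′ (else b′)))
      rep : ∀ τ {f} → Away M x τ → Rep M c τ f → Rep M c′ τ f
      rep (edge b) _ (e , q) = e , mono q
      rep (corner b) (_ , w) (q , inj₁ (e , q′)) = mono q , inj₁ (e , trans (else w) q′)
      rep (corner b) (w , _) (q , inj₂ (e , q′)) = mono q , inj₂ (e , trans (else w) q′)

    -- Splicing the edge after `o` merges the face across the next edge `n₂` of colour true into `z`
    -- and shortens `x` by two. The conditions of `Splice` are instances of `inj` and `indep`, and
    -- both properties persist because `z` itself is the face across `o`.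
    module Step (φφo : φ (φ o) ≢ o) where
      t : Fin N
      t = φ o
      ht : al t ≡ true
      ht = al-φ ho
      lt : lab t ≡ x
      lt = trans (lab-mate ho) lo
      rrt : r (r t) ≡ mate o
      rrt = r³ (mate o)
      lab-rrt : lab (r (r t)) ≡ lab (r o)
      lab-rrt = trans (cong lab rrt) (lab-mate′ ho)
      n₂ : Fin N
      n₂ = φ (φ o)
      hn : al n₂ ≡ true
      hn = al-φ ht
      ln : lab n₂ ≡ x
      ln = trans (lab-mate ht) lt
      Pn : P n₂ ≡ true
      Pn = trans (alt ht lt) (cong not (trans (alt ho lo) (cong not Po)))
      U≢W : lab (r (r t)) ≢ lab (r n₂)
      U≢W e = φφo (inj hn ho ln lo Pn Po (trans (sym e) lab-rrt))
      module S = Splice M ht U≢W (λ h e → indep ho hn h lo ln Po Pn (trans e lab-rrt)) using (s; lab-s; Dead; dead?; stub-rrt; stub-cases; al⁻; mate⁻; alive⁻; alive; ¬dead; mate⁻-keep; mate⁻-stub; stub-mate; rewired; smaller; lift-proper; module Lift; π-rrt; μW; μU)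

      x≢W : x ≢ lab (r n₂)
      x≢W e = loopless hn (trans ln e)
      z≢x : z ≢ x
      z≢x e = loopless ho (trans lo (trans (sym e) (sym lz)))

      x-dead : ∀ {d} → S.Dead d → lab d ≡ x → d ≡ t ⊎ d ≡ n₂
      x-dead (inj₁ (inj₁ q)) e = inj₁ q
      x-dead (inj₁ (inj₂ (inj₁ refl))) e = ⊥-elim (loopless ht (trans lt (sym e)))
      x-dead (inj₁ (inj₂ (inj₂ refl))) e = ⊥-elim (loopless₂ ht (trans lt (sym e)))
      x-dead (inj₂ (inj₁ refl)) e = ⊥-elim (loopless ht (trans lt (trans (sym e) S.lab-s)))
      x-dead (inj₂ (inj₂ (inj₁ q))) e = inj₂ q
      x-dead (inj₂ (inj₂ (inj₂ refl))) e = ⊥-elim (x≢W (sym e))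

      x-lab : ∀ l → merge (lab (r n₂)) (lab (r (r t))) l ≡ x → l ≡ x
      x-lab l e with merge-cases (lab (r n₂)) (lab (r (r t))) l
      ... | inj₁ (q , _) = trans (sym q) e
      ... | inj₂ (q , _) = ⊥-elim (z≢x (trans (sym lz) (trans (sym lab-rrt) (trans (sym q) e))))

      μx : merge (lab (r n₂)) (lab (r (r t))) x ≡ x
      μx = merge-miss x≢W

      al-o : S.al⁻ o ≡ true
      al-o = S.alive⁻ ho (λ d → by (x-dead d lo))
        where
        by : ¬ (o ≡ t ⊎ o ≡ n₂)
        by (inj₁ e) = true≢false Po (trans (cong P e) (trans (alt ho lo) (cong not Po)))
        by (inj₂ e) = φφo (sym e)

      alt⁻ : ∀ {d} → S.al⁻ d ≡ true → lab d ≡ x → P (r (S.mate⁻ d)) ≡ not (P d)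
      alt⁻ {d} h l = by (S.dead? (mate d))
        where
        hd : al d ≡ true
        hd = S.alive h
        by : Dec (S.Dead (mate d)) → P (r (S.mate⁻ d)) ≡ not (P d)
        by (no ¬y) = trans (cong (λ w → P (r w)) (S.mate⁻-keep ¬y)) (alt hd l)
        by (yes y) = which (S.stub-cases (S.stub-mate hd (S.¬dead h) y))
          where
          lab-m : ∀ {e} → mate d ≡ e → lab (r e) ≡ x
          lab-m refl = trans (lab-mate hd) l
          which : (mate d ≡ r t ⊎ mate d ≡ r (r t)) ⊎ (mate d ≡ r S.s ⊎ mate d ≡ r (r S.s)) → P (r (S.mate⁻ d)) ≡ not (P d)
          which (inj₁ (inj₁ q)) = ⊥-elim (loopless₂ ht (trans lt (sym (lab-m q))))
          which (inj₁ (inj₂ q)) = trans (cong (λ w → P (r w)) (trans (cong S.mate⁻ (mate-swap hd q)) (trans (S.mate⁻-stub S.stub-rrt) (cong mate S.π-rrt))))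
              (trans (alt hn ln) (cong not (trans Pn (sym (trans (cong P (mate-injective hd ho (trans q rrt))) Po)))))
          which (inj₂ (inj₁ q)) = ⊥-elim (x≢W (sym (lab-m q)))
          which (inj₂ (inj₂ q)) = ⊥-elim (loopless ht (trans lt (trans (sym (lab-m q)) (trans (cong lab (r³ S.s)) S.lab-s))))

      source : ∀ {d l} → al d ≡ true → lab d ≡ x → P d ≡ true → merge (lab (r n₂)) (lab (r (r t))) l ≡ merge (lab (r n₂)) (lab (r (r t))) (lab (r d)) →
        ∃[ d′ ] (al d′ ≡ true × lab d′ ≡ x × P d′ ≡ true × l ≡ lab (r d′))
      source {d} {l} h ld Pd e with merge-≡ {l = l} e
      ... | inj₁ q = d , h , ld , Pd , q
      ... | inj₂ (inj₁ (q , _)) = n₂ , hn , ln , Pn , q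
      ... | inj₂ (inj₂ (q , _)) = o , ho , lo , Po , trans q lab-rrt

      ring⁻ : Ring S.rewired x o P
      ring⁻ = record
        { ho = al-o ; lo = trans (cong (merge _ _) lo) μx ; Po = Po
        ; alt = λ {d} h l → alt⁻ h (x-lab (lab d) l)
        ; indep = λ {d} {d′} {e} h h′ he l l′ p p′ q q′ →
            let a , ha , la , pa , qa = source (S.alive h) (x-lab (lab d) l) p q
                b , hb , lb , pb , qb = source (S.alive h′) (x-lab (lab d′) l′) p′ q′
            in indep ha hb (S.alive he) la lb pa pb qa qb
        ; inj = λ {d} {d′} h h′ l l′ p p′ q → inj⁻ h h′ (x-lab (lab d) l) (x-lab (lab d′) l′) p p′ (merge-≡ {l = lab (r d)} q)
        }
        where
        not-n₂ : ∀ {d} → S.al⁻ d ≡ true → lab d ≡ x → P d ≡ true → lab (r d) ≢ lab (r n₂)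
        not-n₂ h l p e with inj (S.alive h) hn l ln p Pn e
        ... | refl = S.¬dead h (inj₂ (inj₂ (inj₁ refl)))
        inj⁻ : ∀ {d d′} → S.al⁻ d ≡ true → S.al⁻ d′ ≡ true → lab d ≡ x → lab d′ ≡ x → P d ≡ true → P d′ ≡ true →
          lab (r d) ≡ lab (r d′) ⊎ (lab (r d) ≡ lab (r n₂) × lab (r d′) ≡ lab (r (r t)) ⊎ lab (r d) ≡ lab (r (r t)) × lab (r d′) ≡ lab (r n₂)) → d ≡ d′
        inj⁻ h h′ l l′ p p′ (inj₁ q) = inj (S.alive h) (S.alive h′) l l′ p p′ q
        inj⁻ h h′ l l′ p p′ (inj₂ (inj₁ (q , _))) = ⊥-elim (not-n₂ h l p q)
        inj⁻ h h′ l l′ p p′ (inj₂ (inj₂ (_ , q))) = ⊥-elim (not-n₂ h′ l′ p′ q)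

      μz : ∀ {l} → l ≡ z → merge (lab (r n₂)) (lab (r (r t))) l ≡ z
      μz e = trans (S.μU (trans e (trans (sym lz) (sym lab-rrt)))) (trans lab-rrt lz)

      on⁻ : ∀ τ → On M z τ → Away M x τ → On S.rewired z τ
      on⁻ τ (h , e) w = S.alive⁻ h by , μz e
        where
        b : Fin N
        b = dart τ
        lb : lab b ≡ lab (r (r t))
        lb = trans e (trans (sym lz) (sym lab-rrt))
        by : ¬ S.Dead b
        by (inj₁ (inj₁ q)) = loopless₂ ht (trans (cong lab (sym q)) lb)
        by (inj₁ (inj₂ (inj₁ q))) = loopless (al-rr ht) (trans (cong lab (sym q)) lb)
        by (inj₁ (inj₂ (inj₂ q))) = away-edge {M} τ w (trans (cong (λ y → lab (r y)) q) (trans (cong lab (r³ t)) lt))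
        by (inj₂ (inj₁ q)) = loopless (al-rr ht) (trans (sym S.lab-s) (trans (cong lab (sym q)) lb))
        by (inj₂ (inj₂ (inj₁ q))) = loopless₂ ht (trans lt (trans (sym ln) (trans (cong lab (sym q)) lb)))
        by (inj₂ (inj₂ (inj₂ q))) = U≢W (trans (sym lb) (cong lab q))

      away⁻ : ∀ τ → Away M x τ → Away S.rewired x τ
      away⁻ (edge b) w e = w (x-lab (lab (r b)) e)
      away⁻ (corner b) (w , w′) = (λ e → w (x-lab (lab (r b)) e)) , λ e → w′ (x-lab (lab (r (r b))) e)

      lift : ElimSol S.rewired x z τ₁ τ₂ → ElimSol M x z τ₁ τ₂
      lift (sol c p cz f g rep₁ rep₂ lk , cx) = sol (λ l → c (merge (lab (r n₂)) (lab (r (r t))) l))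
          (S.lift-proper {c} p (mixed₃₁ (c-x lt) (c-z lab-rrt))
            (mixed₃₂ (c-x ln) (trans (cong c (S.μW refl)) cU)))
          (trans (cong c (μz refl)) cz) f g (L.lift-rep τ₁ rep₁) (L.lift-rep τ₂ rep₂) (L.lift-linked lk) , c-x refl
        where
        cU : c (lab (r (r t))) ≡ false
        cU = trans (cong c (trans lab-rrt lz)) cz
        module L = S.Lift {c} (fixed-merge {c = c} cU)
        c-x : ∀ {l} → l ≡ x → c (merge (lab (r n₂)) (lab (r (r t))) l) ≡ true
        c-x refl = trans (cong c μx) cx
        c-z : ∀ {l} → l ≡ lab (r o) → c (merge (lab (r n₂)) (lab (r (r t))) l) ≡ false
        c-z e = trans (cong c (μz (trans e lz))) cz

  -- The induction hypothesis is bounded by a fixed `b` rather than by the size of `M`, since the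
  -- map reached when `x` has length two is solved as it stands. The recursion itself runs on `n`.
  eliminate-face : ∀ n {b} → (∀ M′ → size M′ < b → Solvable M′) → ∀ M → size M < n → size M < b → ∀ {x o P} → Ring M x o P → ∀ {z} → Map.lab M (r o) ≡ z →
    ∀ {τ₁ τ₂} → On M z τ₁ → On M z τ₂ → Away M x τ₁ → Away M x τ₂ → ElimSol M x z τ₁ τ₂
  eliminate-face (suc n) IH M <n <b {x} {o} {P} R {z} lz {τ₁} {τ₂} o₁ o₂ w₁ w₂ with Laws.φ M (Laws.φ M o) ≟ o
  ... | yes q = elim-digon R lz {τ₁} {τ₂} o₁ o₂ w₁ w₂ q (IH M <b {z} {τ₁} {τ₂} o₁ o₂)
  ... | no ¬q = T.lift (eliminate-face n IH T.S.rewired (<-≤-trans T.S.smaller (s≤s⁻¹ <n)) (<-trans T.S.smaller <b) T.ring⁻ (T.μz lz) {τ₁} {τ₂} (T.on⁻ τ₁ o₁ w₁) (T.on⁻ τ₂ o₂ w₂) (T.away⁻ τ₁ w₁) (T.away⁻ τ₂ w₂))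
    where
    module T = Step R lz {τ₁} {τ₂} o₁ o₂ w₁ w₂ ¬q using (module S; ring⁻; μz; on⁻; away⁻; lift)

  -- Here `M` is not yet below the bound of the induction hypothesis. A first splice makes it
  -- smaller, which is why `x` must not have length two.
  eliminate-first : ∀ M → (∀ M′ → size M′ < size M → Solvable M′) → ∀ {x o P} → Ring M x o P → ∀ {z} → Map.lab M (r o) ≡ z →
    ∀ {τ₁ τ₂} → On M z τ₁ → On M z τ₂ → Away M x τ₁ → Away M x τ₂ → Laws.φ M (Laws.φ M o) ≢ o → ElimSol M x z τ₁ τ₂
  eliminate-first M IH R lz {τ₁} {τ₂} o₁ o₂ w₁ w₂ ¬q = T.lift (eliminate-face (size M) IH T.S.rewired T.S.smaller T.S.smaller T.ring⁻ (T.μz lz) {τ₁} {τ₂} (T.on⁻ τ₁ o₁ w₁) (T.on⁻ τ₂ o₂ w₂) (T.away⁻ τ₁ w₁) (T.away⁻ τ₂ w₂))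
    where
    module T = Step R lz {τ₁} {τ₂} o₁ o₂ w₁ w₂ ¬q using (module S; ring⁻; μz; on⁻; away⁻; lift)

  -- Alternating colours along a face, with a possible defect only before o.
  module Parity (M : Map) {o : Fin N} (ho : Map.al M o ≡ true) where
    open Laws M using (al; lab; lab-mate; φ; al-φ; φ-injective; al-φ^; period; face-orbit)

    Hit : ℕ → Fin N → Fin N → Set
    Hit zero    cur d = ⊥
    Hit (suc n) cur d = cur ≡ d ⊎ Hit n (φ cur) d

    hit? : ∀ n cur d → Dec (Hit n cur d)
    hit? zero    cur d = no (λ ())
    hit? (suc n) cur d = (cur ≟ d) ⊎-dec hit? n (φ cur) d

    -- Colours alternate along the orbit, and a dart receives the colour of its first occurrence;
    -- the length `n` may therefore exceed the least period. The value for `n` equal to zero is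
    -- never read at a dart satisfying `Hit`.
    scan : ℕ → Fin N → Bool → Fin N → Bool
    scan zero    cur b d = b
    scan (suc n) cur b d = if does (cur ≟ d) then b else scan n (φ cur) (not b) d

    scan-yes : ∀ n {cur b d} → cur ≡ d → scan (suc n) cur b d ≡ b
    scan-yes n {cur} {b} {d} e = cong (λ q → if q then b else scan n (φ cur) (not b) d) (trans (cong (λ y → does (y ≟ d)) e) (does-refl d))

    scan-no : ∀ n {cur b d} → cur ≢ d → scan (suc n) cur b d ≡ scan n (φ cur) (not b) d
    scan-no n {cur} {b} {d} h = cong (λ q → if q then b else scan n (φ cur) (not b) d) (does-false h)

    scan-fuel : ∀ n {cur b d} → Hit n cur d → scan (suc n) cur b d ≡ scan n cur b d
    scan-fuel (suc n) {cur} {b} {d} h = by h (cur ≟ d)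
      where
      by : Hit (suc n) cur d → Dec (cur ≡ d) → scan (suc (suc n)) cur b d ≡ scan (suc n) cur b d
      by _ (yes e) = trans (scan-yes (suc n) e) (sym (scan-yes n e))
      by (inj₁ e) (no ¬e) = ⊥-elim (¬e e)
      by (inj₂ h) (no ¬e) = trans (scan-no (suc n) ¬e) (trans (scan-fuel n h) (sym (scan-no n ¬e)))

    scan-φ : ∀ n {cur b d} → al cur ≡ true → al d ≡ true → Hit n cur d → φ d ≢ cur → scan (suc n) cur b (φ d) ≡ not (scan n cur b d)
    scan-φ (suc n) {cur} {b} {d} hc hd h ne = by h (cur ≟ d)
      where
      by : Hit (suc n) cur d → Dec (cur ≡ d) → scan (suc (suc n)) cur b (φ d) ≡ not (scan (suc n) cur b d)
      by _ (yes refl) = trans (scan-no (suc n) (λ e → ne (sym e))) (trans (scan-yes n {φ cur} {not b} {φ d} refl) (cong not (sym (scan-yes n {cur} {b} {d} refl))))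
      by (inj₁ e) (no ¬e) = ⊥-elim (¬e e)
      by (inj₂ h) (no ¬e) = trans (scan-no (suc n) (λ e → ne (sym e)))
        (trans (scan-φ n (al-φ hc) hd h (λ e → ¬e (sym (φ-injective hd hc e)))) (cong not (sym (scan-no n ¬e))))

    hit-map : ∀ n {cur d} → Hit n cur d → Hit n (φ cur) (φ d)
    hit-map (suc n) (inj₁ refl) = inj₁ refl
    hit-map (suc n) (inj₂ h) = inj₂ (hit-map n h)

    hit-unmap : ∀ n {cur d} → al cur ≡ true → al d ≡ true → Hit n (φ cur) (φ d) → Hit n cur d
    hit-unmap (suc n) hc hd (inj₁ e) = inj₁ (φ-injective hc hd e)
    hit-unmap (suc n) hc hd (inj₂ h) = inj₂ (hit-unmap n (al-φ hc) hd h)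

    hit-last : ∀ n {cur d} → Hit (suc n) cur d → Hit n cur d ⊎ d ≡ iterate φ n cur
    hit-last zero (inj₁ e) = inj₂ (sym e)
    hit-last (suc n) (inj₁ e) = inj₁ (inj₁ e)
    hit-last (suc n) {cur} (inj₂ h) with hit-last n h
    ... | inj₁ q = inj₁ (inj₂ q)
    ... | inj₂ q = inj₂ (trans q (iterate-suc φ n cur))

    hit-weaken : ∀ n {cur d} → Hit n cur d → Hit (suc n) cur d
    hit-weaken (suc n) (inj₁ e) = inj₁ e
    hit-weaken (suc n) (inj₂ h) = inj₂ (hit-weaken n h)

    hit-iterate : ∀ n {cur} → Hit (suc n) cur (iterate φ n cur)
    hit-iterate zero = inj₁ refl
    hit-iterate (suc n) {cur} = inj₂ (subst (Hit (suc n) (φ cur)) (iterate-suc φ n cur) (hit-iterate n))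

    p : ℕ
    p = proj₁ (period ho)

    returns : iterate φ (suc p) o ≡ o
    returns = proj₂ (period ho)

    forth : ∀ {d} → Hit (suc p) o d → Hit (suc p) o (φ d)
    forth h with hit-last (suc p) (inj₂ (hit-map (suc p) h))
    ... | inj₁ q = q
    ... | inj₂ q = inj₁ (sym (trans q returns))

    back : ∀ {d} → al d ≡ true → Hit (suc p) o (φ d) → Hit (suc p) o d
    back h (inj₁ e) = subst (Hit (suc p) o) (φ-injective (al-φ^ p ho) h (trans returns e)) (hit-iterate p)
    back h (inj₂ q) = hit-weaken p (hit-unmap p ho h q)

    hits : ∀ {d} → al d ≡ true → lab d ≡ lab o → Hit (suc p) o d
    hits {d} hd ld = from (trans (face-orbit (lab o) k k-φ hd ho ld refl) (to (inj₁ refl)))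
      where
      opaque
        in? : ∀ d → Dec (Hit (suc p) o d)
        in? = hit? (suc p) o
      k : Fin N → Bool
      k d = does (in? d)
      to : ∀ {d} → Hit (suc p) o d → k d ≡ true
      to {d} x with in? d
      ... | yes _ = refl
      ... | no ¬x = ⊥-elim (¬x x)
      from : ∀ {d} → k d ≡ true → Hit (suc p) o d
      from {d} x with in? d
      ... | yes q = q
      k-φ : ∀ {d} → al d ≡ true → lab d ≡ lab o → k (φ d) ≡ k d
      k-φ {d} h _ with in? d | in? (φ d)
      ... | yes _ | yes _ = refl
      ... | no _  | no _  = refl
      ... | yes x | no ¬y = ⊥-elim (¬y (forth x))
      ... | no ¬x | yes y = ⊥-elim (¬x (back h y))

    parity : Σ (Fin N → Bool) λ P → P o ≡ true × (∀ {d} → al d ≡ true → lab d ≡ lab o → φ d ≢ o → P (φ d) ≡ not (P d))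
    parity = scan (suc p) o true , scan-yes p refl , λ h l ne → trans (sym (scan-fuel (suc p) (hits (al-φ h) (trans (lab-mate h) l)))) (scan-φ (suc p) ho h (hits h l) ne)

  -- Two corners of a face

  module Corners (M : Map) (tight₂ : Tight₂ M) (tight₃ : Tight₃ M) (thick : Thick M) (IH : ∀ M′ → size M′ < size M → Solvable M′) where
    open Laws M using (al; mate; lab; al-mate; mate-mate; lab-mate; loopless; al-rr; lab-mate′; loopless₂; mate-swap; φ; ν; al-φ; al-ν; lab-ν; lab-r-ν; νφ; ν-injective)
    open TightMap M tight₂ tight₃ thick IH using (bridge; edge-any; corner-self)

    -- The edge of `ν a` separates `lab a` from `lab (r (r a))`. Contracting it lets both be false,
    -- so the corner `a` is served once `lab (r a)` is true; the face at the other end must also be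
    -- true, to keep the suppressed vertex there mixed.
    module Contracted {a : Fin N} (ha : al a ≡ true) where
      t : Fin N
      t = ν a
      ht : al t ≡ true
      ht = al-ν ha
      lt : lab t ≡ lab a
      lt = lab-ν ha
      u≡ : lab (r t) ≡ lab (r (r a))
      u≡ = lab-r-ν ha
      s≡ : mate t ≡ r (r a)
      s≡ = mate-mate (al-rr (al-rr ha))
      rs≡ : r (mate t) ≡ a
      rs≡ = trans (cong r s≡) (r³ a)
      rrs≡ : r (r (mate t)) ≡ r a
      rrs≡ = cong r rs≡
      only : ∀ {d} → al d ≡ true → lab d ≡ lab t → lab (r d) ≡ lab (r t) → d ≡ t
      only h = tight₂ h ht
      module C = Contract M ht (thick ht) only using (s; lab-s; Dead; dead?; Stub; stub-rt; stub-rrs; stub-cases; al⁻; mate⁻; lab⁻; alive⁻; alive; ¬dead; mate⁻-keep; mate⁻-stub; stub-mate; stub-alive⁻; rewired; smaller; lift-proper; module Lift; π-rt; μA; μB; loopless⁻)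

      x≢f : lab (r (r t)) ≢ lab (r a)
      x≢f e = thick ht (trans e (cong lab (sym rrs≡)))

      survives : ∀ {b} → al b ≡ true → lab b ≡ lab a → b ≢ a → b ≢ t → C.al⁻ b ≡ true
      survives {b} hb e b≢a b≢t = C.alive⁻ hb by
        where
        by : ¬ C.Dead b
        by (inj₁ (inj₁ q)) = b≢t q
        by (inj₁ (inj₂ (inj₁ refl))) = loopless ht (trans lt (sym e))
        by (inj₁ (inj₂ (inj₂ refl))) = loopless₂ ht (trans lt (sym e))
        by (inj₂ (inj₁ refl)) = loopless ht (trans lt (trans (sym e) C.lab-s))
        by (inj₂ (inj₂ (inj₁ q))) = b≢a (trans q rs≡)
        by (inj₂ (inj₂ (inj₂ q))) = loopless ha (trans (sym e) (cong lab (trans q rrs≡)))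

      μ : Fin K → Fin K
      μ = merge (lab (r t)) (lab t)

      module Lifted {c : Fin K → Bool} (p : Proper C.rewired c) (cz : c (lab t) ≡ false) (cx : c (μ (lab (r (r t)))) ≡ true) (cf : c (μ (lab (r a))) ≡ true) where
        c⁺ : Fin K → Bool
        c⁺ l = c (μ l)
        c-z : c⁺ (lab a) ≡ false
        c-z = trans (cong c (C.μA (sym lt))) cz
        c-u : c⁺ (lab (r (r a))) ≡ false
        c-u = trans (cong c (C.μB (sym u≡))) cz
        proper⁺ : Proper M c⁺
        proper⁺ = C.lift-proper {c} p (mixed₁₃ (trans (cong c⁺ lt) c-z) cx) (mixed₁₃ (trans (cong (λ y → c⁺ (lab y)) s≡) c-u) (trans (cong (λ y → c⁺ (lab y)) rrs≡) cf))
        open C.Lift {c} (fixed-merge {c = c} cz) public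
        rep-a : Rep M c⁺ (corner a) (lab (r a))
        rep-a = cf , inj₁ (refl , c-u)

    -- The two corners are at the ends of the edge of `ν a`. Bridging this edge makes its far side
    -- false, which is a face at both corners, and links their remaining faces.
    next : ∀ {a} → al a ≡ true → Sol M (lab a) (corner a) (corner (ν a))
    next {a} ha = by (bridge (al-ν ha))
      where
      opp : lab (r (r (mate (ν a)))) ≡ lab (r a)
      opp = cong lab (Contracted.rrs≡ ha)
      by : Bridged M (ν a) → Sol M (lab a) (corner a) (corner (ν a))
      by (bridged c p c-p c-rp c-rrp c-opp lk) = sol c p (trans (cong c (sym (lab-ν ha))) c-p) (lab (r a)) (lab (r (r (ν a))))
        (trans (cong c (sym opp)) c-opp , inj₁ (refl , trans (cong c (sym (lab-r-ν ha))) c-rp)) (c-rrp , inj₂ (refl , c-rp))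
        (λ k te → trans (cong k (sym opp)) (sym (lk k te)))

    -- Opposite corners of a face of length four: contract two opposite edges.
    module Opposite {a b : Fin N} (ha : al a ≡ true) (hb : al b ≡ true) (a≢b : a ≢ b) (νa≢b : ν a ≢ b) (νb≢a : ν b ≢ a) (ν²a : ν (ν a) ≡ b) (ν²b : ν (ν b) ≡ a) where
      open Contracted ha using (t; ht; lt; u≡; rs≡; module C; x≢f; survives; μ; module Lifted)
      q : Fin N
      q = ν b
      hq : al q ≡ true
      hq = al-ν hb
      lb : lab b ≡ lab a
      lb = trans (cong lab (sym ν²a)) (trans (lab-ν ht) lt)
      lq : lab q ≡ lab a
      lq = trans (lab-ν hb) lb
      q≢t : q ≢ t
      q≢t e = a≢b (sym (ν-injective hb ha e))
      hq⁻ : C.al⁻ q ≡ true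
      hq⁻ = survives hq lq νb≢a q≢t
      hb⁻ : C.al⁻ b ≡ true
      hb⁻ = survives hb lb (λ e → a≢b (sym e)) (λ e → νa≢b (sym e))
      module L₁ = Laws C.rewired using (al-rr)
      mate-q : C.mate⁻ q ≡ r (r b)
      mate-q = trans (C.mate⁻-keep (λ d → C.¬dead (L₁.al-rr (L₁.al-rr hb⁻)) (subst C.Dead (mate-mate (al-rr (al-rr hb))) d))) (mate-mate (al-rr (al-rr hb)))
      x≡ : lab (r b) ≡ lab (r (r t))
      x≡ = trans (cong (λ y → lab (r y)) (sym ν²a)) (lab-r-ν ht)
      f≡ : lab (r (r q)) ≡ lab (r a)
      f≡ = trans (sym (lab-r-ν hq)) (cong (λ y → lab (r y)) ν²b)
      opp : r (r (C.mate⁻ q)) ≡ r b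
      opp = trans (cong (λ y → r (r y)) mate-q) (r³ (r b))
      f≢u : lab (r a) ≢ lab (r t)
      f≢u e = loopless (al-rr ha) (trans e u≡)
      x≢u : lab (r (r t)) ≢ lab (r t)
      x≢u e = loopless (al-rr ht) (sym e)
      w≢u : lab (r q) ≢ lab (r t)
      w≢u e = q≢t (tight₂ hq ht (trans lq (sym lt)) e)
      U≢W : C.lab⁻ (r (r q)) ≢ C.lab⁻ (r (r (C.mate⁻ q)))
      U≢W e = x≢f (trans (sym (merge-miss x≢u)) (trans (cong μ (sym x≡)) (trans (cong (λ y → μ (lab y)) (sym opp)) (trans (sym e) (trans (cong μ f≡) (merge-miss f≢u))))))
      -- The merged face consists of `lab t` and `lab (r t)`. A second edge from it to `lab (r q)`
      -- would be a parallel edge in the first case; in the second it would close a triangle of the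
      -- dual with the edges of `r (r b)` and `t`, which meet in no common vertex with it by `νa≢b`
      -- and `νb≢a`.
      only⁻ : ∀ {d} → C.al⁻ d ≡ true → C.lab⁻ d ≡ C.lab⁻ q → C.lab⁻ (r d) ≡ C.lab⁻ (r q) → d ≡ q
      only⁻ {d} h e e′ = by (merge-≡ {l = lab d} e) (merge-≡ {l = lab (r d)} e′)
        where
        hd : al d ≡ true
        hd = C.alive h
        lrq : lab (r q) ≡ lab (r (r b))
        lrq = lab-r-ν hb
        cycle : lab d ≡ lab (r t) → lab (r d) ≡ lab (r q) → ⊥
        cycle p p′ with tight₃ {d} {r (r b)} {t} hd (al-rr (al-rr hb)) ht (trans p′ lrq) (trans (cong lab (r³ b)) (trans lb (sym lt))) (sym p)
        ... | inj₁ (_ , m) = νa≢b (trans m (r³ b))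
        ... | inj₂ (_ , m) = νb≢a (trans m rs≡)
        by : lab d ≡ lab q ⊎ (lab d ≡ lab (r t) × lab q ≡ lab t ⊎ lab d ≡ lab t × lab q ≡ lab (r t)) →
             lab (r d) ≡ lab (r q) ⊎ (lab (r d) ≡ lab (r t) × lab (r q) ≡ lab t ⊎ lab (r d) ≡ lab t × lab (r q) ≡ lab (r t)) → d ≡ q
        by (inj₁ p) (inj₁ p′) = tight₂ hd hq p p′
        by (inj₂ (inj₁ (p , _))) (inj₁ p′) = ⊥-elim (cycle p p′)
        by (inj₂ (inj₂ (p , _))) (inj₁ p′) = tight₂ hd hq (trans p (trans lt (sym lq))) p′
        by _ (inj₂ (inj₁ (_ , p′))) = ⊥-elim (loopless hq (trans lq (trans (sym lt) (sym p′))))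
        by _ (inj₂ (inj₂ (_ , p′))) = ⊥-elim (w≢u p′)
      opposite : Sol M (lab a) (corner a) (corner b)
      opposite = by (contract-solve C.rewired hq⁻ U≢W only⁻ (λ M′ lt → IH M′ (<-trans lt C.smaller)))
        where
        by : Bridged C.rewired q → Sol M (lab a) (corner a) (corner b)
        by (bridged c p c-p c-rp c-rrp c-opp lk) = sol c⁺ proper⁺ c-z (lab (r a)) (lab (r b)) rep-a
            (trans (cong c⁺ x≡) cx , inj₁ (refl , trans (cong c⁺ (sym (lab-r-ν hb))) c-rp))
            (λ k te → trans (cong k (sym (trans (cong μ f≡) (merge-miss f≢u)))) (trans (lift-linked lk k te) (cong k (trans (cong (λ y → μ (lab y)) opp) (trans (cong μ x≡) (trans (merge-miss x≢u) (sym x≡)))))))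
          where
          cz : c (lab t) ≡ false
          cz = trans (cong c (sym (C.μA (trans lq (sym lt))))) c-p
          cx : c (μ (lab (r (r t)))) ≡ true
          cx = trans (cong (λ l → c (μ l)) (trans (sym x≡) (cong lab (sym opp)))) c-opp
          cf : c (μ (lab (r a))) ≡ true
          cf = trans (cong (λ l → c (μ l)) (sym f≡)) c-rrp
          open Lifted {c} p cz cx cf

    -- The face `x` lies at the end of the edge of `ν a` away from `a`. Its dart `o` has `lab a`
    -- across, and the preceding dart `ν o` has `lab (r (r a))` across. Alternating from `o`, the
    -- colour at `ν o` shows the parity of the length of `x`.
    module Far {a b : Fin N} (ha : al a ≡ true) (hb : al b ≡ true) (lb : lab b ≡ lab a) (a≢b : a ≢ b) (νa≢b : ν a ≢ b) (ν²a≢b : ν (ν a) ≢ b) where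
      open Contracted ha using (t; ht; lt; u≡; rrs≡; module C; x≢f; survives; μ; module Lifted)
      o : Fin N
      o = r (r t)
      x : Fin K
      x = lab o
      ho : al o ≡ true
      ho = al-rr (al-rr ht)
      ro : r o ≡ t
      ro = r³ t
      open Parity M ho using (parity)
      P : Fin N → Bool
      P = proj₁ parity
      Po : P o ≡ true
      Po = proj₁ (proj₂ parity)
      P-φ : ∀ {d} → al d ≡ true → lab d ≡ x → φ d ≢ o → P (φ d) ≡ not (P d)
      P-φ = proj₂ (proj₂ parity)
      x≢u : x ≢ lab (r t)
      x≢u e = loopless (al-rr ht) (sym e)
      x≢z : x ≢ lab t
      x≢z e = loopless₂ ht (sym e)
      o-unique : ∀ {d} → al d ≡ true → lab d ≡ x → lab (r d) ≡ lab t → d ≡ o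
      o-unique h l l′ = tight₂ h ho l (trans l′ (cong lab (sym ro)))
      νo : ν o ≡ mate (r t)
      νo = cong mate (cong r ro)
      νo-unique : ∀ {d} → al d ≡ true → lab d ≡ x → lab (r d) ≡ lab (r t) → d ≡ ν o
      νo-unique h l l′ = tight₂ h (al-ν ho) (trans l (sym (lab-ν ho))) (trans l′ (sym (trans (lab-r-ν ho) (cong (λ y → lab (r y)) ro))))

      away-a : Away M x (corner a)
      away-a = (λ e → x≢f (sym e)) , λ e → x≢u (trans (sym e) (sym u≡))
      -- By `tight₂` the face `x` meets the corners of `lab a` only at `ν a` and `ν (ν a)`, and both
      -- are excluded.
      away-b : Away M x (corner b)
      away-b = (λ e → ν²a≢b (sym (tight₂ hb (al-ν ht) (trans lb (sym (trans (lab-ν ht) lt))) (trans e (sym (lab-r-ν ht)))))) ,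
               (λ e → νa≢b (sym (ν-injective hb ht (tight₂ (al-ν hb) (al-ν ht) (trans (lab-ν hb) (trans lb (sym (trans (lab-ν ht) lt)))) (trans (lab-r-ν hb) (trans e (sym (lab-r-ν ht))))))))

      -- An edge between the faces across `d` and `d′` closes a triangle of the dual with `x`. By
      -- `tight₃` it surrounds a vertex, so `d` and `d′` are consecutive on `x`.
      neighbours : ∀ {d d′ e} → al d ≡ true → al d′ ≡ true → al e ≡ true → lab d ≡ x → lab d′ ≡ x → lab e ≡ lab (r d) → lab (r e) ≡ lab (r d′) → φ d′ ≡ d ⊎ φ d ≡ d′
      neighbours {d} {d′} {e} h h′ he l l′ q q′ with tight₃ {d} {e} {mate d′} h he (al-mate h′) (sym q) (trans q′ (sym (lab-mate′ h′))) (trans (lab-mate h′) (trans l′ (sym l)))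
      ... | inj₁ (p , p′) = inj₁ (trans (cong r (trans p′ (cong r p))) (r³ d))
      ... | inj₂ (p , p′) = inj₂ (trans (cong r (trans p (cong r (trans p′ (cong r (mate-mate h′)))))) (r³ d′))

      even : P (ν o) ≡ false → Sol M (lab a) (corner a) (corner b)
      even Pν = proj₁ (eliminate-first M IH R lz {corner a} {corner b} (ha , refl) (hb , lb) away-a away-b digon)
        where
        lz : lab (r o) ≡ lab a
        lz = trans (cong lab ro) lt
        alt : ∀ {d} → al d ≡ true → lab d ≡ x → P (φ d) ≡ not (P d)
        alt {d} h l with φ d ≟ o
        ... | no ne = P-φ h l ne
        ... | yes e = trans (cong P e) (trans Po (cong not (sym (trans (cong P (trans (sym (νφ h)) (cong ν e))) Pν))))
        same-parity : ∀ {d d′} → al d ≡ true → lab d ≡ x → P d ≡ true → P d′ ≡ true → φ d ≢ d′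
        same-parity h l p p′ e = true≢false p′ (trans (cong P (sym e)) (trans (alt h l) (cong not p)))
        R : Ring M x o P
        R = record { ho = ho ; lo = refl ; Po = Po ; alt = alt
                   ; indep = λ h h′ he l l′ p p′ q q′ → indep⁻ h h′ l l′ p p′ (neighbours h h′ he l l′ q q′)
                   ; inj = λ h h′ l l′ _ _ q → tight₂ h h′ (trans l (sym l′)) q }
          where
          indep⁻ : ∀ {d d′} → al d ≡ true → al d′ ≡ true → lab d ≡ x → lab d′ ≡ x → P d ≡ true → P d′ ≡ true → φ d′ ≡ d ⊎ φ d ≡ d′ → ⊥
          indep⁻ h h′ l l′ p p′ (inj₁ e) = same-parity h′ l′ p′ p e
          indep⁻ h h′ l l′ p p′ (inj₂ e) = same-parity h l p p′ e
        digon : φ (φ o) ≢ o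
        digon e = thick (al-φ ho) (trans (cong lab (r³ (mate o))) (trans (lab-mate′ ho) (cong (λ y → lab (r y)) (sym e))))

      -- Contracting `t` joins the edges of `o` and `ν o`, so `x` gets even length with `ν o` as
      -- start. The corner `a` becomes the edge of `w`: requiring `lab (r a)` to be true suffices,
      -- as `lab (r (r a))` belongs to the merged false face. The elimination makes `x` true, which
      -- `Lifted` needs at the other end of `t`.
      odd : P (ν o) ≡ true → Sol M (lab a) (corner a) (corner b)
      odd Pν = by (eliminate-face (size M) IH C.rewired C.smaller C.smaller R (C.μB (trans (lab-r-ν ho) (cong (λ y → lab (r y)) ro))) {edge w} {corner b} on-w on-b away-w away-b⁻)
        where
        x-lab : ∀ l → μ l ≡ x → l ≡ x
        x-lab l e with merge-cases (lab (r t)) (lab t) l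
        ... | inj₁ (q , _) = trans (sym q) e
        ... | inj₂ (q , _) = ⊥-elim (x≢z (trans (sym e) q))
        w : Fin N
        w = mate (r a)
        lab-rw : lab (r w) ≡ lab (r a)
        lab-rw = lab-mate (al-rr ha)
        on-w : On C.rewired (lab t) (edge w)
        on-w = C.stub-alive⁻ (subst C.Stub rrs≡ C.stub-rrs) , C.μB (trans (lab-mate′ (al-rr ha)) (sym u≡))
        on-b : On C.rewired (lab t) (corner b)
        on-b = survives hb lb (λ e → a≢b (sym e)) (λ e → νa≢b (sym e)) , C.μA (trans lb (sym lt))
        away-w : Away C.rewired x (edge w)
        away-w e = x≢f (sym (trans (sym lab-rw) (x-lab (lab (r w)) e)))
        away-b⁻ : Away C.rewired x (corner b)
        away-b⁻ = (λ e → proj₁ away-b (x-lab (lab (r b)) e)) , λ e → proj₂ away-b (x-lab (lab (r (r b))) e)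
        m₁ : Fin N
        m₁ = ν o
        lm : lab m₁ ≡ x
        lm = lab-ν ho
        o≢ : ∀ {d} → C.al⁻ d ≡ true → d ≢ o
        o≢ h refl = C.¬dead h (inj₁ (inj₂ (inj₂ refl)))
        φo≢o : φ o ≢ o
        φo≢o e = loopless (al-rr ho) (trans (sym (lab-mate′ ho)) (cong lab (r-injective (trans e (sym (r³ o))))))
        alt⁻ : ∀ {d} → C.al⁻ d ≡ true → lab d ≡ x → P (r (C.mate⁻ d)) ≡ not (P d)
        alt⁻ {d} h l = go (C.dead? (mate d))
          where
          hd : al d ≡ true
          hd = C.alive h
          lab-m : ∀ {e} → mate d ≡ e → lab (r e) ≡ x
          lab-m refl = trans (lab-mate hd) l
          which : (mate d ≡ r t ⊎ mate d ≡ r (r t)) ⊎ (mate d ≡ r C.s ⊎ mate d ≡ r (r C.s)) → P (r (C.mate⁻ d)) ≡ not (P d)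
          which (inj₁ (inj₁ q)) = trans (cong (λ y → P (r y)) (trans (cong C.mate⁻ (mate-swap hd q)) (trans (C.mate⁻-stub C.stub-rt) (cong mate C.π-rt))))
            (trans (P-φ ho refl φo≢o) (cong not (trans Po (sym (trans (cong P (trans (mate-swap hd q) (sym νo))) Pν)))))
          which (inj₁ (inj₂ q)) = ⊥-elim (x≢z (trans (sym (lab-m q)) (cong lab (r³ t))))
          which (inj₂ (inj₁ q)) = ⊥-elim (x≢f (trans (sym (lab-m q)) (cong lab rrs≡)))
          which (inj₂ (inj₂ q)) = ⊥-elim (x≢u (trans (sym (lab-m q)) (trans (cong lab (r³ C.s)) C.lab-s)))
          go : Dec (C.Dead (mate d)) → P (r (C.mate⁻ d)) ≡ not (P d)
          go (yes y) = which (C.stub-cases (C.stub-mate hd (C.¬dead h) y))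
          go (no ¬y) = trans (cong (λ y → P (r y)) (C.mate⁻-keep ¬y)) (P-φ hd l λ e →
            ¬y (subst C.Dead (sym (trans (cong mate (trans (sym (νφ hd)) (trans (cong ν e) νo))) (mate-mate (al-rr ht)))) (proj₁ C.stub-rt)))
        -- Among the surviving darts of `x` only `m₁` has the merged face across; there the label
        -- may also stem from the face across the removed dart `o`.
        source : ∀ {d l} → C.al⁻ d ≡ true → lab d ≡ x → μ l ≡ μ (lab (r d)) → l ≡ lab (r d) ⊎ (d ≡ m₁ × l ≡ lab (r o))
        source {d} {l} h ld e with merge-≡ {l = l} e
        ... | inj₁ q = inj₁ q
        ... | inj₂ (inj₁ (_ , q)) = ⊥-elim (o≢ h (o-unique (C.alive h) ld q))
        ... | inj₂ (inj₂ (q , q′)) = inj₂ (νo-unique (C.alive h) ld q′ , trans q (cong lab (sym ro)))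
        clash : ∀ {d d′} → al d ≡ true → lab d ≡ x → P d ≡ true → P d′ ≡ true → d′ ≢ o → φ d ≢ d′
        clash h l p p′ ne e = true≢false p′ (trans (cong P (sym e)) (trans (P-φ h l (λ q → ne (trans (sym e) q))) (cong not p)))
        indep⁻ : ∀ {d d′ e} → C.al⁻ d ≡ true → C.al⁻ d′ ≡ true → C.al⁻ e ≡ true → lab d ≡ x → lab d′ ≡ x → P d ≡ true → P d′ ≡ true →
          C.lab⁻ e ≡ C.lab⁻ (r d) → C.lab⁻ (r e) ≢ C.lab⁻ (r d′)
        indep⁻ {d} {d′} {e} h h′ he l l′ p p′ q q′ = go (d ≟ d′) (source h l q) (source h′ l′ q′)
          where
          go : Dec (d ≡ d′) → lab e ≡ lab (r d) ⊎ (d ≡ m₁ × lab e ≡ lab (r o)) → lab (r e) ≡ lab (r d′) ⊎ (d′ ≡ m₁ × lab (r e) ≡ lab (r o)) → ⊥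
          go (yes refl) _ _ = C.loopless⁻ he (trans q (sym q′))
          go (no ne) (inj₁ s) (inj₁ s′) with neighbours (C.alive h) (C.alive h′) (C.alive he) l l′ s s′
          ... | inj₁ m = clash (C.alive h′) l′ p′ p (o≢ h) m
          ... | inj₂ m = clash (C.alive h) l p p′ (o≢ h′) m
          go (no ne) (inj₂ (refl , s)) (inj₁ s′) with neighbours ho (C.alive h′) (C.alive he) refl l′ s s′
          ... | inj₁ m = ne (sym (trans (sym (νφ (C.alive h′))) (cong ν m)))
          ... | inj₂ m = clash ho refl Po p′ (o≢ h′) m
          go (no ne) (inj₁ s) (inj₂ (refl , s′)) with neighbours (C.alive h) ho (C.alive he) l refl s s′
          ... | inj₁ m = clash ho refl Po p (o≢ h) m
          ... | inj₂ m = ne (trans (sym (νφ (C.alive h))) (cong ν m))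
          go (no ne) (inj₂ (e₁ , _)) (inj₂ (e₂ , _)) = ne (trans e₁ (sym e₂))
        inj⁻ : ∀ {d d′} → C.al⁻ d ≡ true → C.al⁻ d′ ≡ true → lab d ≡ x → lab d′ ≡ x → C.lab⁻ (r d) ≡ C.lab⁻ (r d′) → d ≡ d′
        inj⁻ h h′ l l′ q with source h′ l′ q
        ... | inj₁ s = tight₂ (C.alive h) (C.alive h′) (trans l (sym l′)) s
        ... | inj₂ (_ , s) = ⊥-elim (o≢ h (o-unique (C.alive h) l (trans s (cong lab ro))))
        R : Ring C.rewired x m₁ P
        R = record { ho = subst (λ y → C.al⁻ y ≡ true) (sym νo) (C.stub-alive⁻ C.stub-rt) ; lo = trans (cong μ lm) (merge-miss x≢u) ; Po = Pν
                   ; alt = λ {d} h l → alt⁻ h (x-lab (lab d) l)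
                   ; indep = λ {d} {d′} h h′ he l l′ p p′ q q′ → indep⁻ h h′ he (x-lab (lab d) l) (x-lab (lab d′) l′) p p′ q q′
                   ; inj = λ {d} {d′} h h′ l l′ _ _ q → inj⁻ h h′ (x-lab (lab d) l) (x-lab (lab d′) l′) q }
        by : ElimSol C.rewired x (lab t) (edge w) (corner b) → Sol M (lab a) (corner a) (corner b)
        by (sol c p cz f g (refl , q) rep lk , cx) = sol c⁺ proper⁺ c-z (lab (r a)) g rep-a (lift-rep (corner b) rep) (λ k te → trans (cong k (sym f≡)) (lift-linked lk k te))
          where
          cf : c (μ (lab (r a))) ≡ true
          cf = trans (cong (λ l → c (μ l)) (sym lab-rw)) q
          open Lifted {c} p cz (trans (cong c (merge-miss x≢u)) cx) cf
          f≡ : μ (lab (r w)) ≡ lab (r a)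
          f≡ = trans (fixed-merge {c = c} cz (lab (r w)) q) lab-rw

      far : Sol M (lab a) (corner a) (corner b)
      far = by (P (ν o)) refl
        where
        by : ∀ v → P (ν o) ≡ v → Sol M (lab a) (corner a) (corner b)
        by true  e = odd e
        by false e = even e

    -- Either terminal may play the part of `a` in `Far`. This fails from both ends only if each
    -- corner is two steps from the other, that is, on a face of length four.
    corners : ∀ {z a b} → On M z (corner a) → On M z (corner b) → Sol M z (corner a) (corner b)
    corners {z} {a} {b} (ha , refl) (hb , lb) = by (a ≟ b) (ν a ≟ b) (ν b ≟ a) (ν (ν a) ≟ b) (ν (ν b) ≟ a)
      where
      flip : Sol M (lab b) (corner b) (corner a) → Sol M (lab a) (corner a) (corner b)
      flip S = subst (λ l → Sol M l (corner a) (corner b)) lb (swap-sol M S)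
      by : Dec (a ≡ b) → Dec (ν a ≡ b) → Dec (ν b ≡ a) → Dec (ν (ν a) ≡ b) → Dec (ν (ν b) ≡ a) → Sol M (lab a) (corner a) (corner b)
      by (yes refl) _ _ _ _ = corner-self ha
      by (no _) (yes refl) _ _ _ = next ha
      by (no _) (no _) (yes refl) _ _ = flip (next hb)
      by (no p) (no q) (no q′) (no s) _ = Far.far ha hb lb p q s
      by (no p) (no q) (no q′) (yes _) (no s) = flip (Far.far hb ha (sym lb) (λ e → p (sym e)) q′ s)
      by (no p) (no q) (no q′) (yes s) (yes s′) = Opposite.opposite ha hb p q q′ s s′

    tight-solve : Solvable M
    tight-solve {z} {edge a}   {τ₂}       o₁ o₂ = edge-any {z} {a} {τ₂} o₁ o₂
    tight-solve {z} {corner a} {edge b}   o₁ o₂ = swap-sol M (edge-any {z} {b} {corner a} o₂ o₁)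
    tight-solve {z} {corner a} {corner b} o₁ o₂ = corners o₁ o₂

  -- Induction on the number of darts

  solvable-below : ∀ n M → size M < n → Solvable M
  solvable-below (suc n) M <n {z} {τ₁} {τ₂} o₁ o₂ = by₂ find₂
    where
    open Laws M using (al; mate; lab)
    IH : ∀ M′ → size M′ < size M → Solvable M′
    IH M′ lt = solvable-below n M′ (<-≤-trans lt (s≤s⁻¹ <n))
    find₂ : Dec (∃[ d ] ∃[ d′ ] (al d ≡ true × al d′ ≡ true × lab d ≡ lab d′ × lab (r d) ≡ lab (r d′) × d ≢ d′))
    find₂ = any? λ d → any? λ d′ → (al d 𝔹.≟ true) ×-dec (al d′ 𝔹.≟ true) ×-dec (lab d ≟ lab d′) ×-dec (lab (r d) ≟ lab (r d′)) ×-dec ¬? (d ≟ d′)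
    facial? : ∀ d₁ d₂ d₃ → Dec ((d₂ ≡ r d₁ × d₃ ≡ r d₂) ⊎ (mate d₁ ≡ r (mate d₂) × mate d₂ ≡ r (mate d₃)))
    facial? d₁ d₂ d₃ = ((d₂ ≟ r d₁) ×-dec (d₃ ≟ r d₂)) ⊎-dec ((mate d₁ ≟ r (mate d₂)) ×-dec (mate d₂ ≟ r (mate d₃)))
    find₃ : Dec (∃[ d₁ ] ∃[ d₂ ] ∃[ d₃ ] (al d₁ ≡ true × al d₂ ≡ true × al d₃ ≡ true × lab (r d₁) ≡ lab d₂ × lab (r d₂) ≡ lab d₃ × lab (r d₃) ≡ lab d₁ ×
              ¬ ((d₂ ≡ r d₁ × d₃ ≡ r d₂) ⊎ (mate d₁ ≡ r (mate d₂) × mate d₂ ≡ r (mate d₃)))))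
    find₃ = any? λ d₁ → any? λ d₂ → any? λ d₃ → (al d₁ 𝔹.≟ true) ×-dec (al d₂ 𝔹.≟ true) ×-dec (al d₃ 𝔹.≟ true) ×-dec
              (lab (r d₁) ≟ lab d₂) ×-dec (lab (r d₂) ≟ lab d₃) ×-dec (lab (r d₃) ≟ lab d₁) ×-dec ¬? (facial? d₁ d₂ d₃)
    thin? : Dec (∃[ p ] (al p ≡ true × lab (r (r p)) ≡ lab (r (r (mate p)))))
    thin? = any? λ p → (al p 𝔹.≟ true) ×-dec (lab (r (r p)) ≟ lab (r (r (mate p))))
    by₂ : Dec (∃[ d ] ∃[ d′ ] (al d ≡ true × al d′ ≡ true × lab d ≡ lab d′ × lab (r d) ≡ lab (r d′) × d ≢ d′)) → Sol M z τ₁ τ₂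
    by₂ (yes (d , d′ , h , h′ , l , l′ , ne)) = double-solve M h h′ ne l l′ IH {z} {τ₁} {τ₂} o₁ o₂
    by₂ (no none₂) = by₃ find₃
      where
      tight₂ : Tight₂ M
      tight₂ {d} {d′} h h′ l l′ with d ≟ d′
      ... | yes e = e
      ... | no ne = ⊥-elim (none₂ (d , d′ , h , h′ , l , l′ , ne))
      by₃ : Dec (∃[ d₁ ] ∃[ d₂ ] ∃[ d₃ ] (al d₁ ≡ true × al d₂ ≡ true × al d₃ ≡ true × lab (r d₁) ≡ lab d₂ × lab (r d₂) ≡ lab d₃ × lab (r d₃) ≡ lab d₁ ×
              ¬ ((d₂ ≡ r d₁ × d₃ ≡ r d₂) ⊎ (mate d₁ ≡ r (mate d₂) × mate d₂ ≡ r (mate d₃))))) → Sol M z τ₁ τ₂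
      by₃ (yes (d₁ , d₂ , d₃ , h₁ , h₂ , h₃ , l₁ , l₂ , l₃ , ne)) = triple-solve M h₁ h₂ h₃ l₁ l₂ l₃ (λ e → ne (inj₁ e)) (λ e → ne (inj₂ e)) IH {z} {τ₁} {τ₂} o₁ o₂
      by₃ (no none₃) = by-thin thin?
        where
        tight₃ : Tight₃ M
        tight₃ {d₁} {d₂} {d₃} h₁ h₂ h₃ l₁ l₂ l₃ with facial? d₁ d₂ d₃
        ... | yes e = e
        ... | no ne = ⊥-elim (none₃ (d₁ , d₂ , d₃ , h₁ , h₂ , h₃ , l₁ , l₂ , l₃ , ne))
        by-thin : Dec (∃[ p ] (al p ≡ true × lab (r (r p)) ≡ lab (r (r (mate p))))) → Sol M z τ₁ τ₂
        by-thin (yes (p , hp , thin)) = Theta.theta-solve M tight₂ hp thin {z} {τ₁} {τ₂} o₁ o₂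
        by-thin (no thick) = Corners.tight-solve M tight₂ tight₃ (λ hp e → thick (_ , hp , e)) IH {z} {τ₁} {τ₂} o₁ o₂

  solvable : ∀ M → Solvable M
  solvable M {z} {τ₁} {τ₂} = solvable-below (suc (size M)) M ≤-refl {z} {τ₁} {τ₂}

-- Counting darts

∑ : ∀ {n} → (Fin n → ℕ) → ℕ
∑ {zero}  w = 0
∑ {suc n} w = w zero + ∑ (λ i → w (suc i))

∑-cong : ∀ {n} {w w′ : Fin n → ℕ} → (∀ i → w i ≡ w′ i) → ∑ w ≡ ∑ w′
∑-cong {zero}  h = refl
∑-cong {suc n} h = cong₂ _+_ (h zero) (∑-cong (λ i → h (suc i)))

∑-zero : ∀ {n} {w : Fin n → ℕ} → (∀ i → w i ≡ 0) → ∑ w ≡ 0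
∑-zero {zero}  h = refl
∑-zero {suc n} h = cong₂ _+_ (h zero) (∑-zero (λ i → h (suc i)))

∑-zero⁻ : ∀ {n} (w : Fin n → ℕ) → ∑ w ≡ 0 → ∀ i → w i ≡ 0
∑-zero⁻ w e zero    = m+n≡0⇒m≡0 (w zero) e
∑-zero⁻ w e (suc i) = ∑-zero⁻ (λ i → w (suc i)) (m+n≡0⇒n≡0 (w zero) e) i

∑-+ : ∀ {n} (w w′ : Fin n → ℕ) → ∑ (λ i → w i + w′ i) ≡ ∑ w + ∑ w′
∑-+ {zero}  w w′ = refl
∑-+ {suc n} w w′ = trans (cong ((w zero + w′ zero) +_) (∑-+ (λ i → w (suc i)) (λ i → w′ (suc i)))) (swap (w zero) (w′ zero) _ _)
  where
  swap : ∀ a b c d → (a + b) + (c + d) ≡ (a + c) + (b + d)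
  swap a b c d = trans (+-assoc a b (c + d)) (trans (cong (a +_) (trans (sym (+-assoc b c d)) (trans (cong (_+ d) (+-comm b c)) (+-assoc c b d)))) (sym (+-assoc a c (b + d))))

∑-++ : ∀ k {l} (w : Fin (k + l) → ℕ) → ∑ w ≡ ∑ (λ i → w (i ↑ˡ l)) + ∑ (λ j → w (k ↑ʳ j))
∑-++ zero    w = refl
∑-++ (suc k) w = trans (cong (w zero +_) (∑-++ k (λ i → w (suc i)))) (sym (+-assoc (w zero) _ _))

∑-tabulate : ∀ {k} (w : Fin k → ℕ) → List.sum (map w (allFin k)) ≡ ∑ w
∑-tabulate w = trans (cong List.sum (map-tabulate id w)) (go w)
  where
  go : ∀ {k} (w : Fin k → ℕ) → List.sum (tabulate w) ≡ ∑ w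
  go {zero}  w = refl
  go {suc k} w = cong (w zero +_) (go (λ i → w (suc i)))

_off_ : ∀ {k} → (Fin k → ℕ) → Fin k → Fin k → ℕ
(w off p) i = if does (i ≟ p) then 0 else w i

off-hit : ∀ {k} (w : Fin k → ℕ) {p i} → i ≡ p → (w off p) i ≡ 0
off-hit w {p} {i} e with i ≟ p
... | yes _ = refl
... | no h  = ⊥-elim (h e)

off-miss : ∀ {k} (w : Fin k → ℕ) {p i} → i ≢ p → (w off p) i ≡ w i
off-miss w {p} {i} h with i ≟ p
... | yes e = ⊥-elim (h e)
... | no _  = refl

∑-off : ∀ {k} (w : Fin k → ℕ) p → ∑ w ≡ w p + ∑ (w off p)
∑-off {suc k} w zero = cong (w zero +_) (∑-cong {w = λ i → w (suc i)} {λ i → (w off zero) (suc i)} (λ i → sym (off-miss w {zero} {suc i} (λ ()))))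
∑-off {suc k} w (suc p) = trans (cong (w zero +_) (∑-off (λ i → w (suc i)) p)) (trans (swap (w zero) (w (suc p)) _)
    (cong (w (suc p) +_) (cong₂ _+_ (sym (off-miss w {suc p} {zero} (λ ()))) (∑-cong tails))))
  where
  swap : ∀ a b c → a + (b + c) ≡ b + (a + c)
  swap a b c = trans (sym (+-assoc a b c)) (trans (cong (_+ c) (+-comm a b)) (+-assoc b a c))
  tails : ∀ i → ((λ i → w (suc i)) off p) i ≡ (w off suc p) (suc i)
  tails i with i ≟ p
  ... | yes _ = refl
  ... | no _  = refl

∑-three : ∀ {k} (w : Fin k → ℕ) {a b c} → a ≢ b → a ≢ c → b ≢ c → (∀ i → i ≢ a → i ≢ b → i ≢ c → w i ≡ 0) → ∑ w ≡ w a + (w b + w c)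
∑-three w {a} {b} {c} a≢b a≢c b≢c none = begin
  ∑ w                                                     ≡⟨ ∑-off w a ⟩
  w a + ∑ (w off a)                                       ≡⟨ cong (w a +_) (∑-off (w off a) b) ⟩
  w a + ((w off a) b + ∑ ((w off a) off b))               ≡⟨ cong (λ q → w a + ((w off a) b + q)) (∑-off ((w off a) off b) c) ⟩
  w a + ((w off a) b + (((w off a) off b) c + ∑ (((w off a) off b) off c)))
    ≡⟨ cong₂ (λ q q′ → w a + (q + q′)) (off-miss w (λ e → a≢b (sym e))) (cong₂ _+_ (trans (off-miss (w off a) (λ e → b≢c (sym e))) (off-miss w (λ e → a≢c (sym e)))) (∑-zero rest)) ⟩
  w a + (w b + (w c + 0))                                 ≡⟨ cong (λ q → w a + (w b + q)) (+-identityʳ (w c)) ⟩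
  w a + (w b + w c)                                       ∎
  where
  open ≡-Reasoning
  rest : ∀ i → (((w off a) off b) off c) i ≡ 0
  rest i = by (i ≟ a) (i ≟ b) (i ≟ c)
    where
    by : Dec (i ≡ a) → Dec (i ≡ b) → Dec (i ≡ c) → (((w off a) off b) off c) i ≡ 0
    by _ _ (yes e) = off-hit ((w off a) off b) e
    by _ (yes e) (no ¬c) = trans (off-miss ((w off a) off b) ¬c) (off-hit (w off a) e)
    by (yes e) (no ¬b) (no ¬c) = trans (off-miss ((w off a) off b) ¬c) (trans (off-miss (w off a) ¬b) (off-hit w e))
    by (no ¬a) (no ¬b) (no ¬c) = trans (off-miss ((w off a) off b) ¬c) (trans (off-miss (w off a) ¬b) (trans (off-miss w ¬a) (none i ¬a ¬b ¬c)))

∑-positive : ∀ {k} (w : Fin k → ℕ) {j} → ∑ w ≡ suc j → ∃[ i ] w i ≢ 0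
∑-positive w e with any? (λ i → ¬? (w i ℕ.≟ 0))
... | yes found = found
... | no none = ⊥-elim (absurd (trans (sym e) (∑-zero zeros)))
  where
  absurd : ∀ {j} → ¬ (suc j ≡ 0)
  absurd ()
  zeros : ∀ i → w i ≡ 0
  zeros i with w i in q
  ... | zero  = refl
  ... | suc a = ⊥-elim (none (i , λ z → absurd (trans (sym q) z)))

bit : Bool → ℕ
bit true  = 1
bit false = 0

-- A transitive permutation of a three-element fibre is a 3-cycle.
module Fibres {k l : ℕ} (H : Fin k → Fin l) (ρ : Fin k → Fin k) (ρ-injective : ∀ {d d′} → ρ d ≡ ρ d′ → d ≡ d′)
  (H-ρ : ∀ d → H (ρ d) ≡ H d) (transitive : ∀ {d d′} → H d ≡ H d′ → (P : Fin k → Set) → (∀ {x} → P x → P (ρ x)) → P d → P d′)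
  (three : ∀ v → ∑ (λ d → bit ([ H d ]≟ v)) ≡ 3) where

  module _ (d : Fin k) where
    w₀ w₁ w₂ w₃ : Fin k → ℕ
    w₀ x = bit ([ H x ]≟ H d)
    w₁ = w₀ off d
    w₂ = w₁ off ρ d
    w₃ = w₂ off ρ (ρ d)

    one : ∀ {x} → H x ≡ H d → w₀ x ≡ 1
    one {x} e with H x ≟ H d
    ... | yes _ = refl
    ... | no h  = ⊥-elim (h e)

    H-of : ∀ {x} → w₀ x ≢ 0 → H d ≡ H x
    H-of {x} h with H x ≟ H d
    ... | yes e = sym e
    ... | no _  = ⊥-elim (h refl)

    s₁ : ∑ w₁ ≡ 2
    s₁ = suc-injective (trans (cong (_+ ∑ w₁) (sym (one refl))) (trans (sym (∑-off w₀ d)) (three (H d))))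

    -- If `ρ` fixed `d`, transitivity would make `d` the whole fibre, although weight is left
    -- outside `d`. The next inequality rests on the same argument.
    ρ≢ : ρ d ≢ d
    ρ≢ e with ∑-positive w₁ s₁
    ... | x , nz = nz (off-hit w₀ (transitive (H-of (λ z → nz (by z (x ≟ d)))) (_≡ d) (λ { refl → e }) refl))
      where
      by : w₀ x ≡ 0 → Dec (x ≡ d) → w₁ x ≡ 0
      by z (yes p) = off-hit w₀ p
      by z (no p)  = trans (off-miss w₀ p) z

    s₂ : ∑ w₂ ≡ 1
    s₂ = suc-injective (trans (cong (_+ ∑ w₂) (sym (trans (off-miss w₀ ρ≢) (one (H-ρ d))))) (trans (sym (∑-off w₁ (ρ d))) s₁))

    ρρ≢ : ρ (ρ d) ≢ d
    ρρ≢ e with ∑-positive w₂ s₂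
    ... | x , nz = nz (by (transitive (H-of (λ z → nz (by′ z (x ≟ d) (x ≟ ρ d)))) (λ x → x ≡ d ⊎ x ≡ ρ d) (λ { (inj₁ refl) → inj₂ refl ; (inj₂ refl) → inj₁ e }) (inj₁ refl)))
      where
      by′ : w₀ x ≡ 0 → Dec (x ≡ d) → Dec (x ≡ ρ d) → w₂ x ≡ 0
      by′ z _ (yes q) = off-hit w₁ q
      by′ z (yes p) (no q) = trans (off-miss w₁ q) (off-hit w₀ p)
      by′ z (no p) (no q) = trans (off-miss w₁ q) (trans (off-miss w₀ p) z)
      by : x ≡ d ⊎ x ≡ ρ d → w₂ x ≡ 0
      by (inj₂ q) = off-hit w₁ q
      by (inj₁ p) = by″ (x ≟ ρ d)
        where
        by″ : Dec (x ≡ ρ d) → w₂ x ≡ 0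
        by″ (yes q) = off-hit w₁ q
        by″ (no q) = trans (off-miss w₁ q) (off-hit w₀ p)

    ρρ≢ρ : ρ (ρ d) ≢ ρ d
    ρρ≢ρ e = ρ≢ (ρ-injective e)

    s₃ : ∑ w₃ ≡ 0
    s₃ = suc-injective (trans (cong (_+ ∑ w₃) (sym (trans (off-miss w₁ ρρ≢ρ) (trans (off-miss w₀ ρρ≢) (one (trans (H-ρ (ρ d)) (H-ρ d))))))) (trans (sym (∑-off w₂ (ρ (ρ d)))) s₂))

    fibre : ∀ {x} → H x ≡ H d → x ≡ d ⊎ x ≡ ρ d ⊎ x ≡ ρ (ρ d)
    fibre {x} e = by (x ≟ d) (x ≟ ρ d) (x ≟ ρ (ρ d))
      where
      absurd : ¬ (1 ≡ 0)
      absurd ()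
      by : Dec (x ≡ d) → Dec (x ≡ ρ d) → Dec (x ≡ ρ (ρ d)) → x ≡ d ⊎ x ≡ ρ d ⊎ x ≡ ρ (ρ d)
      by (yes p) _ _ = inj₁ p
      by _ (yes p) _ = inj₂ (inj₁ p)
      by _ _ (yes p) = inj₂ (inj₂ p)
      by (no p) (no p′) (no p″) = ⊥-elim (absurd (trans (sym (one e)) (trans (sym (trans (off-miss w₂ p″) (trans (off-miss w₁ p′) (off-miss w₀ p)))) (∑-zero⁻ w₃ s₃ x))))

  ρ³ : ∀ d → ρ (ρ (ρ d)) ≡ d
  ρ³ d with fibre d (trans (H-ρ (ρ (ρ d))) (trans (H-ρ (ρ d)) (H-ρ d)))
  ... | inj₁ e = e
  ... | inj₂ (inj₁ e) = ⊥-elim (ρρ≢ d (ρ-injective e))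
  ... | inj₂ (inj₂ e) = ⊥-elim (ρ≢ d (ρ-injective (ρ-injective e)))

  inhabited : ∀ v → ∃[ d ] H d ≡ v
  inhabited v with ∑-positive (λ d → bit ([ H d ]≟ v)) (three v)
  ... | d , nz with H d ≟ v
  ... | yes e = d , e
  ... | no _  = ⊥-elim (nz refl)

  ∑-fibre : ∀ (g : Fin k → ℕ) d → ∑ (λ x → bit ([ H x ]≟ H d) * g x) ≡ g d + (g (ρ d) + g (ρ (ρ d)))
  ∑-fibre g d = trans (∑-three (λ x → bit ([ H x ]≟ H d) * g x) (λ e → ρ≢ d (sym e)) (λ e → ρρ≢ d (sym e)) (λ e → ρρ≢ρ d (sym e)) none)
      (cong₂ _+_ (val refl) (cong₂ _+_ (val (H-ρ d)) (val (trans (H-ρ (ρ d)) (H-ρ d)))))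
    where
    val : ∀ {x} → H x ≡ H d → bit ([ H x ]≟ H d) * g x ≡ g x
    val {x} e = trans (cong (_* g x) (one d e)) (+-identityʳ (g x))
    none : ∀ x → x ≢ d → x ≢ ρ d → x ≢ ρ (ρ d) → bit ([ H x ]≟ H d) * g x ≡ 0
    none x p p′ p″ with H x ≟ H d
    ... | no _ = refl
    ... | yes e with fibre d e
    ... | inj₁ q = ⊥-elim (p q)
    ... | inj₂ (inj₁ q) = ⊥-elim (p′ q)
    ... | inj₂ (inj₂ q) = ⊥-elim (p″ q)

  sum-fibre : ∀ (g : Fin k → Bool) d → sum (λ x → [ H x ]≟ H d ∧ g x) ≡ g d xor (g (ρ d) xor g (ρ (ρ d)))
  sum-fibre g d = begin
    sum (λ x → [ H x ]≟ H d ∧ g x)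
      ≡⟨ sum-cong-≗ (λ x → trans (cong (_∧ g x) (indicator x)) (trans (𝔹.∧-distribʳ-xor (g x) ([ d ]≟ x) _) (cong (([ d ]≟ x ∧ g x) xor_) (𝔹.∧-distribʳ-xor (g x) ([ ρ d ]≟ x) _)))) ⟩
    sum (λ x → ([ d ]≟ x ∧ g x) xor (([ ρ d ]≟ x ∧ g x) xor ([ ρ (ρ d) ]≟ x ∧ g x)))
      ≡⟨ trans (∑-distrib-+ _ _) (cong₂ _xor_ (sum-single d g) (trans (∑-distrib-+ _ _) (cong₂ _xor_ (sum-single (ρ d) g) (sum-single (ρ (ρ d)) g)))) ⟩
    g d xor (g (ρ d) xor g (ρ (ρ d))) ∎
    where
    open ≡-Reasoning
    indicator : ∀ x → [ H x ]≟ H d ≡ [ d ]≟ x xor ([ ρ d ]≟ x xor [ ρ (ρ d) ]≟ x)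
    indicator x with H x ≟ H d | d ≟ x | ρ d ≟ x | ρ (ρ d) ≟ x
    ... | yes _ | yes _ | no _ | no _ = refl
    ... | yes _ | no _ | yes _ | no _ = refl
    ... | yes _ | no _ | no _ | yes _ = refl
    ... | no _  | no _ | no _ | no _ = refl
    ... | _ | yes p | yes q | _ = ⊥-elim (ρ≢ d (trans q (sym p)))
    ... | _ | yes p | no _ | yes q = ⊥-elim (ρρ≢ d (trans q (sym p)))
    ... | _ | no _ | yes p | yes q = ⊥-elim (ρρ≢ρ d (trans q (sym p)))
    ... | no h | yes refl | no _ | no _ = ⊥-elim (h refl)
    ... | no h | no _ | yes refl | no _ = ⊥-elim (h (H-ρ d))
    ... | no h | no _ | no _ | yes refl = ⊥-elim (h (trans (H-ρ (ρ d)) (H-ρ d)))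
    ... | yes e | no p | no p′ | no p″ with fibre d e
    ... | inj₁ q = ⊥-elim (p (sym q))
    ... | inj₂ (inj₁ q) = ⊥-elim (p′ (sym q))
    ... | inj₂ (inj₂ q) = ⊥-elim (p″ (sym q))

open import Defs


-- Every even subgraph of a connected map on the sphere is a boundary: by Euler's formula there are
-- fewer independent edge conditions than faces, hence a non-trivial combination of the even subgraph
-- with face boundaries vanishes.
euler-cyc : ∀ {n f m} (h₁ h₂ : Fin m → Fin n) (l₁ l₂ : Fin m → Fin f) → Fin n → Fin f → n + f ≡ m + 2 →
  (∀ (s : Fin n → Bool) → (∀ e → s (h₁ e) ≡ s (h₂ e)) → ∀ v v′ → s v ≡ s v′) →
  (∀ (c : Fin f → Bool) → (∀ e → c (l₁ e) ≡ c (l₂ e)) → ∀ l l′ → c l ≡ c l′) →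
  (∀ v l → sum (λ e → ([ h₁ e ]≟ v xor [ h₂ e ]≟ v) ∧ ([ l₁ e ]≟ l xor [ l₂ e ]≟ l)) ≡ false) →
  (F : Fin m → Bool) → (∀ v → sum (λ e → ([ h₁ e ]≟ v xor [ h₂ e ]≟ v) ∧ F e) ≡ false) →
  Σ (Fin f → Bool) λ c → ∀ e → F e ≡ c (l₁ e) xor c (l₂ e)
euler-cyc {suc n} {suc f} {m} h₁ h₂ l₁ l₂ _ _ euler conn dual faces F even =
    by (kernel′ n bound a y null indep)
  where
  bound : m < suc f + n
  bound = ≤-reflexive (suc-injective (sym (trans (trans (cong (λ q → suc (suc q)) (+-comm f n)) (sym (cong suc (+-suc n f)))) (trans euler (+-comm m 2)))))
  -- Column zero is `F`, the others are the faces except face zero, and the left-null vectors `y`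
  -- are the vertex stars except that of vertex zero. Euler's formula then reads `n + f ≡ m`, so the
  -- column for `F` is exactly the one in excess.
  a : Fin m → Fin (suc f) → Bool
  a e zero    = F e
  a e (suc j) = [ l₁ e ]≟ suc j xor [ l₂ e ]≟ suc j
  y : Fin n → Fin m → Bool
  y i e = [ h₁ e ]≟ suc i xor [ h₂ e ]≟ suc i
  null : ∀ i j → sum (λ e → y i e ∧ a e j) ≡ false
  null i zero    = even (suc i)
  null i (suc j) = faces (suc i) (suc j)
  pad : ∀ {k} → (Fin k → Bool) → Fin (suc k) → Bool
  pad s zero    = false
  pad s (suc i) = s i
  sum-pad : ∀ {k} (s : Fin k → Bool) v → sum (λ i → [ v ]≟ suc i ∧ s i) ≡ pad s v
  sum-pad s v = trans (sym (trans (sum-suc (λ i → [ v ]≟ i ∧ pad s i)) (cong (_xor sum (λ i → [ v ]≟ suc i ∧ s i)) (𝔹.∧-zeroʳ ([ v ]≟ zero))))) (sum-single v (pad s))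
  sum-pad₂ : ∀ {k} (s : Fin k → Bool) v v′ → sum (λ i → ([ v ]≟ suc i xor [ v′ ]≟ suc i) ∧ s i) ≡ pad s v xor pad s v′
  sum-pad₂ s v v′ = trans (sum-cong-≗ (λ i → 𝔹.∧-distribʳ-xor (s i) ([ v ]≟ suc i) _)) (trans (∑-distrib-+ _ _) (cong₂ _xor_ (sum-pad s v) (sum-pad s v′)))
  indep : ∀ (s : Fin n → Bool) → (∀ e → sum (λ i → s i ∧ y i e) ≡ false) → ∀ i → s i ≡ false
  indep s hs i = conn (pad s) (λ e → xor-cancel (trans (sym (sum-pad₂ s (h₁ e) (h₂ e))) (trans (sum-∧-comm (λ i → y i e) s) (hs e)))) (suc i) zero
  by : (Σ (Fin (suc f) → Bool) λ x → (∃[ j ] x j ≡ true) × (∀ e → sum (λ j → a e j ∧ x j) ≡ false)) → Σ (Fin (suc f) → Bool) λ c → ∀ e → F e ≡ c (l₁ e) xor c (l₂ e)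
  by (x , (j , xj) , rows) = split (x zero) refl
    where
    c : Fin (suc f) → Bool
    c = pad (λ j → x (suc j))
    row : ∀ e → F e ∧ x zero ≡ c (l₁ e) xor c (l₂ e)
    row e = xor-cancel (trans (cong ((F e ∧ x zero) xor_) (sym (sum-pad₂ (λ j → x (suc j)) (l₁ e) (l₂ e)))) (trans (sym (sum-suc (λ j → a e j ∧ x j))) (rows e)))
    split : ∀ η → x zero ≡ η → Σ (Fin (suc f) → Bool) λ c → ∀ e → F e ≡ c (l₁ e) xor c (l₂ e)
    split true  q = c , λ e → trans (sym (𝔹.∧-identityʳ (F e))) (trans (cong (F e ∧_) (sym q)) (row e))
    -- A relation without `F` forces `c` to be constant by `dual`; as `c` is false on the omitted
    -- face zero, the whole relation would be trivial.
    split false q = ⊥-elim (vanish j xj)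
      where
      const : ∀ l → c l ≡ false
      const l = dual c (λ e → xor-cancel (trans (sym (row e)) (trans (cong (F e ∧_) q) (𝔹.∧-zeroʳ (F e))))) l zero
      vanish : ∀ j → x j ≡ true → ⊥
      vanish zero    p = true≢false p q
      vanish (suc j) p = true≢false p (const (suc j))

-- Deciding reachability, one edge at a time

module _ (G : Graph) where

  reach-trans : ∀ {P : Edge G → Set} {u v w} → Reach G P u v → Reach G P v w → Reach G P u w
  reach-trans here q = q
  reach-trans (step e p j q) q′ = step e p j (reach-trans q q′)

  reach-map : ∀ {P Q : Edge G → Set} → (∀ {e} → P e → Q e) → ∀ {u v} → Reach G P u v → Reach G Q u v
  reach-map f here = here
  reach-map f (step e p j q) = step e (f p) j (reach-map f q)

  reach-inv : ∀ {P : Edge G → Set} (X : Vertex G → Bool) → (∀ e → P e → X (proj₁ (ends G e)) ≡ X (proj₂ (ends G e))) → ∀ {u v} → Reach G P u v → X u ≡ X v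
  reach-inv X inv here = refl
  reach-inv X inv (step e p (inj₁ q) rest) = trans (trans (cong X (sym (cong proj₁ q))) (trans (inv e p) (cong X (cong proj₂ q)))) (reach-inv X inv rest)
  reach-inv X inv (step e p (inj₂ q) rest) = trans (trans (cong X (sym (cong proj₂ q))) (trans (sym (inv e p)) (cong X (cong proj₁ q)))) (reach-inv X inv rest)

  module _ {P : Edge G → Set} (P? : ∀ e → Dec (P e)) where

    Below : ℕ → Edge G → Set
    Below k e = P e × toℕ e < k

    below-suc : ∀ {k e} → Below k e → Below (suc k) e
    below-suc (p , q) = p , m<n⇒m<1+n q

    -- Only the part of a walk before its first use of `e` and the part after its last use matter;
    -- what lies between is replaced by one passage through `e` or by none.
    last-edge : ∀ {k} (e : Edge G) → toℕ e ≡ k → ∀ {u v} → Reach G (Below (suc k)) u v →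
      let p = proj₁ (ends G e) ; q = proj₂ (ends G e) ; R = Reach G (Below k) in R u v ⊎ (R u p × R q v ⊎ R u q × R p v)
    last-edge e k≡ here = inj₁ here
    last-edge {k} e k≡ {u} {v} (step e′ (pe , lt) j rest) with <-cmp (toℕ e′) k | last-edge e k≡ rest
    ... | tri> _ _ gt | _ = ⊥-elim (<-irrefl refl (ℕ.<-≤-trans gt (s≤s⁻¹ lt)))
    ... | tri< l _ _ | inj₁ q = inj₁ (step e′ (pe , l) j q)
    ... | tri< l _ _ | inj₂ (inj₁ (q , q′)) = inj₂ (inj₁ (step e′ (pe , l) j q , q′))
    ... | tri< l _ _ | inj₂ (inj₂ (q , q′)) = inj₂ (inj₂ (step e′ (pe , l) j q , q′))
    ... | tri≈ _ eq _ | R with toℕ-injective (trans eq (sym k≡))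
    ... | refl = by j R
      where
      p q : Vertex G
      p = proj₁ (ends G e)
      q = proj₂ (ends G e)
      S : Vertex G → Vertex G → Set
      S = Reach G (Below k)
      by : ∀ {w} → Joins G e u w → S w v ⊎ (S w p × S q v ⊎ S w q × S p v) → S u v ⊎ (S u p × S q v ⊎ S u q × S p v)
      by (inj₁ refl) (inj₁ z)              = inj₂ (inj₁ (here , z))
      by (inj₁ refl) (inj₂ (inj₁ (_ , z))) = inj₂ (inj₁ (here , z))
      by (inj₁ refl) (inj₂ (inj₂ (_ , z))) = inj₁ z
      by (inj₂ refl) (inj₁ z)              = inj₂ (inj₂ (here , z))
      by (inj₂ refl) (inj₂ (inj₁ (_ , z))) = inj₁ z
      by (inj₂ refl) (inj₂ (inj₂ (_ , z))) = inj₂ (inj₂ (here , z))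

    reach-below? : ∀ k → k ≤ m G → ∀ u v → Dec (Reach G (Below k) u v)
    reach-below? zero _ u v with u ≟ v
    ... | yes refl = yes here
    ... | no ne = no λ { here → ne refl ; (step _ (_ , ()) _ _) }
    reach-below? (suc k) k<m u v with P? (fromℕ< k<m)
    ... | no ¬p with reach-below? k (ℕ.<⇒≤ k<m) u v
    ... | yes R = yes (reach-map below-suc R)
    ... | no ¬R = no λ R → ¬R (reach-map strict R)
      where
      strict : ∀ {e} → Below (suc k) e → Below k e
      strict {e} (p , lt) with <-cmp (toℕ e) k
      ... | tri< l _ _ = p , l
      ... | tri> _ _ gt = ⊥-elim (<-irrefl refl (ℕ.<-≤-trans gt (s≤s⁻¹ lt)))
      ... | tri≈ _ eq _ = ⊥-elim (¬p (subst P (toℕ-injective (trans eq (sym (toℕ-fromℕ< k<m)))) p))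
    reach-below? (suc k) k<m u v | yes pe = by (R? u v) (R? u p ×-dec R? q v) (R? u q ×-dec R? p v)
      where
      e : Edge G
      e = fromℕ< k<m
      p q : Vertex G
      p = proj₁ (ends G e)
      q = proj₂ (ends G e)
      R? : ∀ u v → Dec (Reach G (Below k) u v)
      R? = reach-below? k (ℕ.<⇒≤ k<m)
      here-e : Below (suc k) e
      here-e = pe , subst (_< suc k) (sym (toℕ-fromℕ< k<m)) (n<1+n k)
      by : Dec (Reach G (Below k) u v) → Dec (Reach G (Below k) u p × Reach G (Below k) q v) → Dec (Reach G (Below k) u q × Reach G (Below k) p v) → Dec (Reach G (Below (suc k)) u v)
      by (yes R) _ _ = yes (reach-map below-suc R)
      by _ (yes (R , R′)) _ = yes (reach-trans (reach-map below-suc R) (step e here-e (inj₁ refl) (reach-map below-suc R′)))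
      by _ _ (yes (R , R′)) = yes (reach-trans (reach-map below-suc R) (step e here-e (inj₂ refl) (reach-map below-suc R′)))
      by (no ¬R) (no ¬R′) (no ¬R″) = no λ R → none (last-edge e (toℕ-fromℕ< k<m) R)
        where
        none : ¬ (Reach G (Below k) u v ⊎ (Reach G (Below k) u p × Reach G (Below k) q v ⊎ Reach G (Below k) u q × Reach G (Below k) p v))
        none (inj₁ R) = ¬R R
        none (inj₂ (inj₁ R)) = ¬R′ R
        none (inj₂ (inj₂ R)) = ¬R″ R

    reach? : ∀ u v → Dec (Reach G P u v)
    reach? u v with reach-below? (m G) ℕ.≤-refl u v
    ... | yes R = yes (reach-map proj₁ R)
    ... | no ¬R = no λ R → ¬R (reach-map (λ {e} p → p , toℕ<n e) R)

-- From plane graphs to maps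

module Embedding (G : Graph) (connected : Connected G) (bridgeless : ∀ e → ConnectedWithout G (λ e′ → e′ ≡ e)) (cubic : Cubic G)
  (σ : Dart G ↔ Dart G) (rotation : IsRotation G σ) {f : ℕ} (orbits : HasOrbitCount G (λ d → Inverse.to σ (flip G d)) f) (euler : n G + f ≡ m G + 2) where

  open Inverse σ using (to)

  N : ℕ
  N = m G + m G

  enc : Dart G → Fin N
  enc (e , true)  = e ↑ˡ m G
  enc (e , false) = m G ↑ʳ e

  opaque
    dec : Fin N → Dart G
    dec i = [ (λ e → e , true) , (λ e → e , false) ]′ (splitAt (m G) i)

    dec-enc : ∀ d → dec (enc d) ≡ d
    dec-enc (e , true)  = cong [ (λ e → e , true) , (λ e → e , false) ]′ (splitAt-↑ˡ (m G) e (m G))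
    dec-enc (e , false) = cong [ (λ e → e , true) , (λ e → e , false) ]′ (splitAt-↑ʳ (m G) (m G) e)

    enc-dec : ∀ i → enc (dec i) ≡ i
    enc-dec i with splitAt (m G) i in q
    ... | inj₁ e = trans (sym (cong [ (_↑ˡ m G) , (m G ↑ʳ_) ]′ q)) (join-splitAt (m G) (m G) i)
    ... | inj₂ e = trans (sym (cong [ (_↑ˡ m G) , (m G ↑ʳ_) ]′ q)) (join-splitAt (m G) (m G) i)

  r mate : Fin N → Fin N
  r i = enc (to (dec i))
  mate i = enc (flip G (dec i))

  H : Fin N → Vertex G
  H i = head G (dec i)

  lab : Fin N → Fin f
  lab i = proj₁ orbits (dec i)

  edgeOf : Fin N → Edge G
  edgeOf i = proj₁ (dec i)

  dart-cases : (P : Fin N → Set) → (∀ e → P (enc (e , true))) → (∀ e → P (enc (e , false))) → ∀ i → P i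
  dart-cases P a b i = subst P (enc-dec i) (by (dec i))
    where
    by : ∀ d → P (enc d)
    by (e , true)  = a e
    by (e , false) = b e

  mate-true : ∀ e → mate (enc (e , true)) ≡ enc (e , false)
  mate-true e = cong (λ d → enc (flip G d)) (dec-enc (e , true))

  mate-false : ∀ e → mate (enc (e , false)) ≡ enc (e , true)
  mate-false e = cong (λ d → enc (flip G d)) (dec-enc (e , false))

  mate-mate : ∀ i → mate (mate i) ≡ i
  mate-mate = dart-cases _ (λ e → trans (cong mate (mate-true e)) (mate-false e)) (λ e → trans (cong mate (mate-false e)) (mate-true e))

  edge-mate : ∀ i → edgeOf (mate i) ≡ edgeOf i
  edge-mate i = cong proj₁ (dec-enc (flip G (dec i)))

  H-r : ∀ i → H (r i) ≡ H i
  H-r i = trans (cong (head G) (dec-enc (to (dec i)))) (proj₁ rotation (dec i))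

  r-injective : ∀ {i j} → r i ≡ r j → i ≡ j
  r-injective {i} {j} e = trans (sym (enc-dec i)) (trans (cong enc (trans (sym (Inverse.strictlyInverseʳ σ (dec i)))
    (trans (cong (Inverse.from σ) (trans (sym (dec-enc (to (dec i)))) (trans (cong dec e) (dec-enc (to (dec j)))))) (Inverse.strictlyInverseʳ σ (dec j))))) (enc-dec j))

  transitive : ∀ {i j} → H i ≡ H j → (P : Fin N → Set) → (∀ {x} → P x → P (r x)) → P i → P j
  transitive {i} {j} e P P-r p = let k , q = proj₂ rotation (dec i) (dec j) e in subst P (trans (cong enc q) (enc-dec j)) (go k)
    where
    go : ∀ k → P (enc (iter G to k (dec i)))
    go zero    = subst P (sym (enc-dec i)) p
    go (suc k) = subst P (cong (λ d → enc (to d)) (dec-enc (iter G to k (dec i)))) (P-r (go k))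

  -- The summand of `degreeIn` is built from local functions that cannot be named here, so the
  -- left-hand side of `incidence` is left to be inferred from its use in `degree-list`.
  mutual
    degree-list : ∀ S v → degreeIn G S v ≡ List.sum (map (λ e → bit ([ head G (e , true) ]≟ v) * bit (S e) + bit ([ head G (e , false) ]≟ v) * bit (S e)) (allFin (m G)))
    degree-list S v = cong List.sum (map-cong (incidence S v) (allFin (m G)))

    incidence : ∀ S v e → _ ≡ bit ([ head G (e , true) ]≟ v) * bit (S e) + bit ([ head G (e , false) ]≟ v) * bit (S e)
    incidence S v e with S e | proj₁ (ends G e) ≟ v | proj₂ (ends G e) ≟ v
    ... | true  | yes _ | yes _ = refl
    ... | true  | yes _ | no _  = refl
    ... | true  | no _  | yes _ = refl
    ... | true  | no _  | no _  = refl
    ... | false | yes _ | yes _ = refl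
    ... | false | yes _ | no _  = refl
    ... | false | no _  | yes _ = refl
    ... | false | no _  | no _  = refl

  degree-darts : ∀ S v → degreeIn G S v ≡ ∑ (λ i → bit ([ H i ]≟ v) * bit (S (edgeOf i)))
  degree-darts S v = trans (degree-list S v) (trans (∑-tabulate (λ e → at (e , true) + at (e , false))) (trans (∑-+ (λ e → at (e , true)) (λ e → at (e , false)))
      (sym (trans (∑-++ (m G) (λ i → at (dec i))) (cong₂ _+_ (∑-cong (λ e → cong at (dec-enc (e , true)))) (∑-cong (λ e → cong at (dec-enc (e , false)))))))))
    where
    at : Dart G → ℕ
    at d = bit ([ head G d ]≟ v) * bit (S (proj₁ d))

  three : ∀ v → ∑ (λ i → bit ([ H i ]≟ v)) ≡ 3
  three v = trans (∑-cong (λ i → sym (*-identityʳ (bit ([ H i ]≟ v))))) (trans (sym (degree-darts (λ _ → true) v)) (cubic v))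

  open Fibres H r r-injective H-r transitive three using (ρ³; inhabited; ∑-fibre; sum-fibre)
  open Maps {N} {f} r ρ³ using (Map; does-refl; does-false; sum-++; Mixed; odd-one-out; Bridged; bridged; Double; module Double; double; edge-solvable; contract-solve; solvable)

  lab-mate : ∀ i → lab (r (mate i)) ≡ lab i
  lab-mate i = trans (cong (proj₁ orbits) (trans (dec-enc (to (dec (mate i)))) (cong to (dec-enc (flip G (dec i))))))
    (sym (proj₂ (proj₂ (proj₂ orbits)) (dec i) _ (1 , refl)))

  lab-mate′ : ∀ i → lab (mate i) ≡ lab (r i)
  lab-mate′ i = trans (sym (lab-mate (mate i))) (cong (λ x → lab (r x)) (mate-mate i))

  at-vertex : ∀ (X : Fin N → Bool) → (∀ i → X (r i) ≡ X i) → ∀ {i j} → H i ≡ H j → X i ≡ X j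
  at-vertex X X-r {i} {j} e = transitive e (λ x → X i ≡ X x) (λ {x} p → trans p (sym (X-r x))) refl

  onVertices : (Fin N → Bool) → Vertex G → Bool
  onVertices X v = X (proj₁ (inhabited v))

  onVertices-H : ∀ X → (∀ i → X (r i) ≡ X i) → ∀ i → onVertices X (H i) ≡ X i
  onVertices-H X X-r i = at-vertex X X-r (proj₂ (inhabited (H i)))

  onVertices-head : ∀ X → (∀ i → X (r i) ≡ X i) → ∀ d → onVertices X (head G d) ≡ X (enc d)
  onVertices-head X X-r d = trans (cong (λ x → onVertices X (head G x)) (sym (dec-enc d))) (onVertices-H X X-r (enc d))

  conn : ∀ (X : Fin N → Bool) → (∀ i → X (r i) ≡ X i) → (∀ i → X (mate i) ≡ X i) → ∀ i j → X i ≡ X j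
  conn X X-r X-mate i j = trans (sym (onVertices-H X X-r i)) (trans (reach-inv G (onVertices X) (λ e _ → across e) (connected (H i) (H j))) (onVertices-H X X-r j))
    where
    across : ∀ e → onVertices X (head G (e , true)) ≡ onVertices X (head G (e , false))
    across e = trans (onVertices-head X X-r (e , true)) (trans (sym (X-mate _)) (trans (cong X (mate-true e)) (sym (onVertices-head X X-r (e , false)))))

  boundary : (Edge G → Bool) → Vertex G → Bool
  boundary F v = sum (λ e → ([ head G (e , true) ]≟ v xor [ head G (e , false) ]≟ v) ∧ F e)

  boundary-darts : ∀ (g : Fin N → Bool) → (∀ i → g (mate i) ≡ g i) → ∀ v → boundary (λ e → g (enc (e , true))) v ≡ sum (λ i → [ H i ]≟ v ∧ g i)
  boundary-darts g g-mate v = trans (sum-cong-≗ (λ e → 𝔹.∧-distribʳ-xor (g (enc (e , true))) ([ head G (e , true) ]≟ v) ([ head G (e , false) ]≟ v))) (trans (∑-distrib-+ _ _) (sym (trans (sum-++ (m G) _) (cong₂ _xor_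
    (sum-cong-≗ (λ e → cong (λ d → [ head G d ]≟ v ∧ g (enc (e , true))) (dec-enc (e , true))))
    (sum-cong-≗ (λ e → cong₂ (λ d b → [ head G d ]≟ v ∧ b) (dec-enc (e , false)) (trans (cong g (sym (mate-true e))) (g-mate _))))))))

  boundary-even : ∀ (g : Fin N → Bool) → (∀ i → g (mate i) ≡ g i) → (∀ i → g i xor (g (r i) xor g (r (r i))) ≡ false) → ∀ v → boundary (λ e → g (enc (e , true))) v ≡ false
  boundary-even g g-mate even v = let d , e = inhabited v in
    trans (boundary-darts g g-mate v) (trans (cong (λ v → sum (λ i → [ H i ]≟ v ∧ g i)) (sym e)) (trans (sum-fibre g d) (even d)))

  even-boundary : ∀ (g : Fin N → Bool) → (∀ i → g (mate i) ≡ g i) → (∀ v → boundary (λ e → g (enc (e , true))) v ≡ false) → ∀ i → g i xor (g (r i) xor g (r (r i))) ≡ false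
  even-boundary g g-mate zero-b i = trans (sym (sum-fibre g i)) (trans (sym (boundary-darts g g-mate (H i))) (zero-b (H i)))

  cyc : Edge G → ∀ (F : Fin N → Bool) → (∀ i → F (mate i) ≡ F i) → (∀ i → F i xor (F (r i) xor F (r (r i))) ≡ false) →
    Σ (Fin f → Bool) λ c → ∀ i → F i ≡ c (lab i) xor c (lab (r i))
  cyc e₀ F F-mate F-even = c , dart-cases (λ i → F i ≡ c (lab i) xor c (lab (r i))) (proj₂ E) opposite
    where
    l₁ l₂ : Edge G → Fin f
    l₁ e = lab (enc (e , true))
    l₂ e = lab (r (enc (e , true)))
    dual : ∀ (c : Fin f → Bool) → (∀ e → c (l₁ e) ≡ c (l₂ e)) → ∀ l l′ → c l ≡ c l′
    dual c h l l′ = let d , p = proj₁ (proj₂ orbits) l ; d′ , p′ = proj₁ (proj₂ orbits) l′ in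
        trans (cong c (trans (sym p) (cong (proj₁ orbits) (sym (dec-enc d))))) (trans (conn (λ i → c (lab i)) c-r c-mate (enc d) (enc d′)) (cong c (trans (cong (proj₁ orbits) (dec-enc d′)) p′)))
      where
      c-r : ∀ i → c (lab (r i)) ≡ c (lab i)
      c-r = dart-cases _ (λ e → sym (h e)) (λ e → trans (cong c (trans (cong (λ x → lab (r x)) (sym (mate-true e))) (lab-mate _)))
              (trans (h e) (cong c (trans (sym (lab-mate′ (enc (e , true)))) (cong lab (mate-true e))))))
      c-mate : ∀ i → c (lab (mate i)) ≡ c (lab i)
      c-mate i = trans (cong c (lab-mate′ i)) (c-r i)
    faces : ∀ v l → boundary (λ e → [ l₁ e ]≟ l xor [ l₂ e ]≟ l) v ≡ false
    faces v l = boundary-even (λ i → [ lab i ]≟ l xor [ lab (r i) ]≟ l)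
      (λ i → trans (cong₂ (λ a b → [ a ]≟ l xor [ b ]≟ l) (lab-mate′ i) (lab-mate i)) (𝔹.xor-comm ([ lab (r i) ]≟ l) ([ lab i ]≟ l)))
      (λ i → trans (cong (λ x → ([ lab i ]≟ l xor [ lab (r i) ]≟ l) xor (([ lab (r i) ]≟ l xor [ lab (r (r i)) ]≟ l) xor ([ lab (r (r i)) ]≟ l xor [ lab x ]≟ l))) (ρ³ i)) (xor-triangle ([ lab i ]≟ l) ([ lab (r i) ]≟ l) ([ lab (r (r i)) ]≟ l))) v
    E : Σ (Fin f → Bool) λ c → ∀ e → F (enc (e , true)) ≡ c (l₁ e) xor c (l₂ e)
    E = euler-cyc (λ e → head G (e , true)) (λ e → head G (e , false)) l₁ l₂ (head G (e₀ , true)) (l₁ e₀) euler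
          (λ s h v v′ → reach-inv G s (λ e _ → h e) (connected v v′)) dual faces (λ e → F (enc (e , true))) (boundary-even F F-mate F-even)
    c : Fin f → Bool
    c = proj₁ E
    opposite : ∀ e → F (enc (e , false)) ≡ c (lab (enc (e , false))) xor c (lab (r (enc (e , false))))
    opposite e = trans (cong F (sym (mate-true e))) (trans (F-mate _) (trans (proj₂ E e) (trans (𝔹.xor-comm (c (l₁ e)) (c (l₂ e)))
      (cong₂ (λ a b → c a xor c b) (trans (sym (lab-mate′ _)) (cong lab (mate-true e))) (trans (sym (lab-mate _)) (cong (λ x → lab (r x)) (mate-true e)))))))

  -- The edges of the walk are added modulo 2; at inner vertices the contributions of consecutive
  -- edges cancel.
  path-chain : ∀ {P : Edge G → Set} {e₀} → (∀ {e} → P e → e ≢ e₀) → ∀ {u v} → Reach G P u v → Σ (Edge G → Bool) λ F → F e₀ ≡ false × (∀ w → boundary F w ≡ [ u ]≟ w xor [ v ]≟ w)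
  path-chain ne {u} here = (λ _ → false) , refl , λ w → trans (sum-false (λ e → 𝔹.∧-zeroʳ _)) (sym (𝔹.xor-same ([ u ]≟ w)))
  path-chain {e₀ = e₀} ne {u} {v} (step {w = x} e p j rest) = let F , F₀ , bF = path-chain ne rest in
      (λ e′ → [ e ]≟ e′ xor F e′) , cong₂ _xor_ (does-false (ne p)) F₀ ,
      λ w → trans (sum-cong-≗ (λ e′ → trans (𝔹.∧-distribˡ-xor (inc w e′) ([ e ]≟ e′) (F e′)) (cong (_xor (inc w e′ ∧ F e′)) (𝔹.∧-comm (inc w e′) ([ e ]≟ e′)))))
            (trans (∑-distrib-+ _ _) (trans (cong₂ _xor_ (trans (sum-single e (inc w)) (ends-of w j)) (bF w)) (telescope ([ u ]≟ w) ([ x ]≟ w) ([ v ]≟ w))))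
    where
    inc : Vertex G → Edge G → Bool
    inc w e = [ head G (e , true) ]≟ w xor [ head G (e , false) ]≟ w
    ends-of : ∀ w → Joins G e u x → inc w e ≡ [ u ]≟ w xor [ x ]≟ w
    ends-of w (inj₁ q) = cong₂ (λ a b → [ a ]≟ w xor [ b ]≟ w) (cong proj₁ q) (cong proj₂ q)
    ends-of w (inj₂ q) = trans (cong₂ (λ a b → [ a ]≟ w xor [ b ]≟ w) (cong proj₁ q) (cong proj₂ q)) (𝔹.xor-comm ([ x ]≟ w) ([ u ]≟ w))
    telescope : ∀ a b c → (a xor b) xor (b xor c) ≡ a xor c
    telescope a b c = trans (𝔹.xor-assoc a b (b xor c)) (cong (a xor_) (trans (sym (𝔹.xor-assoc b b c)) (cong (_xor c) (𝔹.xor-same b))))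

  -- An edge with the same face on both sides would be avoided by every even subgraph.
  no-loops : ∀ i → lab i ≢ lab (r i)
  no-loops i same = true≢false on-e (trans (proj₂ C i) (trans (cong (λ l → proj₁ C (lab i) xor proj₁ C l) (sym same)) (𝔹.xor-same (proj₁ C (lab i)))))
    where
    e : Edge G
    e = edgeOf i
    chain : Σ (Edge G → Bool) λ F → F e ≡ false × (∀ w → boundary F w ≡ [ head G (e , true) ]≟ w xor [ head G (e , false) ]≟ w)
    chain = path-chain (λ ne → ne) (bridgeless e (head G (e , true)) (head G (e , false)))
    F : Edge G → Bool
    F e′ = [ e ]≟ e′ xor proj₁ chain e′
    g : Fin N → Bool
    g i = F (edgeOf i)
    on-e : g i ≡ true
    on-e = cong₂ _xor_ (does-refl e) (proj₁ (proj₂ chain))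
    closed : ∀ w → boundary (λ e′ → g (enc (e′ , true))) w ≡ false
    closed w = trans (sum-cong-≗ (λ e′ → trans (cong (λ d → inc e′ ∧ F (proj₁ d)) (dec-enc (e′ , true)))
          (trans (𝔹.∧-distribˡ-xor (inc e′) ([ e ]≟ e′) (proj₁ chain e′)) (cong (_xor (inc e′ ∧ proj₁ chain e′)) (𝔹.∧-comm (inc e′) ([ e ]≟ e′))))))
        (trans (∑-distrib-+ _ _) (trans (cong₂ _xor_ (sum-single e inc) (proj₂ (proj₂ chain) w)) (𝔹.xor-same (inc e))))
      where
      inc : Edge G → Bool
      inc e = [ head G (e , true) ]≟ w xor [ head G (e , false) ]≟ w
    C : Σ (Fin f → Bool) λ c → ∀ i → g i ≡ c (lab i) xor c (lab (r i))
    C = cyc e g (λ i → cong F (edge-mate i)) (even-boundary g (λ i → cong F (edge-mate i)) closed)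

  embedding : Edge G → Map
  embedding e₀ = record
    { al = λ _ → true ; mate = mate ; lab = lab
    ; al-r = λ _ → refl ; al-mate = λ _ → refl ; mate-mate = λ {i} _ → mate-mate i ; lab-mate = λ {i} _ → lab-mate i
    ; loopless = λ {i} _ → no-loops i
    ; conn = λ X X-r X-mate {i} {j} _ _ → conn X (λ i → X-r {i} refl) (λ i → X-mate {i} refl) i j
    ; cyc = λ F F-mate F-even → let c , p = cyc e₀ F (λ i → F-mate {i} refl) (λ i → F-even {i} refl) in c , λ {i} _ → p i
    }

  -- The two alternatives for a given edge

  module _ (e : Edge G) where
    M : Map
    M = embedding e

    t : Fin N
    t = enc (e , true)

    -- The side `X` of the cut through both edges, read on vertices, is constant along every walk
    -- avoiding them but distinguishes the ends of `e`.
    two-edge-cut : ∀ d → d ≢ t → lab t ≡ lab d → lab (r t) ≡ lab (r d) → InTwoEdgeCut G e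
    two-edge-cut d d≢t l l′ = edgeOf d , distinct , λ cn → cut (double M {t} {d} refl refl (λ q → d≢t (sym q)) l l′) cn
      where
      edge-t : edgeOf t ≡ e
      edge-t = cong proj₁ (dec-enc (e , true))
      same-edge : ∀ {i} → e ≡ edgeOf i → i ≡ t ⊎ i ≡ mate t
      same-edge {i} q = by (dec i) refl
        where
        by : ∀ x → dec i ≡ x → i ≡ t ⊎ i ≡ mate t
        by (e′ , true)  p = inj₁ (trans (sym (enc-dec i)) (cong enc (trans p (cong (_, true) (sym (trans q (cong proj₁ p)))))))
        by (e′ , false) p = inj₂ (trans (sym (enc-dec i)) (trans (cong enc (trans p (cong (_, false) (sym (trans q (cong proj₁ p)))))) (sym (mate-true e))))
      distinct : e ≢ edgeOf d
      distinct q with same-edge q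
      ... | inj₁ p = d≢t p
      ... | inj₂ p = no-loops t (trans l (trans (cong lab p) (lab-mate′ t)))
      cut : (Σ (Fin N → Bool) λ X → Double M X t d) → ¬ ConnectedWithout G (λ e′ → (e′ ≡ e) ⊎ (e′ ≡ edgeOf d))
      cut (X , D) cn = true≢false (Double.x D) (trans (sym (onVertices-head X X-r (e , true)))
          (trans (reach-inv G (onVertices X) across (cn (head G (e , true)) (head G (e , false)))) (trans (onVertices-head X X-r (e , false)) (trans (cong X (sym (mate-true e))) (Double.xm D)))))
        where
        X-r : ∀ i → X (r i) ≡ X i
        X-r i = Double.X-r D {i} refl
        across : ∀ e′ → ¬ ((e′ ≡ e) ⊎ (e′ ≡ edgeOf d)) → onVertices X (head G (e′ , true)) ≡ onVertices X (head G (e′ , false))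
        across e′ ne = trans (onVertices-head X X-r (e′ , true)) (trans (by (X i 𝔹.≟ X (mate i))) (trans (cong X (mate-true e′)) (sym (onVertices-head X X-r (e′ , false)))))
          where
          i : Fin N
          i = enc (e′ , true)
          edge-i : edgeOf i ≡ e′
          edge-i = cong proj₁ (dec-enc (e′ , true))
          crossed : (t ≡ i ⊎ mate t ≡ i) ⊎ (d ≡ i ⊎ mate d ≡ i) → ⊥
          crossed (inj₁ (inj₁ p)) = ne (inj₁ (trans (sym edge-i) (trans (cong edgeOf (sym p)) edge-t)))
          crossed (inj₁ (inj₂ p)) = ne (inj₁ (trans (sym edge-i) (trans (cong edgeOf (sym p)) (trans (edge-mate t) edge-t))))
          crossed (inj₂ (inj₁ p)) = ne (inj₂ (trans (sym edge-i) (cong edgeOf (sym p))))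
          crossed (inj₂ (inj₂ p)) = ne (inj₂ (trans (sym edge-i) (trans (cong edgeOf (sym p)) (edge-mate d))))
          by : Dec (X i ≡ X (mate i)) → X i ≡ X (mate i)
          by (yes q) = q
          by (no ¬q) = ⊥-elim (crossed (Double.cross D {i} refl ¬q))

    bridge-over : (∀ {d} → true ≡ true → lab d ≡ lab t → lab (r d) ≡ lab (r t) → d ≡ t) → Bridged M t
    bridge-over only with lab (r (r t)) ≟ lab (r (r (mate t)))
    ... | no ne = contract-solve M {t} refl ne only (λ M′ _ → solvable M′)
    ... | yes q = let c , p , c₁ , c₂ , c₃ = odd-one-out {M} (edge-solvable {M} (solvable M)) {r (r t)} refl true in
      bridged c p (trans (cong (λ x → c (lab x)) (sym (ρ³ t))) c₂) (trans (cong (λ x → c (lab (r x))) (sym (ρ³ t))) c₃) c₁ (trans (cong c (sym q)) c₁) (λ k _ → cong k q)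

    -- If the two ends of e were on different cycles, one of these would be the boundary of a set c₁ of
    -- faces on which, by linkedness, both faces at the ends of e agree.
    chord : Bridged M t → ∃[ F ] ∃[ w ] (IsTwoFactor G F × IsChord G F w e)
    chord (bridged c proper c-t c-rt c-rrt c-opp linked) = F , head G (e , true) , two-factor , (λ (p , _) → subst T F-e p) , here , reached (reach? G (λ e → T? (F e)) (head G (e , true)) (head G (e , false)))
      where
      δ : Fin N → Bool
      δ i = c (lab i) xor c (lab (r i))
      F : Edge G → Bool
      F e = δ (enc (e , true))
      δ-mate : ∀ i → δ (mate i) ≡ δ i
      δ-mate i = trans (cong₂ (λ a b → c a xor c b) (lab-mate′ i) (lab-mate i)) (𝔹.xor-comm (c (lab (r i))) (c (lab i)))
      δ-F : ∀ i → δ i ≡ F (edgeOf i)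
      δ-F = dart-cases _ (λ e → cong (λ d → F (proj₁ d)) (sym (dec-enc (e , true))))
        (λ e → trans (cong δ (sym (mate-true e))) (trans (δ-mate _) (cong (λ d → F (proj₁ d)) (sym (dec-enc (e , false))))))
      δ-even : ∀ i → δ i xor (δ (r i) xor δ (r (r i))) ≡ false
      δ-even i = trans (cong (λ x → δ i xor (δ (r i) xor (c (lab (r (r i))) xor c (lab x)))) (ρ³ i)) (xor-triangle (c (lab i)) (c (lab (r i))) (c (lab (r (r i)))))
      F-e : F e ≡ false
      F-e = cong₂ _xor_ c-t c-rt
      two : ∀ a b c → Mixed a b c → bit (a xor b) + (bit (b xor c) + bit (c xor a)) ≡ 2
      two true  true  true  h = ⊥-elim (h (refl , refl))
      two true  true  false h = refl
      two true  false true  h = refl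
      two true  false false h = refl
      two false true  true  h = refl
      two false true  false h = refl
      two false false true  h = refl
      two false false false h = ⊥-elim (h (refl , refl))
      two-factor : IsTwoFactor G F
      two-factor v = let d , q = inhabited v in trans (degree-darts F v) (trans (∑-cong (λ i → cong (λ b → bit ([ H i ]≟ v) * bit b) (sym (δ-F i))))
        (trans (cong (λ v → ∑ (λ i → bit ([ H i ]≟ v) * bit (δ i))) (sym q)) (trans (∑-fibre (λ i → bit (δ i)) d)
        (trans (cong (λ x → bit (δ d) + (bit (δ (r d)) + bit (c (lab (r (r d))) xor c (lab x)))) (ρ³ d)) (two (c (lab d)) (c (lab (r d))) (c (lab (r (r d)))) (proper {d} refl))))))
      reached : Dec (Reach G (λ e → T (F e)) (head G (e , true)) (head G (e , false))) → Reach G (λ e → T (F e)) (head G (e , true)) (head G (e , false))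
      reached (yes R) = R
      -- `A`, `B` are the sides of `e` and `U`, `W` the faces at its ends. Around the closed curve
      -- `A`, `B`, `U`, `W` the colour `c₁` would change exactly once: between `B` and `U`, where
      -- the curve crosses the cycle through `u`. The crossing between `W` and `A` is at the other
      -- end of `e`, assumed not to be on that cycle.
      reached (no ¬R) = ⊥-elim (true≢false B≢U (trans (cong₂ _xor_ (sym A≡B) (trans U≡W (sym A≡W))) (𝔹.xor-same (c₁ (lab t)))))
        where
        u : Vertex G
        u = head G (e , true)
        opaque
          on? : ∀ v → Dec (Reach G (λ e → T (F e)) u v)
          on? = reach? G (λ e → T? (F e)) u
        X : Vertex G → Bool
        X v = does (on? v)
        X-yes : ∀ {v} → Reach G (λ e → T (F e)) u v → X v ≡ true
        X-yes {v} R with on? v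
        ... | yes _ = refl
        ... | no ¬R = ⊥-elim (¬R R)
        X-no : ∀ {v} → ¬ Reach G (λ e → T (F e)) u v → X v ≡ false
        X-no {v} ¬R with on? v
        ... | yes R = ⊥-elim (¬R R)
        ... | no _  = refl
        X-edge : ∀ e′ → F e′ ≡ true → X (head G (e′ , true)) ≡ X (head G (e′ , false))
        X-edge e′ q with on? (head G (e′ , true)) | on? (head G (e′ , false))
        ... | yes _ | yes _ = refl
        ... | no _  | no _  = refl
        ... | yes R | no ¬R = ⊥-elim (¬R (reach-trans G R (step e′ (subst T (sym q) _) (inj₁ refl) here)))
        ... | no ¬R | yes R = ⊥-elim (¬R (reach-trans G R (step e′ (subst T (sym q) _) (inj₂ refl) here)))
        F₁ : Fin N → Bool
        F₁ i = δ i ∧ X (H i)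
        H-enc : ∀ d → H (enc d) ≡ head G d
        H-enc d = cong (head G) (dec-enc d)
        F₁-mate : ∀ i → F₁ (mate i) ≡ F₁ i
        F₁-mate i = trans (cong (_∧ X (H (mate i))) (δ-mate i)) (by (δ i) refl)
          where
          X-mate : ∀ i → δ i ≡ true → X (H (mate i)) ≡ X (H i)
          X-mate = dart-cases _ (λ e′ q → trans (cong X (trans (cong H (mate-true e′)) (H-enc (e′ , false)))) (trans (sym (X-edge e′ q)) (cong X (sym (H-enc (e′ , true))))))
            (λ e′ q → trans (cong X (trans (cong H (mate-false e′)) (H-enc (e′ , true)))) (trans (X-edge e′ (trans (sym (trans (cong δ (sym (mate-true e′))) (δ-mate _))) q)) (cong X (sym (H-enc (e′ , false))))))
          by : ∀ b → δ i ≡ b → δ i ∧ X (H (mate i)) ≡ F₁ i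
          by true  q = cong (δ i ∧_) (X-mate i q)
          by false q = trans (cong (_∧ X (H (mate i))) q) (cong (_∧ X (H i)) (sym q))
        F₁-even : ∀ i → F₁ i xor (F₁ (r i) xor F₁ (r (r i))) ≡ false
        F₁-even i = trans (cong₂ (λ a b → F₁ i xor ((δ (r i) ∧ a) xor (δ (r (r i)) ∧ b))) (cong X (H-r i)) (cong X (trans (H-r (r i)) (H-r i))))
          (trans (factor (δ i) (δ (r i)) (δ (r (r i))) (X (H i))) (cong (_∧ X (H i)) (δ-even i)))
          where
          factor : ∀ a b c x → (a ∧ x) xor ((b ∧ x) xor (c ∧ x)) ≡ (a xor (b xor c)) ∧ x
          factor a b c x = sym (trans (𝔹.∧-distribʳ-xor x a (b xor c)) (cong ((a ∧ x) xor_) (𝔹.∧-distribʳ-xor x b c)))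
        C : Σ (Fin f → Bool) λ c₁ → ∀ i → F₁ i ≡ c₁ (lab i) xor c₁ (lab (r i))
        C = cyc e F₁ F₁-mate F₁-even
        c₁ : Fin f → Bool
        c₁ = proj₁ C
        off-F : ∀ i → δ i ≡ false → c₁ (lab i) ≡ c₁ (lab (r i))
        off-F i q = xor-cancel (trans (sym (proj₂ C i)) (cong (_∧ X (H i)) q))
        A≡B : c₁ (lab t) ≡ c₁ (lab (r t))
        A≡B = off-F t F-e
        U≡W : c₁ (lab (r (r t))) ≡ c₁ (lab (r (r (mate t))))
        U≡W = linked c₁ (λ {i} _ p q → off-F i (cong₂ _xor_ p q))
        B≢U : c₁ (lab (r t)) xor c₁ (lab (r (r t))) ≡ true
        B≢U = trans (sym (proj₂ C (r t))) (cong₂ _∧_ (cong₂ _xor_ c-rt c-rrt) (trans (cong X (trans (H-r t) (H-enc (e , true)))) (X-yes here)))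
        A≡W : c₁ (lab t) ≡ c₁ (lab (r (r (mate t))))
        A≡W = trans (cong c₁ (sym (lab-mate t))) (xor-cancel (trans (sym (proj₂ C (r (mate t)))) (trans (cong (δ (r (mate t)) ∧_)
          (trans (cong X (trans (H-r (mate t)) (trans (cong H (mate-true e)) (H-enc (e , false))))) (X-no ¬R))) (𝔹.∧-zeroʳ (δ (r (mate t)))))))

-- A second edge between the two faces at `e` completes a 2-edge-cut. Without one, merging the two
-- sides of `e` makes no face adjacent to itself, and a bridged colouring exists.
theorem3 : (G : Graph) → TwoEdgeConnected G → Planar G → Cubic G →
    (e : Edge G) →
    InTwoEdgeCut G e ⊎ (∃[ F ] ∃[ w ] (IsTwoFactor G F × IsChord G F w e))
theorem3 G (connected , bridgeless) (σ , f , rotation , orbits , euler) cubic e = by (any? λ d → ¬? (d ≟ t e) ×-dec (lab (t e) ≟ lab d) ×-dec (lab (r (t e)) ≟ lab (r d)))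
  where
  open Embedding G connected bridgeless cubic σ rotation orbits euler using (r; lab; t; two-edge-cut; bridge-over; chord)
  by : Dec (∃[ d ] (d ≢ t e × lab (t e) ≡ lab d × lab (r (t e)) ≡ lab (r d))) → InTwoEdgeCut G e ⊎ (∃[ F ] ∃[ w ] (IsTwoFactor G F × IsChord G F w e))
  by (yes (d , ne , l , l′)) = inj₁ (two-edge-cut e d ne l l′)
  by (no none) = inj₂ (chord e (bridge-over e (λ {d} _ l l′ → only d l l′)))
    where
    only : ∀ d → lab d ≡ lab (t e) → lab (r d) ≡ lab (r (t e)) → d ≡ t e
    only d l l′ with d ≟ t e
    ... | yes q = q
    ... | no ne = ⊥-elim (none (d , ne , sym l , sym l′))
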